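{- Let $G$ be a strongly connected digraph of order $p\geq 3$ such that $d(x)+d(y)\geq 2p-2$ for every pair of non-adjacent vertices $x,y$ of $G$. Then $G$ contains a Hamiltonian bypass, unless $G$ is isomorphic to a digraph of type $D_0$, or $G$ is isomorphic to $D_{p-k,k}$ for some $k\in[1,p-2]$, or $G$ is isomorphic to $T_5$ or to $C_3$.
   Context: Digraphs are finite, without loops and without multiple arcs (a pair of opposite arcs $xy,yx$ is allowed). For a vertex $x$, $d(x)=od(x)+id(x)$ is the sum of its out-degree and in-degree. Two distinct vertices are adjacent if at least one of the arcs $xy$, $yx$ is present. A Hamiltonian bypass in a digraph $G$ of order $p$ is a subdigraph consisting of a Hamiltonian path $v_1v_2\ldots v_p$ of $G$ together with the arc $v_1v_p$ (i.e., a Hamiltonian path whose initial vertex dominates its terminal vertex). $K^*_n$ denotes the complete symmetric digraph on $n$ vertices (every ordered pair of distinct vertices is an arc). For $k\in[1,p-2]$, $D_{p-k,k}$ is the digraph of order $p$ obtained from $K^*_{p-k}$ and $K^*_{k+1}$ by identifying a vertex of the first with a vertex of the second. A digraph of type $D_0$ is any digraph of odd order $p\geq 3$ whose vertex set is a disjoint union $A\cup B$ where $A$ is an independent set of $(p+1)/2$ vertices, $B$ is a set of $(p-1)/2$ vertices inducing an arbitrary subdigraph, and all arcs $ab$ and $ba$ with $a\in A$, $b\in B$ are present. $T_5$ is the tournament with vertex set $\{z_1,z_2,z_3,z_4,y\}$ and arc set $\{z_1z_2,z_2z_3,z_3z_4,z_4z_1,z_1y,z_3y,yz_2,yz_4,z_1z_3,z_2z_4\}$.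 $C_3$ is the directed cycle of length three. -}

module Defs where

open import Data.Nat using (ℕ; zero; suc; _+_; _*_; _∸_; _≤_; _<_)
open import Data.Fin using (Fin; zero; suc; toℕ; inject₁; fromℕ)
open import Data.Bool using (Bool; true; false; if_then_else_; _∧_; _∨_; not)
open import Data.Product using (Σ; ∃; _×_; _,_)
open import Data.Sum using (_⊎_)
open import Relation.Nullary using (¬_; Dec; yes; no; does)
open import Relation.Binary.PropositionalEquality using (_≡_; _≢_)
open import Function.Definitions using (Injective)
import Data.Fin as F
import Data.Nat as N

record Digraph (n : ℕ) : Set where
  field
    arc      : Fin n → Fin n → Bool
    loopless : ∀ x → arc x x ≡ false
open Digraph public

countB : ∀ {n} → (Fin n → Bool) → ℕ
countB {zero}  f = 0
countB {suc n} f = (if f zero then 1 else 0) + countB (λ i → f (suc i))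

outdeg indeg deg : ∀ {n} → Digraph n → Fin n → ℕ
outdeg G x = countB (λ y → arc G x y)
indeg  G x = countB (λ y → arc G y x)
deg    G x = outdeg G x + indeg G x

NonAdjacent : ∀ {n} → Digraph n → Fin n → Fin n → Set
NonAdjacent G x y = x ≢ y × arc G x y ≡ false × arc G y x ≡ false

data Reach {n} (G : Digraph n) : Fin n → Fin n → Set where
  here : ∀ {x} → Reach G x x
  step : ∀ {x y z} → arc G x y ≡ true → Reach G y z → Reach G x z

StronglyConnected : ∀ {n} → Digraph n → Set
StronglyConnected G = ∀ x y → Reach G x y

HamiltonianBypass : ∀ {m} → Digraph (suc m) → Set
HamiltonianBypass {m} G =
  Σ (Fin (suc m) → Fin (suc m)) λ v →
    Injective _≡_ _≡_ v
    × (∀ (i : Fin m) → arc G (v (inject₁ i)) (v (suc i)) ≡ true)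
    × arc G (v zero) (v (fromℕ m)) ≡ true

record _≅_ {p q} (G : Digraph p) (H : Digraph q) : Set where
  field
    to       : Fin p → Fin q
    from     : Fin q → Fin p
    from∘to  : ∀ x → from (to x) ≡ x
    to∘from  : ∀ y → to (from y) ≡ y
    arc-pres : ∀ x y → arc H (to x) (to y) ≡ arc G x y

-- digraph of type D0 (order p = 2m+1 with m ≥ 1): inA marks A, the rest is B
IsTypeD0 : ∀ {p} → Digraph p → Set
IsTypeD0 {p} H =
  Σ ℕ λ m → p ≡ 2 * m + 1 × 1 ≤ m ×
  Σ (Fin p → Bool) λ inA →
    countB inA ≡ m + 1
    × (∀ a a' → inA a ≡ true → inA a' ≡ true → arc H a a' ≡ false)
    × (∀ a b → inA a ≡ true → inA b ≡ false → arc H a b ≡ true × arc H b a ≡ true)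

-- D_{p-k,k}: K*_{p-k} on vertices 0..p-k-1 and K*_{k+1} on vertices p-k-1..p-1,
-- sharing the vertex p-k-1.
D : (p k : ℕ) → Digraph p
D p k = record { arc = a ; loopless = ll }
  where
  a : Fin p → Fin p → Bool
  a x y = not (does (x F.≟ y)) ∧
          ((does (suc (toℕ x) N.≤? p ∸ k) ∧ does (suc (toℕ y) N.≤? p ∸ k))
           ∨ (does (p ∸ k ∸ 1 N.≤? toℕ x) ∧ does (p ∸ k ∸ 1 N.≤? toℕ y)))
  ll : ∀ x → a x x ≡ false
  ll x with x F.≟ x
  ... | yes _ = Relation.Binary.PropositionalEquality.refl
  ... | no x≢x = Data.Empty.⊥-elim (x≢x Relation.Binary.PropositionalEquality.refl)
    where import Data.Empty

-- T5: z1,z2,z3,z4,y are 0,1,2,3,4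
T5 : Digraph 5
T5 = record { arc = a ; loopless = ll }
  where
  a : Fin 5 → Fin 5 → Bool
  a zero (suc zero) = true
  a (suc zero) (suc (suc zero)) = true
  a (suc (suc zero)) (suc (suc (suc zero))) = true
  a (suc (suc (suc zero))) zero = true
  a zero (suc (suc (suc (suc zero)))) = true
  a (suc (suc zero)) (suc (suc (suc (suc zero)))) = true
  a (suc (suc (suc (suc zero)))) (suc zero) = true
  a (suc (suc (suc (suc zero)))) (suc (suc (suc zero))) = true
  a zero (suc (suc zero)) = true
  a (suc zero) (suc (suc (suc zero))) = true
  a _ _ = false
  ll : ∀ x → a x x ≡ false
  ll zero = Relation.Binary.PropositionalEquality.refl
  ll (suc zero) = Relation.Binary.PropositionalEquality.refl
  ll (suc (suc zero)) = Relation.Binary.PropositionalEquality.refl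
  ll (suc (suc (suc zero))) = Relation.Binary.PropositionalEquality.refl
  ll (suc (suc (suc (suc zero)))) = Relation.Binary.PropositionalEquality.refl

C3 : Digraph 3
C3 = record { arc = a ; loopless = ll }
  where
  a : Fin 3 → Fin 3 → Bool
  a zero (suc zero) = true
  a (suc zero) (suc (suc zero)) = true
  a (suc (suc zero)) zero = true
  a _ _ = false
  ll : ∀ x → a x x ≡ false
  ll zero = Relation.Binary.PropositionalEquality.refl
  ll (suc zero) = Relation.Binary.PropositionalEquality.refl
  ll (suc (suc zero)) = Relation.Binary.PropositionalEquality.refl

{-# OPTIONS --safe #-}

-- Let p = n + 1, and suppose that G has no hamiltonian bypass and is not exceptional.  Everything rests on
-- inserting vertices into walks: a vertex that cannot be inserted into a walk on k vertices has at most k + 1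
-- arcs to and from it.
--
-- (1) If G − y has a hamiltonian cycle C, then no two consecutive vertices of C both dominate y, or are both
--     dominated by y; so d(y) ≤ n.  If d(y) = n, the neighbours of y alternate on C, and either G has type D₀ or
--     y is adjacent to every vertex by a single arc.  In the latter case C is 2-coloured by the direction of
--     these arcs, no hamiltonian path of G − y joins two vertices of one colour, and this leaves only T₅.
--     If d(y) < n, then inserting the non-neighbours of y between two of its consecutive neighbours on C into the
--     rest of C contradicts the degree condition, up to the case D_{p-1,1}.
-- (2) Otherwise no G − y is hamiltonian.  G has a hamiltonian path by the argument of Bondy and Thomassen, and
--     one with non-adjacent ends unless G is C₃.  Moving an end vertex of such a path into its interior again gives
--     a path with non-adjacent ends.  Iterating at both ends produces a path M ++ K ++ N all of whose vertices in M
--     (in N) can be made first (last), and cannot be inserted into K.  Then the degree sum of a vertex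
--     of M and one of N is at most 2n.  Equality makes M and N cliques joined to the ends of K, which gives
--     D_{p-k,k} if K is a single vertex, and a bypass or a cycle of length n otherwise.
--
-- All case distinctions on the existence of walks are made inside a proof of ⊥, which suffices since the
-- conclusion is decidable by search.
module Submission where

open import Defs
open import Data.Bool using (Bool; true; false; if_then_else_; _∧_; _∨_)
import Data.Bool as Bool
open import Data.Empty using (⊥; ⊥-elim)
open import Data.Fin using (Fin; zero; suc; toℕ; inject₁; fromℕ)
import Data.Fin as Fin
import Data.Fin.Properties as Fin
open import Data.List using (List; []; _∷_; [_]; _++_; length; map; reverse; lookup; allFin; tabulate)
import Data.List.Properties as List
open import Data.List.Membership.Propositional using (_∈_)
import Data.List.Membership.Propositional.Properties as Mem
open import Data.List.Relation.Binary.Permutation.Propositional using (_↭_; ↭-refl; ↭-reflexive; ↭-sym; ↭-trans; prep)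
import Data.List.Relation.Binary.Permutation.Propositional.Properties as Perm
open import Data.List.Relation.Unary.All using (All; []; _∷_)
import Data.List.Relation.Unary.All as All
import Data.List.Relation.Unary.All.Properties as All
open import Data.List.Relation.Unary.Any using (here; there)
open import Data.List.Relation.Unary.Linked using (Linked; []; [-]; _∷_)
open import Data.List.Relation.Unary.Unique.Propositional using (Unique)
open import Data.List.Relation.Unary.AllPairs using ([]; _∷_)
open import Data.Maybe using (Maybe; just; nothing)
open import Data.Nat using (ℕ; zero; suc; _+_; _*_; _∸_; _≤_; _<_; z≤n; s≤s)
import Data.Nat as Nat
import Data.Nat.Properties as ℕ
open import Data.Nat.ListAction using (sum)
import Data.Nat.ListAction.Properties as Sum
open import Data.Product using (Σ; ∃; _×_; _,_; proj₁; proj₂)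
open import Data.Sum using (_⊎_; inj₁; inj₂)
open import Data.Vec using (Vec; []; _∷_)
import Data.Vec as Vec
open import Function using (_∘_; id; flip)
open import Function.Definitions using (Injective)
open import Relation.Nullary using (¬_; Dec; yes; no; does)
open import Relation.Nullary.Decidable using (map′; _×-dec_; _⊎-dec_; _→-dec_; ¬?)
open import Relation.Binary.PropositionalEquality using (_≡_; _≢_; refl; sym; trans; cong; cong₂; subst; subst₂)

-- The hypothesis lies one below Meyniel's bound 2p - 1, so most degree counts end in equality
-- rather than in a contradiction, and the structure has to be read off from the equality case.
-- Counting lemmas therefore come in pairs: a bound, and a tight form saying that every consecutive
-- pair on the walk attains its local bound. Two outcomes are exploited throughout. A hamiltonian
-- path whose first vertex dominates its last is a bypass. A cycle missing exactly one vertex v caps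
-- the degree of v at n, so a vertex known to have larger degree can never be the missing one. Type
-- D₀ arises because a vertex y of degree n and a non-neighbour of y can be exchanged on the cycle,
-- which forces them to have the same neighbours. A new vertex joined to all others by both arcs
-- adds 4 to each degree sum, while Meyniel's bound grows only by 2; this lifts the hypothesis above
-- that bound, and the hamiltonian cycles of the enlarged digraph are the hamiltonian paths of G.
-- The conditions on a counterexample are invariant under reversal of all arcs, so arguments at one
-- end of a gap or of a path are transferred to the other end.

infixr 7 _⊕_
infix 6 _≈_ _≼_

-- Reflective checkers for list permutations and linear inequalities

data Expr (k : ℕ) : Set where
  var : Fin k → Expr k
  𝟙 ∅ : Expr k
  _⊕_ : Expr k → Expr k → Expr k

data Equation (k : ℕ) : Set where
  _≈_ : Expr k → Expr k → Equation k

data Inequality (k : ℕ) : Set where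
  _≼_ : Expr k → Expr k → Inequality k

vars : ∀ k → Vec (Expr k) k
vars k = Vec.tabulate var

-- The unit 𝟙 is recorded as the variable zero.
atoms : ∀ {k} → Expr k → List (Fin (suc k))
atoms (var i) = suc i ∷ []
atoms 𝟙 = zero ∷ []
atoms ∅ = []
atoms (e ⊕ f) = atoms e ++ atoms f

remove : ∀ {k} → Fin k → List (Fin k) → Maybe (List (Fin k))
remove i [] = nothing
remove i (j ∷ js) with i Fin.≟ j
... | yes _ = just js
... | no _ = Data.Maybe.map (j ∷_) (remove i js)
  where import Data.Maybe

removeAll : ∀ {k} → List (Fin k) → List (Fin k) → Maybe (List (Fin k))
removeAll [] js = just js
removeAll (i ∷ is) js with remove i js
... | nothing = nothing
... | just js′ = removeAll is js′

remove-↭ : ∀ {k} (i : Fin k) js {ks} → remove i js ≡ just ks → js ↭ i ∷ ks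
remove-↭ i (j ∷ js) eq with i Fin.≟ j
remove-↭ i (j ∷ js) refl | yes refl = ↭-refl
remove-↭ i (j ∷ js) eq | no _ with remove i js in eq′
remove-↭ i (j ∷ js) refl | no _ | just ks =
  ↭-trans (prep j (remove-↭ i js eq′)) (_↭_.swap j i ↭-refl)

removeAll-↭ : ∀ {k} (is js : List (Fin k)) {ks} → removeAll is js ≡ just ks → js ↭ is ++ ks
removeAll-↭ [] js refl = ↭-refl
removeAll-↭ (i ∷ is) js eq with remove i js in eq′
... | just js′ = ↭-trans (remove-↭ i js eq′) (prep i (removeAll-↭ is js′ eq))

isEmpty : ∀ {k} → Maybe (List (Fin k)) → Bool
isEmpty (just []) = true
isEmpty _ = false

hasZero : ∀ {k} → Maybe (List (Fin (suc k))) → Bool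
hasZero nothing = false
hasZero (just js) with remove zero js
... | nothing = false
... | just _ = true

module _ {a} {A : Set a} where

  ++-cancelˡ-↭ : ∀ (zs : List A) {xs ys} → zs ++ xs ↭ zs ++ ys → xs ↭ ys
  ++-cancelˡ-↭ [] p = p
  ++-cancelˡ-↭ (z ∷ zs) p = ++-cancelˡ-↭ zs (Perm.drop-∷ p)

  concat-↭ : ∀ {k} (ρ : Fin k → List A) {is js} → is ↭ js →
             Data.List.concatMap ρ is ↭ Data.List.concatMap ρ js
  concat-↭ ρ _↭_.refl = ↭-refl
  concat-↭ ρ (_↭_.prep i p) = Perm.++⁺ˡ (ρ i) (concat-↭ ρ p)
  concat-↭ ρ (_↭_.swap i j p) = ↭-trans (Perm.shifts (ρ i) (ρ j)) (Perm.++⁺ˡ (ρ j) (Perm.++⁺ˡ (ρ i) (concat-↭ ρ p)))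
  concat-↭ ρ (_↭_.trans p q) = ↭-trans (concat-↭ ρ p) (concat-↭ ρ q)

  ⟦_⟧ₗ : ∀ {k} → Expr k → Vec (List A) k → List A
  ⟦ var i ⟧ₗ ρ = Vec.lookup ρ i
  ⟦ 𝟙 ⟧ₗ ρ = []
  ⟦ ∅ ⟧ₗ ρ = []
  ⟦ e ⊕ f ⟧ₗ ρ = ⟦ e ⟧ₗ ρ ++ ⟦ f ⟧ₗ ρ

  ⟦_⟧↭ : ∀ {k} → Equation k → Vec (List A) k → Set a
  ⟦ e ≈ f ⟧↭ ρ = ⟦ e ⟧ₗ ρ ↭ ⟦ f ⟧ₗ ρ

  flattenₗ : ∀ {k} (e : Expr k) ρ → ⟦ e ⟧ₗ ρ ≡ Data.List.concatMap (Vec.lookup ([] ∷ ρ)) (atoms e)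
  flattenₗ (var i) ρ = sym (List.++-identityʳ _)
  flattenₗ 𝟙 ρ = refl
  flattenₗ ∅ ρ = refl
  flattenₗ (e ⊕ f) ρ = trans (cong₂ _++_ (flattenₗ e ρ) (flattenₗ f ρ))
                             (sym (List.concatMap-++ _ (atoms e) (atoms f)))

  left right : ∀ {k} → List (Equation k) → Expr k
  left [] = ∅
  left ((e ≈ _) ∷ hs) = e ⊕ left hs
  right [] = ∅
  right ((_ ≈ f) ∷ hs) = f ⊕ right hs

  combine : ∀ {k} (hs : List (Equation k)) ρ → All (λ h → ⟦ h ⟧↭ ρ) hs → ⟦ left hs ⟧ₗ ρ ↭ ⟦ right hs ⟧ₗ ρ
  combine [] ρ [] = ↭-refl
  combine ((_ ≈ _) ∷ hs) ρ (p ∷ ps) = Perm.++⁺ p (combine hs ρ ps)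

  balanced : ∀ {k} → Equation k × List (Equation k) → Bool
  balanced ((e ≈ f) , hs) = isEmpty (removeAll (atoms (right hs ⊕ e)) (atoms (left hs ⊕ f)))

  -- Each hypothesis is used once. The check makes `right hs ⊕ e` a rearrangement of `left hs ⊕ f`,
  -- the hypotheses turn the latter into `right hs ⊕ f`, and the common prefix cancels.
  balanced-sound : ∀ {k} (goal : Equation k) hs ρ → balanced (goal , hs) ≡ true →
                   All (λ h → ⟦ h ⟧↭ ρ) hs → ⟦ goal ⟧↭ ρ
  balanced-sound (e ≈ f) hs ρ ok ps
    with removeAll (atoms (right hs ⊕ e)) (atoms (left hs ⊕ f)) in eq
  ... | just [] = ++-cancelˡ-↭ (⟦ right hs ⟧ₗ ρ)
          (↭-trans (subst₂ _↭_ (sym (flattenₗ (right hs ⊕ e) ρ)) (sym (flattenₗ (left hs ⊕ f) ρ))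
                     (concat-↭ _ (↭-sym (subst (_ ↭_) (List.++-identityʳ _) (removeAll-↭ (atoms (right hs ⊕ e)) _ eq)))))
                   (Perm.++⁺ʳ (⟦ f ⟧ₗ ρ) (combine hs ρ ps)))

  -- Permutations modulo permutation hypotheses: the goal, added to the reversed hypotheses,
  -- must balance as an identity of multisets of atoms.
  permute : ∀ {k} (ρ : Vec (List A) k) (problem : Vec (Expr k) k → Equation k × List (Equation k)) →
            balanced (problem (vars k)) ≡ true →
            All (λ h → ⟦ h ⟧↭ ρ) (proj₂ (problem (vars k))) →
            ⟦ proj₁ (problem (vars k)) ⟧↭ ρ
  permute ρ problem ok ps = balanced-sound _ _ ρ ok ps

≡⇒≤ : ∀ {i j} → i ≡ j → i ≤ j
≡⇒≤ = ℕ.≤-reflexive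

≡⇒≥ : ∀ {i j} → i ≡ j → j ≤ i
≡⇒≥ e = ℕ.≤-reflexive (sym e)

⟦_⟧ₙ : ∀ {k} → Expr k → Vec ℕ k → ℕ
⟦ var i ⟧ₙ ρ = Vec.lookup ρ i
⟦ 𝟙 ⟧ₙ ρ = 1
⟦ ∅ ⟧ₙ ρ = 0
⟦ e ⊕ f ⟧ₙ ρ = ⟦ e ⟧ₙ ρ + ⟦ f ⟧ₙ ρ

⟦_⟧≤ : ∀ {k} → Inequality k → Vec ℕ k → Set
⟦ e ≼ f ⟧≤ ρ = ⟦ e ⟧ₙ ρ ≤ ⟦ f ⟧ₙ ρ

flattenₙ : ∀ {k} (e : Expr k) ρ → ⟦ e ⟧ₙ ρ ≡ sum (map (Vec.lookup (1 ∷ ρ)) (atoms e))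
flattenₙ (var i) ρ = sym (ℕ.+-identityʳ _)
flattenₙ 𝟙 ρ = refl
flattenₙ ∅ ρ = refl
flattenₙ (e ⊕ f) ρ = trans (cong₂ _+_ (flattenₙ e ρ) (flattenₙ f ρ))
  (sym (trans (cong sum (List.map-++ _ (atoms e) (atoms f))) (Sum.sum-++ (map _ (atoms e)) _)))

lower upper : ∀ {k} → List (Inequality k) → Expr k
lower [] = ∅
lower ((e ≼ _) ∷ hs) = e ⊕ lower hs
upper [] = ∅
upper ((_ ≼ f) ∷ hs) = f ⊕ upper hs

contradictory : ∀ {k} → List (Inequality k) → Bool
contradictory hs = hasZero (removeAll (atoms (upper hs)) (atoms (lower hs)))

add-up : ∀ {k} (hs : List (Inequality k)) ρ → All (λ h → ⟦ h ⟧≤ ρ) hs → ⟦ lower hs ⟧ₙ ρ ≤ ⟦ upper hs ⟧ₙ ρ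
add-up [] ρ [] = z≤n
add-up ((_ ≼ _) ∷ hs) ρ (p ∷ ps) = ℕ.+-mono-≤ p (add-up hs ρ ps)

contradictory-sound : ∀ {k} (hs : List (Inequality k)) ρ → contradictory hs ≡ true →
                      All (λ h → ⟦ h ⟧≤ ρ) hs → ⊥
contradictory-sound hs ρ ok ps with removeAll (atoms (upper hs)) (atoms (lower hs)) in eq
... | just js with remove zero js in eq′
... | just ks = ℕ.<-irrefl refl (ℕ.<-≤-trans bigger (add-up hs ρ ps))
  where
  value : List _ → ℕ
  value is = sum (map (Vec.lookup (1 ∷ ρ)) is)
  lower≡ : ⟦ lower hs ⟧ₙ ρ ≡ ⟦ upper hs ⟧ₙ ρ + suc (value ks)
  lower≡ = trans (flattenₙ (lower hs) ρ)
    (trans (Sum.sum-↭ (Perm.map⁺ _ (removeAll-↭ (atoms (upper hs)) _ eq)))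
    (trans (cong sum (List.map-++ _ (atoms (upper hs)) js))
    (trans (Sum.sum-++ (map _ (atoms (upper hs))) _)
    (cong₂ _+_ (sym (flattenₙ (upper hs) ρ)) (Sum.sum-↭ (Perm.map⁺ _ (remove-↭ zero js eq′)))))))
  bigger : ⟦ upper hs ⟧ₙ ρ < ⟦ lower hs ⟧ₙ ρ
  bigger = subst (⟦ upper hs ⟧ₙ ρ <_) (sym lower≡) (ℕ.m<m+n _ (s≤s z≤n))

-- Linear inequalities whose sum is a contradiction: the left-hand sides contain all
-- the atoms of the right-hand sides and an additional 1.
absurd : ∀ {k} (ρ : Vec ℕ k) (system : Vec (Expr k) k → List (Inequality k)) →
         contradictory (system (vars k)) ≡ true →
         All (λ h → ⟦ h ⟧≤ ρ) (system (vars k)) → ⊥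
absurd ρ system ok ps = contradictory-sound _ ρ ok ps


-- Sums over lists and relations between consecutive entries

∑ : {V : Set} → (V → ℕ) → List V → ℕ
∑ f L = sum (map f L)

∑-↭ : ∀ {V : Set} (f : V → ℕ) {L L′} → L ↭ L′ → ∑ f L ≡ ∑ f L′
∑-↭ f p = Sum.sum-↭ (Perm.map⁺ f p)

∑-++ : ∀ {V : Set} (f : V → ℕ) L L′ → ∑ f (L ++ L′) ≡ ∑ f L + ∑ f L′
∑-++ f L L′ = trans (cong sum (List.map-++ f L L′)) (Sum.sum-++ (map f L) _)

∑-bound : ∀ {V : Set} (f : V → ℕ) → (∀ v → f v ≤ 1) → ∀ L → ∑ f L ≤ length L
∑-bound f f≤1 [] = z≤n
∑-bound f f≤1 (x ∷ L) = ℕ.+-mono-≤ (f≤1 x) (∑-bound f f≤1 L)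

∑-zero : ∀ {V : Set} (f : V → ℕ) {L} → All (λ v → f v ≡ 0) L → ∑ f L ≡ 0
∑-zero f [] = refl
∑-zero f (e ∷ es) = cong₂ _+_ e (∑-zero f es)

module _ {V : Set} {R : V → V → Set} where

  linked-++ˡ : ∀ A {B} → Linked R (A ++ B) → Linked R A
  linked-++ˡ [] l = []
  linked-++ˡ (x ∷ []) l = [-]
  linked-++ˡ (x ∷ y ∷ A) (r ∷ l) = r ∷ linked-++ˡ (y ∷ A) l

  linked-++ʳ : ∀ A {B} → Linked R (A ++ B) → Linked R B
  linked-++ʳ [] l = l
  linked-++ʳ (x ∷ []) {[]} l = []
  linked-++ʳ (x ∷ []) {_ ∷ _} (_ ∷ l) = l
  linked-++ʳ (x ∷ y ∷ A) (_ ∷ l) = linked-++ʳ (y ∷ A) l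

  linked-at : ∀ A {u v B} → Linked R (A ++ u ∷ v ∷ B) → R u v
  linked-at A l with linked-++ʳ A l
  ... | r ∷ _ = r

  linked-∷ʳ : ∀ A {u v} → Linked R (A ++ u ∷ []) → R u v → Linked R ((A ++ u ∷ []) ++ v ∷ [])
  linked-∷ʳ [] [-] r = r ∷ [-]
  linked-∷ʳ (x ∷ []) (r′ ∷ l) r = r′ ∷ linked-∷ʳ [] l r
  linked-∷ʳ (x ∷ y ∷ A) (r′ ∷ l) r = r′ ∷ linked-∷ʳ (y ∷ A) l r

linked-map : ∀ {V : Set} {R S : V → V → Set} → (∀ {u v} → R u v → S u v) → ∀ {L} → Linked R L → Linked S L
linked-map f [] = []
linked-map f [-] = [-]
linked-map f (r ∷ l) = f r ∷ linked-map f l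

linked-reverse : ∀ {V : Set} {R : V → V → Set} L → Linked R L → Linked (flip R) (reverse L)
linked-reverse [] l = []
linked-reverse (x ∷ []) l = [-]
linked-reverse (x ∷ y ∷ L) (r ∷ l)
  rewrite List.unfold-reverse x (y ∷ L) | List.unfold-reverse y L =
  linked-∷ʳ (reverse L) (subst (Linked _) (List.unfold-reverse y L) (linked-reverse (y ∷ L) l)) r

-- Walks, insertion of vertices, and the resulting degree bounds

module Walks {V : Set} (arc : V → V → Bool) where

  infixr 5 _▹_ _⧺_

  E : V → V → Set
  E u v = arc u v ≡ true

  E? : ∀ u v → Dec (E u v)
  E? u v = arc u v Bool.≟ true

  χ : V → V → ℕ
  χ u v = if arc u v then 1 else 0

  χ≤1 : ∀ u v → χ u v ≤ 1
  χ≤1 u v with arc u v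
  ... | true = s≤s z≤n
  ... | false = z≤n

  χ-arc : ∀ {u v} → E u v → χ u v ≡ 1
  χ-arc e rewrite e = refl

  χ-no-arc : ∀ {u v} → ¬ E u v → χ u v ≡ 0
  χ-no-arc {u} {v} ¬e with arc u v
  ... | true = ⊥-elim (¬e refl)
  ... | false = refl

  arc-χ : ∀ {u v} → 1 ≤ χ u v → E u v
  arc-χ {u} {v} h with arc u v
  ... | true = refl
  ... | false with h
  ... | ()

  none : ∀ {u v} → χ u v ≡ 0 → ¬ E u v
  none {u} {v} z e with trans (sym (χ-arc e)) z
  ... | ()

  one : ∀ {u v} → χ u v ≡ 1 → E u v
  one z = arc-χ (ℕ.≤-reflexive (sym z))

  dg : V → List V → ℕ
  dg x L = ∑ (χ x) L + ∑ (λ v → χ v x) L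

  dg-↭ : ∀ x {L L′} → L ↭ L′ → dg x L ≡ dg x L′
  dg-↭ x p = cong₂ _+_ (∑-↭ _ p) (∑-↭ _ p)

  dg-++ : ∀ x L L′ → dg x (L ++ L′) ≡ dg x L + dg x L′
  dg-++ x L L′ = ℕ.≤-antisym
    (ℕ.≮⇒≥ λ h → (absurd ((dg x L) ∷ (dg x L′) ∷ (∑ (χ x) (L ++ L′)) ∷
          (∑ (λ v → χ v x) (L ++ L′)) ∷ (∑ (χ x) L) ∷ (∑ (χ x) L′) ∷ (∑ (λ v → χ v x) L) ∷
          (∑ (λ v → χ v x) L′) ∷ [])
        (λ { (a ∷ b ∷ c ∷ d ∷ e ∷ f ∷ g ∷ h ∷ []) → 𝟙 ⊕ a ⊕ b ≼ c ⊕ d ∷ c ≼ e ⊕ f ∷ d ≼ g ⊕ h ∷ e ⊕ g ≼ a ∷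
              f ⊕ h ≼ b ∷ [] })
        refl (h ∷ ≡⇒≤ (∑-++ (χ x) L L′) ∷ ≡⇒≤ (∑-++ (λ v → χ v x) L L′) ∷ ≡⇒≥ refl ∷ ≡⇒≥ refl ∷ [])))
    (ℕ.≮⇒≥ λ h → (absurd ((∑ (χ x) (L ++ L′)) ∷ (∑ (λ v → χ v x) (L ++ L′)) ∷
          (dg x L) ∷ (dg x L′) ∷ (∑ (χ x) L) ∷ (∑ (χ x) L′) ∷ (∑ (λ v → χ v x) L) ∷ (∑ (λ v → χ v x) L′) ∷ [])
        (λ { (a ∷ b ∷ c ∷ d ∷ e ∷ f ∷ g ∷ h ∷ []) → 𝟙 ⊕ a ⊕ b ≼ c ⊕ d ∷ e ⊕ f ≼ a ∷ g ⊕ h ≼ b ∷ c ≼ e ⊕ g ∷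
              d ≼ f ⊕ h ∷ [] })
        refl (h ∷ ≡⇒≥ (∑-++ (χ x) L L′) ∷ ≡⇒≥ (∑-++ (λ v → χ v x) L L′) ∷ ≡⇒≤ refl ∷ ≡⇒≤ refl ∷ [])))

  dg-length : ∀ x L → dg x L ≤ length L + length L
  dg-length x L = ℕ.+-mono-≤ (∑-bound _ (λ v → χ≤1 x v) L) (∑-bound _ (λ v → χ≤1 v x) L)

  dg≤2 : ∀ x v → dg x (v ∷ []) ≤ 2
  dg≤2 x v = dg-length x (v ∷ [])

  NonAdj : V → V → Set
  NonAdj x y = ¬ E x y × ¬ E y x

  dg≤1ˡ : ∀ {x v} → ¬ E x v → dg x (v ∷ []) ≤ 1
  dg≤1ˡ {x} {v} ¬e = subst (λ k → (k + 0) + (χ v x + 0) ≤ 1) (sym (χ-no-arc ¬e)) (∑-bound (λ u → χ u x) (λ u → χ≤1 u x) (v ∷ []))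

  dg≤1ʳ : ∀ {x v} → ¬ E v x → dg x (v ∷ []) ≤ 1
  dg≤1ʳ {x} {v} ¬e = subst (_≤ 1) (ℕ.+-comm (χ v x + 0) _)
    (subst (λ k → (k + 0) + (χ x v + 0) ≤ 1) (sym (χ-no-arc ¬e)) (∑-bound (χ x) (χ≤1 x) (v ∷ [])))

  dg-nonadj : ∀ x {L} → All (NonAdj x) L → dg x L ≡ 0
  dg-nonadj x as = cong₂ _+_ (∑-zero _ (All.map (λ h → χ-no-arc (proj₁ h)) as))
                             (∑-zero _ (All.map (λ h → χ-no-arc (proj₂ h)) as))

  nonadj? : ∀ x y → Dec (NonAdj x y)
  nonadj? x y = ¬? (E? x y) ×-dec ¬? (E? y x)

  -- Walk x L y visits the vertices x ∷ L in this order and ends in y.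
  data Walk : V → List V → V → Set where
    nil : ∀ {x} → Walk x [] x
    _▹_ : ∀ {x y z L} → E x y → Walk y L z → Walk x (y ∷ L) z

  _⧺_ : ∀ {x y z L L′} → Walk x L y → Walk y L′ z → Walk x (L ++ L′) z
  nil ⧺ w′ = w′
  (e ▹ w) ⧺ w′ = e ▹ (w ⧺ w′)

  [_]ʷ : ∀ {x y} → E x y → Walk x (y ∷ []) y
  [ e ]ʷ = e ▹ nil

  last∈ : ∀ {x L z} → Walk x L z → z ∈ (x ∷ L)
  last∈ nil = here refl
  last∈ (_ ▹ w) = there (last∈ w)

  end∈ : ∀ {x v L z} → Walk x (v ∷ L) z → z ∈ (v ∷ L)
  end∈ (_ ▹ w) = last∈ w

  data Split (x : V) (L : List V) (z : V) : V → Set where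
    split : ∀ {y A B} → Walk x A y → Walk y B z → L ≡ A ++ B → Split x L z y

  split-at : ∀ {x L z} → Walk x L z → ∀ {y} → y ∈ (x ∷ L) → Split x L z y
  split-at w (here refl) = split nil w refl
  split-at (e ▹ w) (there i) with split-at w i
  ... | split w₁ w₂ refl = split (e ▹ w₁) w₂ refl

  walk-∷ʳ : ∀ {x v L y} → Walk x (v ∷ L) y → ∃ λ u → ∃ λ L′ → Walk x L′ u × E u y × v ∷ L ≡ L′ ++ y ∷ []
  walk-∷ʳ (e ▹ nil) = _ , _ , nil , e , refl
  walk-∷ʳ {x} (e ▹ w@(_ ▹ _)) with walk-∷ʳ w
  ... | u , L′ , w′ , e′ , eq = u , _ , e ▹ w′ , e′ , cong (_ ∷_) eq

  linked-join : ∀ {R : V → V → Set} {x L y z B} → Walk x L y → Linked R ((x ∷ L) ++ z ∷ B) → R y z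
  linked-join nil (r ∷ _) = r
  linked-join (_ ▹ w) (_ ∷ l) = linked-join w l

  rotate-closed : ∀ {c L x} → Walk c L c → x ∈ L → ∃ λ L′ → Walk x L′ x × L′ ↭ L
  rotate-closed w i with split-at w (there i)
  ... | split {A = A} {B} w₁ w₂ refl = B ++ A , w₂ ⧺ w₁ , Perm.++-comm B A

  -- The relation may depend on the two remainders of the walk around the pair. On a closed walk
  -- these, taken in the opposite order, form the walk from `v` all the way round to `u`.
  linked-pairs : ∀ {x L y} {R : V → V → Set} → Walk x L y →
                 (∀ {u v A B} → Walk x A u → E u v → Walk v B y → L ≡ A ++ v ∷ B → R u v) → Linked R (x ∷ L)
  linked-pairs nil h = [-]
  linked-pairs (e ▹ w) h = h nil e w refl ∷ linked-pairs w (λ w₁ e′ w₂ eq → h (e ▹ w₁) e′ w₂ (cong (_ ∷_) eq))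

  -- Adding the inequalities of all consecutive pairs counts `f` everywhere but at the last vertex
  -- and `g` everywhere but at the first; the two missing terms reappear on the right. The `+ 1` on
  -- the left stands for having one pair fewer than vertices.
  linked-bound : ∀ (f g : V → ℕ) {x L y} → Walk x L y → Linked (λ u v → f u + g v ≤ 1) (x ∷ L) →
                 ∑ f (x ∷ L) + ∑ g (x ∷ L) + 1 ≤ length (x ∷ L) + (g x + f y)
  linked-bound f g {x} nil l = ℕ.≮⇒≥ λ h →
    (absurd ((g x) ∷ (f x) ∷ [])
        (λ { (a ∷ b ∷ []) → 𝟙 ⊕ (𝟙 ⊕ ∅) ⊕ a ⊕ b ≼ ((b ⊕ ∅) ⊕ a ⊕ ∅) ⊕ 𝟙 ∷ [] })
        refl (h ∷ []))
  linked-bound f g {x} {z ∷ L} {y} (e ▹ w) (r ∷ l) = ℕ.≮⇒≥ λ h →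
    (absurd ((length (z ∷ L)) ∷ (g x) ∷ (f y) ∷ (f x) ∷
          (∑ f (z ∷ L)) ∷ (∑ g (z ∷ L)) ∷ (g z) ∷ [])
        (λ { (a ∷ b ∷ c ∷ d ∷ e ∷ f ∷ g ∷ []) → 𝟙 ⊕ (𝟙 ⊕ a) ⊕ b ⊕ c ≼ ((d ⊕ e) ⊕ b ⊕ f) ⊕ 𝟙 ∷
              (e ⊕ f) ⊕ 𝟙 ≼ a ⊕ g ⊕ c ∷ d ⊕ g ≼ 𝟙 ∷ [] })
        refl (h ∷ linked-bound f g w l ∷ r ∷ []))

  -- If the total is attained, no single pair can be slack.
  linked-tight : ∀ (f g : V → ℕ) {x L y} → Walk x L y → Linked (λ u v → f u + g v ≤ 1) (x ∷ L) →
                 length (x ∷ L) + (g x + f y) ≤ ∑ f (x ∷ L) + ∑ g (x ∷ L) + 1 →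
                 Linked (λ u v → f u + g v ≡ 1) (x ∷ L)
  linked-tight f g nil l t = [-]
  linked-tight f g {x} {z ∷ L} {y} (e ▹ w) (r ∷ l) t = ℕ.≤-antisym r one≤ ∷ linked-tight f g w l tail
    where
    one≤ : 1 ≤ f x + g z
    one≤ = ℕ.≮⇒≥ λ h →
      (absurd ((f x) ∷ (g z) ∷ (∑ f (z ∷ L)) ∷ (∑ g (z ∷ L)) ∷
            (length (z ∷ L)) ∷ (f y) ∷ (g x) ∷ [])
          (λ { (a ∷ b ∷ c ∷ d ∷ e ∷ f ∷ g ∷ []) → 𝟙 ⊕ a ⊕ b ≼ 𝟙 ∷ (c ⊕ d) ⊕ 𝟙 ≼ e ⊕ b ⊕ f ∷
                (𝟙 ⊕ e) ⊕ g ⊕ f ≼ ((a ⊕ c) ⊕ g ⊕ d) ⊕ 𝟙 ∷ [] })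
          refl (h ∷ linked-bound f g w l ∷ t ∷ []))
    tail : length (z ∷ L) + (g z + f y) ≤ ∑ f (z ∷ L) + ∑ g (z ∷ L) + 1
    tail = ℕ.≮⇒≥ λ h →
      (absurd ((∑ f (z ∷ L)) ∷ (∑ g (z ∷ L)) ∷ (length (z ∷ L)) ∷
            (g z) ∷ (f y) ∷ (f x) ∷ (g x) ∷ [])
          (λ { (a ∷ b ∷ c ∷ d ∷ e ∷ f ∷ g ∷ []) → 𝟙 ⊕ (a ⊕ b) ⊕ 𝟙 ≼ c ⊕ d ⊕ e ∷ f ⊕ d ≼ 𝟙 ∷
                (𝟙 ⊕ c) ⊕ g ⊕ e ≼ ((f ⊕ a) ⊕ g ⊕ b) ⊕ 𝟙 ∷ [] })
          refl (h ∷ r ∷ t ∷ []))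

  data Insert (z : V) : List V → List V → Set where
    here : ∀ {u v L} → E u z → E z v → Insert z (u ∷ v ∷ L) (u ∷ z ∷ v ∷ L)
    there : ∀ {x L L′} → Insert z L L′ → Insert z (x ∷ L) (x ∷ L′)

  insert-↭ : ∀ {z L L′} → Insert z L L′ → L′ ↭ z ∷ L
  insert-↭ {z} (here {u} {v} {L} _ _) = (permute ([ u ] ∷ [ z ] ∷ [ v ] ∷ L ∷ [])
      (λ { (a ∷ b ∷ c ∷ d ∷ []) → a ⊕ b ⊕ c ⊕ d ≈ b ⊕ a ⊕ c ⊕ d , [] })
      refl ([]))
  insert-↭ {z} (there {x} {L} {L′} i) = (permute ([ x ] ∷ L′ ∷ [ z ] ∷ L ∷ [])
      (λ { (a ∷ b ∷ c ∷ d ∷ []) → a ⊕ b ≈ c ⊕ a ⊕ d , b ≈ c ⊕ d ∷ [] })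
      refl (insert-↭ i ∷ []))

  insert-walk : ∀ {z x L y L′} → Walk x L y → Insert z (x ∷ L) L′ → ∃ λ L″ → L′ ≡ x ∷ L″ × Walk x L″ y
  insert-walk (_ ▹ w) (here e e′) = _ , refl , e ▹ e′ ▹ w
  insert-walk (e ▹ w) (there i) with insert-walk w i
  ... | _ , refl , w′ = _ , refl , e ▹ w′

  -- Written as a bound on a sum of indicators, not as a negation, so that the conditions for all
  -- pairs can be added up.
  Uninsertable : V → List V → Set
  Uninsertable z = Linked (λ u v → χ u z + χ z v ≤ 1)

  pair? : ∀ u z v → (E u z × E z v) ⊎ χ u z + χ z v ≤ 1
  pair? u z v with arc u z | arc z v
  ... | true | true = inj₁ (refl , refl)
  ... | true | false = inj₂ (s≤s z≤n)
  ... | false | true = inj₂ (s≤s z≤n)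
  ... | false | false = inj₂ z≤n

  insert? : ∀ z L → (∃ λ L′ → Insert z L L′) ⊎ Uninsertable z L
  insert? z [] = inj₂ []
  insert? z (x ∷ []) = inj₂ [-]
  insert? z (x ∷ L@(y ∷ _)) with pair? x z y | insert? z L
  ... | inj₁ (e , e′) | _ = inj₁ (_ , here e e′)
  ... | inj₂ _ | inj₁ (_ , i) = inj₁ (_ , there i)
  ... | inj₂ r | inj₂ l = inj₂ (r ∷ l)

  insertʷ? : ∀ {x L y} → Walk x L y → ∀ z → (∃ λ L′ → Walk x L′ y × L′ ↭ z ∷ L) ⊎ Uninsertable z (x ∷ L)
  insertʷ? {x} {L} w z with insert? z (x ∷ L)
  ... | inj₂ l = inj₂ l
  ... | inj₁ (_ , i) with insert-walk w i
  ... | L″ , refl , w′ = inj₁ (L″ , w′ , (permute (L″ ∷ [ z ] ∷ L ∷ [ x ] ∷ [])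
      (λ { (a ∷ b ∷ c ∷ d ∷ []) → a ≈ b ⊕ c , d ⊕ a ≈ b ⊕ d ⊕ c ∷ [] })
      refl (insert-↭ i ∷ [])))

  -- `linked-bound` with `f` for the arcs into `z` and `g` for those out of `z`. The two arcs that
  -- would put `z` before or after the walk stay explicit, because they are often known to be
  -- absent.
  dg-uninsertable : ∀ {x L y} → Walk x L y → ∀ z → Uninsertable z (x ∷ L) →
                    dg z (x ∷ L) + 1 ≤ length (x ∷ L) + (χ z x + χ y z)
  dg-uninsertable {x} {L} {y} w z l = ℕ.≮⇒≥ λ h →
    (absurd ((length (x ∷ L)) ∷ (χ z x) ∷ (χ y z) ∷
          (∑ (χ z) (x ∷ L)) ∷ (∑ (λ v → χ v z) (x ∷ L)) ∷ [])
        (λ { (a ∷ b ∷ c ∷ d ∷ e ∷ []) → 𝟙 ⊕ a ⊕ b ⊕ c ≼ (d ⊕ e) ⊕ 𝟙 ∷ (e ⊕ d) ⊕ 𝟙 ≼ a ⊕ b ⊕ c ∷ [] })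
        refl (h ∷ linked-bound (λ v → χ v z) (χ z) w l ∷ []))

  tight-uninsertable : ∀ {x L y} → Walk x L y → ∀ z → Uninsertable z (x ∷ L) →
                       length (x ∷ L) + (χ z x + χ y z) ≤ dg z (x ∷ L) + 1 →
                       Linked (λ u v → χ u z + χ z v ≡ 1) (x ∷ L)
  tight-uninsertable {x} {L} {y} w z l t = linked-tight (λ v → χ v z) (χ z) w l (ℕ.≮⇒≥ λ h →
    (absurd ((∑ (λ v → χ v z) (x ∷ L)) ∷ (∑ (χ z) (x ∷ L)) ∷
          (length (x ∷ L)) ∷ (χ z x) ∷ (χ y z) ∷ [])
        (λ { (a ∷ b ∷ c ∷ d ∷ e ∷ []) → 𝟙 ⊕ (a ⊕ b) ⊕ 𝟙 ≼ c ⊕ d ⊕ e ∷ c ⊕ d ⊕ e ≼ (b ⊕ a) ⊕ 𝟙 ∷ [] })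
        refl (h ∷ t ∷ [])))

  -- Insertion of the vertices Z into a walk, one at a time, stopped before the last one.
  record Saturated (x : V) (L : List V) (y : V) (Z : List V) : Set where
    constructor saturated
    field
      {visited rest inserted} : List V
      walk : Walk x visited y
      visited-↭ : visited ↭ L ++ inserted
      rest-↭ : Z ↭ rest ++ inserted
      outcome : (∃ λ z → ∃ λ L′ → rest ≡ z ∷ [] × Walk x L′ y × L′ ↭ z ∷ visited)
                ⊎ (∃ λ z → ∃ λ R → rest ≡ z ∷ R × All (λ r → Uninsertable r (x ∷ visited)) rest)

  insertable-among : ∀ {x L y} → Walk x L y → ∀ Z →
    (∃ λ z → ∃ λ R → ∃ λ L′ → Z ↭ z ∷ R × Walk x L′ y × L′ ↭ z ∷ L) ⊎ All (λ r → Uninsertable r (x ∷ L)) Z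
  insertable-among w [] = inj₂ []
  insertable-among w (z ∷ Z) with insertʷ? w z
  ... | inj₁ (L′ , w′ , p) = inj₁ (z , Z , L′ , ↭-refl , w′ , p)
  ... | inj₂ l with insertable-among w Z
  ...   | inj₂ ls = inj₂ (l ∷ ls)
  ...   | inj₁ (z′ , R , L′ , q , w′ , p) = inj₁ (z′ , z ∷ R , L′ , (permute ([ z ] ∷ Z ∷ [ z′ ] ∷ R ∷ [])
      (λ { (a ∷ b ∷ c ∷ d ∷ []) → a ⊕ b ≈ c ⊕ a ⊕ d , b ≈ c ⊕ d ∷ [] })
      refl (q ∷ [])) , w′ , p)

  -- The first outcome keeps two walks: the one still missing `z`, which may close up to a cycle
  -- avoiding only `z`, and the complete one, which serves for a bypass or a longer cycle.
  saturate : ∀ {x L y} → Walk x L y → ∀ z Z → Saturated x L y (z ∷ Z)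
  saturate {x} {L₀} {y} w₀ z₀ Z₀ = go (length Z₀) z₀ Z₀ [] ℕ.≤-refl w₀ (↭-sym (Perm.++-identityʳ L₀)) (↭-sym (Perm.++-identityʳ _))
    where
    go : ∀ k z Z I {L} → length Z ≤ k → Walk x L y → L ↭ L₀ ++ I → z₀ ∷ Z₀ ↭ (z ∷ Z) ++ I → Saturated x L₀ y (z₀ ∷ Z₀)
    go k z Z I {L} b w p q with insertable-among w (z ∷ Z)
    ... | inj₂ ls = saturated w p q (inj₂ (z , Z , refl , ls))
    ... | inj₁ (z′ , [] , L′ , r , w′ , p′) = saturated {rest = z′ ∷ []} w p
            (permute ([ z₀ ] ∷ Z₀ ∷ [ z′ ] ∷ I ∷ [ z ] ∷ Z ∷ [])
                (λ { (a ∷ b ∷ c ∷ d ∷ e ∷ f ∷ []) → a ⊕ b ≈ c ⊕ d , a ⊕ b ≈ e ⊕ f ⊕ d ∷ e ⊕ f ≈ c ∷ [] })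
                refl (q ∷ r ∷ [])) (inj₁ (z′ , L′ , refl , w′ , p′))
    ... | inj₁ (z′ , z″ ∷ R , L′ , r , w′ , p′) with k | ℕ.≤-trans (ℕ.≤-reflexive (sym (ℕ.suc-injective (Perm.↭-length r)))) b
    ...   | suc k′ | s≤s b′ = go k′ z″ R (z′ ∷ I) b′ w′ (permute (L′ ∷ L₀ ∷ [ z′ ] ∷ I ∷ L ∷ [])
        (λ { (a ∷ b ∷ c ∷ d ∷ e ∷ []) → a ≈ b ⊕ c ⊕ d , a ≈ c ⊕ e ∷ e ≈ b ⊕ d ∷ [] })
        refl (p′ ∷ p ∷ []))
              (permute ([ z₀ ] ∷ Z₀ ∷ [ z″ ] ∷ R ∷ [ z′ ] ∷ I ∷ [ z ] ∷ Z ∷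
                    [])
                  (λ { (a ∷ b ∷ c ∷ d ∷ e ∷ f ∷ g ∷ h ∷ []) → a ⊕ b ≈ c ⊕ d ⊕ e ⊕ f , a ⊕ b ≈ g ⊕ h ⊕ f ∷
                        g ⊕ h ≈ e ⊕ c ⊕ d ∷ [] })
                  refl (q ∷ r ∷ []))

-- Reversed walks, and walks through a fixed set of vertices

module _ {V : Set} (arc : V → V → Bool) where
  private
    module G = Walks arc
    module Gᵒᵖ = Walks (flip arc)

  reverse-walk : ∀ {x L y} → G.Walk x L y → ∃ λ L′ → Gᵒᵖ.Walk y L′ x × y ∷ L′ ≡ reverse (x ∷ L)
  reverse-walk G.nil = _ , Gᵒᵖ.nil , refl
  reverse-walk {x} {z ∷ L} (e G.▹ w) with reverse-walk w
  ... | L′ , w′ , eq = _ , w′ Gᵒᵖ.⧺ (e Gᵒᵖ.▹ Gᵒᵖ.nil) ,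
        trans (cong (_++ x ∷ []) eq) (sym (List.unfold-reverse x (z ∷ L)))

  reverse-walk-↭ : ∀ {x L y} → G.Walk x L y → ∃ λ L′ → Gᵒᵖ.Walk y L′ x × y ∷ L′ ↭ x ∷ L
  reverse-walk-↭ {x} {L} w with reverse-walk w
  ... | L′ , w′ , eq = L′ , w′ , subst (_↭ x ∷ L) (sym eq) (Perm.↭-reverse (x ∷ L))

-- To span means to be a permutation of `all`. Freedom from repetitions is accordingly assumed in
-- the form that no permutation of `all` begins with the same vertex twice, which combines directly
-- with `permute`.
module Spanning {V : Set} (all : List V) (nodup : ∀ {x L} → ¬ (x ∷ x ∷ L ↭ all))
                (n : ℕ) (size : length all ≡ suc n)
                (arc : V → V → Bool) (loopless : ∀ x → arc x x ≡ false) where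

  open Walks arc public

  δ : V → ℕ
  δ x = dg x all

  χ-loop : ∀ x → χ x x ≡ 0
  χ-loop x = χ-no-arc λ e → case-false (trans (sym (loopless x)) e)
    where
    case-false : ¬ (false ≡ true)
    case-false ()

  dg-∷ : ∀ x L → dg x (x ∷ L) ≡ dg x L
  dg-∷ x L rewrite χ-loop x = refl

  deg-rest : ∀ {x L} → x ∷ L ↭ all → δ x ≡ dg x L
  deg-rest {x} {L} p = trans (dg-↭ x (↭-sym p)) (dg-∷ x L)

  distinct : ∀ {x y L} → x ∷ y ∷ L ↭ all → x ≢ y
  distinct p refl = nodup p

  size-rest : ∀ {x L} → x ∷ L ↭ all → length L ≡ n
  size-rest p = ℕ.suc-injective (trans (Perm.↭-length p) size)

  apart : ∀ {y L v} → y ∷ L ↭ all → v ∈ L → y ≢ v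
  apart {y} {L} {v} p i refl with Mem.∈-∃++ i
  ... | A , B , eq = nodup (permute ([ y ] ∷ A ∷ B ∷ all ∷ L ∷ [])
      (λ { (a ∷ b ∷ c ∷ d ∷ e ∷ []) → a ⊕ a ⊕ b ⊕ c ≈ d , a ⊕ e ≈ d ∷ b ⊕ a ⊕ c ≈ e ∷ [] })
      refl (p ∷ ↭-sym (↭-reflexive eq) ∷ []))

  dg-within : ∀ {x L L′} → L ↭ x ∷ L′ → dg x L + 2 ≤ length L + length L
  dg-within {x} {L} {L′} p = ℕ.≮⇒≥ λ h →
    (absurd ((length L) ∷ (dg x L) ∷ (dg x (x ∷ L′)) ∷
          (dg x L′) ∷ (length L′) ∷ [])
        (λ { (a ∷ b ∷ c ∷ d ∷ e ∷ []) → 𝟙 ⊕ a ⊕ a ≼ b ⊕ 𝟙 ⊕ 𝟙 ∷ b ≼ c ∷ c ≼ d ∷ d ≼ e ⊕ e ∷ 𝟙 ⊕ e ≼ a ∷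
              𝟙 ⊕ e ≼ a ∷ [] })
        refl (h ∷ ≡⇒≤ (dg-↭ x p) ∷ ≡⇒≤ (dg-∷ x L′) ∷ dg-length x L′ ∷ ≡⇒≥ (Perm.↭-length p) ∷
          ≡⇒≥ (Perm.↭-length p) ∷ []))

  -- The count for a vertex `z` left over after saturation. The constant 3 consists of 1 from the
  -- insertion bound and 2 from the absent loop at `z`, which lies in `R`.
  dg-rest : ∀ {x L y z R} → Walk x L y → Uninsertable z (x ∷ L) → z ∈ R →
            dg z (x ∷ L) + dg z R + 3 ≤ length (x ∷ L) + (χ z x + χ y z) + (length R + length R)
  dg-rest {x} {L} {y} {z} {R} w l i with Mem.∈-∃++ i
  ... | A , B , eq = ℕ.≮⇒≥ λ h →
    (absurd ((length (x ∷ L)) ∷ (χ z x) ∷ (χ y z) ∷ (length R) ∷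
          (dg z (x ∷ L)) ∷ (dg z R) ∷ [])
        (λ { (a ∷ b ∷ c ∷ d ∷ e ∷ f ∷ []) → 𝟙 ⊕ (a ⊕ b ⊕ c) ⊕ d ⊕ d ≼ (e ⊕ f) ⊕ 𝟙 ⊕ 𝟙 ⊕ 𝟙 ∷
              e ⊕ 𝟙 ≼ a ⊕ b ⊕ c ∷ f ⊕ 𝟙 ⊕ 𝟙 ≼ d ⊕ d ∷ [] })
        refl (h ∷ dg-uninsertable w z l ∷ dg-within (permute (R ∷ [ z ] ∷ A ∷ B ∷ [])
        (λ { (a ∷ b ∷ c ∷ d ∷ []) → a ≈ b ⊕ c ⊕ d , a ≈ c ⊕ b ⊕ d ∷ [] })
        refl (↭-reflexive eq ∷ [])) ∷ []))

  -- The vertex-deleted digraph is hamiltonian.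
  Low : V → Set
  Low z = ∃ λ v → ∃ λ L → ∃ λ u → Walk v L u × E u v × z ∷ v ∷ L ↭ all

  module Extremal (ore : ∀ {x y} → x ≢ y → NonAdj x y → n + n ≤ δ x + δ y)
                  (no-bypass : ∀ {x L y} → Walk x L y → x ∷ L ↭ all → ¬ E x y) where

    no-consecutive-in : ∀ {v L u y} → Walk v L u → y ∷ v ∷ L ↭ all → ¬ (E u y × E v y)
    no-consecutive-in {v} {L} {u} {y} w p (e , e′) = no-bypass (w ⧺ [ e ]ʷ) (permute ([ v ] ∷ L ∷ [ y ] ∷ all ∷ [])
        (λ { (a ∷ b ∷ c ∷ d ∷ []) → a ⊕ b ⊕ c ≈ d , c ⊕ a ⊕ b ≈ d ∷ [] })
        refl (p ∷ [])) e′

    no-consecutive-out : ∀ {v L u y} → Walk v L u → y ∷ v ∷ L ↭ all → ¬ (E y u × E y v)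
    no-consecutive-out w p (e , e′) = no-bypass (e′ ▹ w) p e

    rotate : ∀ {b P a Q u v A B} {y} → P ≡ A ++ v ∷ B → Walk a Q b → Walk b A u → Walk v B a → y ∷ P ++ Q ↭ all →
             Walk v (B ++ Q ++ A) u × y ∷ v ∷ B ++ Q ++ A ↭ all
    rotate {P = P} {Q = Q} {v = v} {A = A} {B} {y} eq q w₁ w₂ p = (w₂ ⧺ q ⧺ w₁) ,
      (permute ([ y ] ∷ [ v ] ∷ B ∷ Q ∷ A ∷ all ∷ P ∷ [])
          (λ { (a ∷ b ∷ c ∷ d ∷ e ∷ f ∷ g ∷ []) → a ⊕ b ⊕ c ⊕ d ⊕ e ≈ f , a ⊕ g ⊕ d ≈ f ∷ e ⊕ b ⊕ c ≈ g ∷ [] })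
          refl (p ∷ ↭-sym (↭-reflexive eq) ∷ []))

    -- Closed walks are given as two walks b → a and a → b; together they visit P ++ Q.
    separated-in : ∀ {y b P a Q} → Walk b P a → Walk a Q b → y ∷ P ++ Q ↭ all →
                   Linked (λ u v → χ u y + χ v y ≤ 1) (b ∷ P)
    separated-in {y} w q p = linked-pairs w λ {u} {v} w₁ e w₂ eq → let (r , s) = rotate eq q w₁ w₂ p in
      both (no-consecutive-in r s)
      where
      both : ∀ {u v} → ¬ (E u y × E v y) → χ u y + χ v y ≤ 1
      both {u} {v} h with arc u y | arc v y
      ... | true | true = ⊥-elim (h (refl , refl))
      ... | true | false = s≤s z≤n
      ... | false | true = s≤s z≤n
      ... | false | false = z≤n

    separated-out : ∀ {y b P a Q} → Walk b P a → Walk a Q b → y ∷ P ++ Q ↭ all →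
                    Linked (λ u v → χ y u + χ y v ≤ 1) (b ∷ P)
    separated-out {y} w q p = linked-pairs w λ {u} {v} w₁ e w₂ eq → let (r , s) = rotate eq q w₁ w₂ p in
      both (no-consecutive-out r s)
      where
      both : ∀ {u v} → ¬ (E y u × E y v) → χ y u + χ y v ≤ 1
      both {u} {v} h with arc y u | arc y v
      ... | true | true = ⊥-elim (h (refl , refl))
      ... | true | false = s≤s z≤n
      ... | false | true = s≤s z≤n
      ... | false | false = z≤n

    module _ {y b P a Q} (w : Walk b P a) (q : Walk a Q b) (p : y ∷ P ++ Q ↭ all) where

      in-bound : ∑ (λ v → χ v y) (b ∷ P) + ∑ (λ v → χ v y) (b ∷ P) + 1 ≤ length (b ∷ P) + (χ b y + χ a y)
      in-bound = linked-bound (λ v → χ v y) (λ v → χ v y) w (separated-in w q p)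

      out-bound : ∑ (χ y) (b ∷ P) + ∑ (χ y) (b ∷ P) + 1 ≤ length (b ∷ P) + (χ y b + χ y a)
      out-bound = linked-bound (χ y) (χ y) w (separated-out w q p)

      in-tight : length (b ∷ P) + (χ b y + χ a y) ≤ ∑ (λ v → χ v y) (b ∷ P) + ∑ (λ v → χ v y) (b ∷ P) + 1 →
                 Linked (λ u v → χ u y + χ v y ≡ 1) (b ∷ P)
      in-tight = linked-tight (λ v → χ v y) (λ v → χ v y) w (separated-in w q p)

      out-tight : length (b ∷ P) + (χ y b + χ y a) ≤ ∑ (χ y) (b ∷ P) + ∑ (χ y) (b ∷ P) + 1 →
                  Linked (λ u v → χ y u + χ y v ≡ 1) (b ∷ P)
      out-tight = linked-tight (χ y) (χ y) w (separated-out w q p)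

    module _ {y c L} (w : Walk c L c) (p : y ∷ L ↭ all) where
      private
        p′ : y ∷ L ++ [] ↭ all
        p′ = (permute ([ y ] ∷ L ∷ all ∷ [])
            (λ { (a ∷ b ∷ c ∷ []) → a ⊕ b ⊕ ∅ ≈ c , a ⊕ b ≈ c ∷ [] })
            refl (p ∷ []))

      -- On a closed walk `c` occurs at both ends of `c ∷ L`; the boundary terms of `in-bound`
      -- cancel exactly this double occurrence.
      2in≤n : ∑ (λ v → χ v y) L + ∑ (λ v → χ v y) L ≤ n
      2in≤n = ℕ.≮⇒≥ λ h → (absurd (n ∷ (∑ (λ v → χ v y) L) ∷ (length L) ∷ (χ c y) ∷ [])
          (λ { (a ∷ b ∷ c ∷ d ∷ []) → 𝟙 ⊕ a ≼ b ⊕ b ∷ c ≼ a ∷ ((d ⊕ b) ⊕ d ⊕ b) ⊕ 𝟙 ≼ (𝟙 ⊕ c) ⊕ d ⊕ d ∷ [] })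
          refl (h ∷ ≡⇒≤ (size-rest p) ∷ in-bound w nil p′ ∷ []))

      2out≤n : ∑ (χ y) L + ∑ (χ y) L ≤ n
      2out≤n = ℕ.≮⇒≥ λ h → (absurd (n ∷ (∑ (χ y) L) ∷ (length L) ∷ (χ y c) ∷ [])
          (λ { (a ∷ b ∷ c ∷ d ∷ []) → 𝟙 ⊕ a ≼ b ⊕ b ∷ c ≼ a ∷ ((d ⊕ b) ⊕ d ⊕ b) ⊕ 𝟙 ≼ (𝟙 ⊕ c) ⊕ d ⊕ d ∷ [] })
          refl (h ∷ ≡⇒≤ (size-rest p) ∷ out-bound w nil p′ ∷ []))

      deg≤n : δ y ≤ n
      deg≤n = ℕ.≮⇒≥ λ h → (absurd (n ∷ (δ y) ∷ (∑ (χ y) L) ∷ (∑ (λ v → χ v y) L) ∷ [])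
          (λ { (a ∷ b ∷ c ∷ d ∷ []) → 𝟙 ⊕ a ≼ b ∷ 𝟙 ⊕ a ≼ b ∷ b ≼ c ⊕ d ∷ b ≼ c ⊕ d ∷ d ⊕ d ≼ a ∷ c ⊕ c ≼ a ∷
                [] })
          refl (h ∷ h ∷ ≡⇒≤ (deg-rest p) ∷ ≡⇒≤ (deg-rest p) ∷ 2in≤n ∷ 2out≤n ∷ []))

      -- In-degree and out-degree are each at most n/2, so degree n forces both to attain it, and
      -- with it the bound at every consecutive pair.
      in-alternating : n ≤ δ y → Linked (λ u v → χ u y + χ v y ≡ 1) (c ∷ L)
      in-alternating t = in-tight w nil p′ (ℕ.≮⇒≥ λ h → (absurd (n ∷ (δ y) ∷ (∑ (χ y) L) ∷ (∑ (λ v → χ v y) L) ∷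
            (length L) ∷ (χ c y) ∷ [])
          (λ { (a ∷ b ∷ c ∷ d ∷ e ∷ f ∷ []) → a ≼ b ∷ a ≼ b ∷ b ≼ c ⊕ d ∷ b ≼ c ⊕ d ∷ e ≼ a ∷ c ⊕ c ≼ a ∷
                𝟙 ⊕ ((f ⊕ d) ⊕ f ⊕ d) ⊕ 𝟙 ≼ (𝟙 ⊕ e) ⊕ f ⊕ f ∷ [] })
          refl (t ∷ t ∷ ≡⇒≤ (deg-rest p) ∷ ≡⇒≤ (deg-rest p) ∷ ≡⇒≤ (size-rest p) ∷ 2out≤n ∷ h ∷ [])))

      out-alternating : n ≤ δ y → Linked (λ u v → χ y u + χ y v ≡ 1) (c ∷ L)
      out-alternating t = out-tight w nil p′ (ℕ.≮⇒≥ λ h → (absurd (n ∷ (δ y) ∷ (∑ (χ y) L) ∷ (∑ (λ v → χ v y) L) ∷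
            (length L) ∷ (χ y c) ∷ [])
          (λ { (a ∷ b ∷ c ∷ d ∷ e ∷ f ∷ []) → a ≼ b ∷ a ≼ b ∷ b ≼ c ⊕ d ∷ b ≼ c ⊕ d ∷ e ≼ a ∷ d ⊕ d ≼ a ∷
                𝟙 ⊕ ((f ⊕ c) ⊕ f ⊕ c) ⊕ 𝟙 ≼ (𝟙 ⊕ e) ⊕ f ⊕ f ∷ [] })
          refl (t ∷ t ∷ ≡⇒≤ (deg-rest p) ∷ ≡⇒≤ (deg-rest p) ∷ ≡⇒≤ (size-rest p) ∷ 2in≤n ∷ h ∷ [])))

    low-closed : ∀ {y} → Low y → ∃ λ c → ∃ λ L → Walk c L c × y ∷ L ↭ all
    low-closed {y} (v , L , u , w , e , p) = v , _ , w ⧺ [ e ]ʷ , (permute ([ y ] ∷ L ∷ [ v ] ∷ all ∷ [])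
        (λ { (a ∷ b ∷ c ∷ d ∷ []) → a ⊕ b ⊕ c ≈ d , a ⊕ c ⊕ b ≈ d ∷ [] })
        refl (p ∷ []))

    low-deg : ∀ {y} → Low y → δ y ≤ n
    low-deg l = let (_ , _ , w , p) = low-closed l in deg≤n w p

    both-arcs : ∀ {x v} → 2 ≤ dg x (v ∷ []) → E x v × E v x
    both-arcs {x} {v} h =
      arc-χ (ℕ.≮⇒≥ λ l → (absurd ((χ x v) ∷ (χ v x) ∷ [])
          (λ { (a ∷ b ∷ []) → 𝟙 ⊕ a ≼ 𝟙 ∷ b ≼ 𝟙 ∷ 𝟙 ⊕ 𝟙 ≼ (a ⊕ ∅) ⊕ b ⊕ ∅ ∷ [] })
          refl (l ∷ χ≤1 v x ∷ h ∷ []))) ,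
      arc-χ (ℕ.≮⇒≥ λ l → (absurd ((χ v x) ∷ (χ x v) ∷ [])
          (λ { (a ∷ b ∷ []) → 𝟙 ⊕ a ≼ 𝟙 ∷ b ≼ 𝟙 ∷ 𝟙 ⊕ 𝟙 ≼ (b ⊕ ∅) ⊕ a ⊕ ∅ ∷ [] })
          refl (l ∷ χ≤1 x v ∷ h ∷ [])))

    -- For want of a loop, 2|X| - 2 is the largest degree that `x` can have within `X`; when it is
    -- attained, no arc is absent.
    complete-arc : ∀ {x v X} → x ∈ X → v ∈ X → x ≢ v → length X + length X ≤ dg x X + 2 → E x v
    complete-arc {x} {v} {X} i j x≢v h with Mem.∈-∃++ i
    ... | A , B , eq with Perm.∈-resp-↭ (permute (X ∷ [ x ] ∷ A ∷ B ∷ [])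
        (λ { (a ∷ b ∷ c ∷ d ∷ []) → a ≈ b ⊕ c ⊕ d , a ≈ c ⊕ b ⊕ d ∷ [] })
        refl (↭-reflexive eq ∷ [])) j
    ...   | here e = ⊥-elim (x≢v (sym e))
    ...   | there k with Mem.∈-∃++ k
    ...     | A′ , B′ , eq′ = proj₁ (both-arcs (ℕ.≮⇒≥ λ l →
              (absurd ((dg x (v ∷ [])) ∷ (length X) ∷ (dg x X) ∷
                    (dg x (v ∷ A′ ++ B′)) ∷ (dg x (A′ ++ B′)) ∷ (length (A′ ++ B′)) ∷ [])
                  (λ { (a ∷ b ∷ c ∷ d ∷ e ∷ f ∷ []) → 𝟙 ⊕ a ≼ 𝟙 ⊕ 𝟙 ∷ b ⊕ b ≼ c ⊕ 𝟙 ⊕ 𝟙 ∷ c ≼ d ∷ d ≼ a ⊕ e ∷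
                        e ≼ f ⊕ f ∷ 𝟙 ⊕ 𝟙 ⊕ f ≼ b ∷ 𝟙 ⊕ 𝟙 ⊕ f ≼ b ∷ [] })
                  refl (l ∷ h ∷ ≡⇒≤ (trans (dg-↭ x X↭) (dg-∷ x (v ∷ A′ ++ B′))) ∷
                    ≡⇒≤ (dg-++ x (v ∷ []) (A′ ++ B′)) ∷ dg-length x (A′ ++ B′) ∷ ≡⇒≥ (Perm.↭-length X↭) ∷
                    ≡⇒≥ (Perm.↭-length X↭) ∷ []))))
      where
      X↭ : X ↭ x ∷ v ∷ A′ ++ B′
      X↭ = (permute (X ∷ [ x ] ∷ [ v ] ∷ A′ ∷ B′ ∷ A ∷ B ∷ [])
          (λ { (a ∷ b ∷ c ∷ d ∷ e ∷ f ∷ g ∷ []) → a ≈ b ⊕ c ⊕ d ⊕ e , a ≈ f ⊕ b ⊕ g ∷ f ⊕ g ≈ d ⊕ c ⊕ e ∷ [] })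
          refl (↭-reflexive eq ∷ ↭-reflexive eq′ ∷ []))

    Tight : V → List V → V → V → List V → Set
    Tight x X κ ω K = length X + length X ≤ dg x X + 2 × E x κ × E ω x × Linked (λ u v → χ u x + χ x v ≡ 1) (κ ∷ K)

    -- Write k for the number of vertices on the middle walk. Then d(x) ≤ 2(|M| - 1) + k + 1 and
    -- d(z) ≤ 2(|N| - 1) + k + 1, and the sum of these bounds is 2n because |M| + k + |N| = n + 1.
    -- As 2n is also the required degree sum, all inequalities are equalities; the components of
    -- `Tight` are those that concern `x`.
    tight-end : ∀ {κ ω K M N x z} → Walk κ K ω → M ++ (κ ∷ K) ++ N ↭ all →
            (∀ {x z} → x ∈ M → z ∈ N → NonAdj x z) → x ∈ M → z ∈ N →
            Uninsertable x (κ ∷ K) → Uninsertable z (κ ∷ K) → Tight x M κ ω K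
    tight-end {κ} {ω} {K} {M} {N} {x} {z} w p apart-MN i j ux uz =
      ℕ.≮⇒≥ (λ l → (absurd ((dg x M) ∷ (length M) ∷ (length (κ ∷ K)) ∷
            (dg x (κ ∷ K)) ∷ (χ x κ) ∷ (χ ω x) ∷ [])
          (λ { (a ∷ b ∷ c ∷ d ∷ e ∷ f ∷ []) → 𝟙 ⊕ a ⊕ 𝟙 ⊕ 𝟙 ≼ b ⊕ b ∷
                (b ⊕ b) ⊕ c ⊕ 𝟙 ⊕ 𝟙 ≼ (a ⊕ 𝟙 ⊕ 𝟙) ⊕ d ⊕ 𝟙 ∷ d ⊕ 𝟙 ≼ c ⊕ e ⊕ f ∷ e ≼ 𝟙 ∷ f ≼ 𝟙 ∷ [] })
          refl (l ∷ total ∷ bound ∷ χ≤1 x κ ∷ χ≤1 ω x ∷ []))) ,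
      arc-χ (ℕ.≮⇒≥ λ l → (absurd ((χ x κ) ∷ (length M) ∷ (length (κ ∷ K)) ∷
            (dg x M) ∷ (dg x (κ ∷ K)) ∷ (χ ω x) ∷ [])
          (λ { (a ∷ b ∷ c ∷ d ∷ e ∷ f ∷ []) → 𝟙 ⊕ a ≼ 𝟙 ∷ (b ⊕ b) ⊕ c ⊕ 𝟙 ⊕ 𝟙 ≼ (d ⊕ 𝟙 ⊕ 𝟙) ⊕ e ⊕ 𝟙 ∷
                d ⊕ 𝟙 ⊕ 𝟙 ≼ b ⊕ b ∷ e ⊕ 𝟙 ≼ c ⊕ a ⊕ f ∷ f ≼ 𝟙 ∷ [] })
          refl (l ∷ total ∷ inside ∷ bound ∷ χ≤1 ω x ∷ []))) ,
      arc-χ (ℕ.≮⇒≥ λ l → (absurd ((χ ω x) ∷ (length M) ∷ (length (κ ∷ K)) ∷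
            (dg x M) ∷ (dg x (κ ∷ K)) ∷ (χ x κ) ∷ [])
          (λ { (a ∷ b ∷ c ∷ d ∷ e ∷ f ∷ []) → 𝟙 ⊕ a ≼ 𝟙 ∷ (b ⊕ b) ⊕ c ⊕ 𝟙 ⊕ 𝟙 ≼ (d ⊕ 𝟙 ⊕ 𝟙) ⊕ e ⊕ 𝟙 ∷
                d ⊕ 𝟙 ⊕ 𝟙 ≼ b ⊕ b ∷ e ⊕ 𝟙 ≼ c ⊕ f ⊕ a ∷ f ≼ 𝟙 ∷ [] })
          refl (l ∷ total ∷ inside ∷ bound ∷ χ≤1 x κ ∷ []))) ,
      tight-uninsertable w x ux (ℕ.≮⇒≥ λ l → (absurd ((dg x (κ ∷ K)) ∷ (length (κ ∷ K)) ∷ (χ x κ) ∷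
            (χ ω x) ∷ (length M) ∷ (dg x M) ∷ [])
          (λ { (a ∷ b ∷ c ∷ d ∷ e ∷ f ∷ []) → 𝟙 ⊕ a ⊕ 𝟙 ≼ b ⊕ c ⊕ d ∷
                (e ⊕ e) ⊕ b ⊕ 𝟙 ⊕ 𝟙 ≼ (f ⊕ 𝟙 ⊕ 𝟙) ⊕ a ⊕ 𝟙 ∷ f ⊕ 𝟙 ⊕ 𝟙 ≼ e ⊕ e ∷ c ≼ 𝟙 ∷ d ≼ 𝟙 ∷ [] })
          refl (l ∷ total ∷ inside ∷ χ≤1 x κ ∷ χ≤1 ω x ∷ [])))
      where
      bound : dg x (κ ∷ K) + 1 ≤ length (κ ∷ K) + (χ x κ + χ ω x)
      bound = dg-uninsertable w x ux
      member : ∀ {v X} → v ∈ X → dg v X + 2 ≤ length X + length X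
      member {v} {X} k = let (A , B , eq) = Mem.∈-∃++ k in dg-within (permute (X ∷ [ v ] ∷ A ∷ B ∷ [])
          (λ { (a ∷ b ∷ c ∷ d ∷ []) → a ≈ b ⊕ c ⊕ d , a ≈ c ⊕ b ⊕ d ∷ [] })
          refl (↭-reflexive eq ∷ []))
      inside : dg x M + 2 ≤ length M + length M
      inside = member i
      δx : δ x ≡ dg x M + dg x (κ ∷ K)
      δx = trans (dg-↭ x (↭-sym p)) (trans (dg-++ x M _) (cong (dg x M +_) (trans (dg-++ x (κ ∷ K) N)
             (trans (cong (dg x (κ ∷ K) +_) (dg-nonadj x (All.tabulate λ k → apart-MN i k))) (ℕ.+-identityʳ _)))))
      δz : δ z ≡ dg z (κ ∷ K) + dg z N
      δz = trans (dg-↭ z (↭-sym p)) (trans (dg-++ z M _) (trans (cong (_+ dg z ((κ ∷ K) ++ N)) (dg-nonadj z (All.tabulate λ k → let (h , h′) = apart-MN k j in h′ , h))) (dg-++ z (κ ∷ K) N)))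
      x≢z : x ≢ z
      x≢z refl = let (A , B , eq) = Mem.∈-∃++ i ; (A′ , B′ , eq′) = Mem.∈-∃++ j in
        nodup (permute ([ x ] ∷ A ∷ B ∷ [ κ ] ∷ K ∷ A′ ∷ B′ ∷ all ∷ M ∷ N ∷
              [])
            (λ { (a ∷ b ∷ c ∷ d ∷ e ∷ f ∷ g ∷ h ∷ i ∷ j ∷ []) → a ⊕ a ⊕ b ⊕ c ⊕ (d ⊕ e) ⊕ f ⊕ g ≈ h , i ⊕ (d ⊕ e) ⊕ j ≈ h ∷
                  b ⊕ a ⊕ c ≈ i ∷ f ⊕ a ⊕ g ≈ j ∷ [] })
            refl (p ∷ ↭-sym (↭-reflexive eq) ∷ ↭-sym (↭-reflexive eq′) ∷ []))
      -- The upper bound for `z` is spent here; what is left is the lower bound for `x` used in all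
      -- four components.
      total : length M + length M + (length (κ ∷ K) + 2) ≤ dg x M + 2 + (dg x (κ ∷ K) + 1)
      total = ℕ.≮⇒≥ λ l → (absurd ((dg x M) ∷ (dg x (κ ∷ K)) ∷ (length M) ∷
            (length (κ ∷ K)) ∷ n ∷ (δ x) ∷ (δ z) ∷ (dg z (κ ∷ K)) ∷ (dg z N) ∷ (length N) ∷ (χ z κ) ∷ (χ ω z) ∷
            [])
          (λ { (a ∷ b ∷ c ∷ d ∷ e ∷ f ∷ g ∷ h ∷ i ∷ j ∷ k ∷ l ∷ []) → 𝟙 ⊕ (a ⊕ 𝟙 ⊕ 𝟙) ⊕ b ⊕ 𝟙 ≼ (c ⊕ c) ⊕ d ⊕ 𝟙 ⊕ 𝟙 ∷
                e ⊕ e ≼ f ⊕ g ∷ f ≼ a ⊕ b ∷ g ≼ h ⊕ i ∷ i ⊕ 𝟙 ⊕ 𝟙 ≼ j ⊕ j ∷ h ⊕ 𝟙 ≼ d ⊕ k ⊕ l ∷ k ≼ 𝟙 ∷ l ≼ 𝟙 ∷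
                c ⊕ d ⊕ j ≼ 𝟙 ⊕ e ∷ c ⊕ d ⊕ j ≼ 𝟙 ⊕ e ∷ [] })
          refl (l ∷ ore x≢z (apart-MN i j) ∷ ≡⇒≤ δx ∷ ≡⇒≤ δz ∷ member j ∷ dg-uninsertable w z uz ∷ χ≤1 z κ ∷
            χ≤1 ω z ∷
            ≡⇒≤ (trans (sym (trans (List.length-++ M) (cong (length M +_) (List.length-++ (κ ∷ K))))) (trans (Perm.↭-length p) size)) ∷
            ≡⇒≤ (trans (sym (trans (List.length-++ M) (cong (length M +_) (List.length-++ (κ ∷ K))))) (trans (Perm.↭-length p) size)) ∷
            []))

-- Counterexamples in terms of lists and walks, and their reversal

record Counterexample : Set₁ where
  field
    V : Set
    all : List V
    covers : ∀ x → x ∈ all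
    nodup : ∀ {x L} → ¬ (x ∷ x ∷ L ↭ all)
    n : ℕ
    size : length all ≡ suc n
    arcs : V → V → Bool
    loopless′ : ∀ x → arcs x x ≡ false
  open Spanning all nodup n size arcs loopless′ public
  field
    ore : ∀ {x y} → x ≢ y → NonAdj x y → n + n ≤ δ x + δ y
    no-bypass : ∀ {x L y} → Walk x L y → x ∷ L ↭ all → ¬ E x y
    no-D₀ : ∀ A B → A ++ B ↭ all → length A ≡ suc (length B) →
            (∀ {a a′} → a ∈ A → a′ ∈ A → NonAdj a a′) →
            (∀ {a b} → a ∈ A → b ∈ B → E a b × E b a) → ⊥
    -- Only the separation by the cut vertex `κ` is asked for: in a digraph meeting the degree
    -- condition it forces both sides, together with `κ`, to be complete.
    no-cliques : ∀ {m M κ ν N} → (m ∷ M) ++ κ ∷ ν ∷ N ↭ all →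
                 (∀ {x y} → x ∈ (m ∷ M) → y ∈ (ν ∷ N) → NonAdj x y) → ⊥
  open Extremal ore no-bypass public

-- Reversal keeps degrees, and it carries a bypass to a bypass: the path is traversed backwards, and
-- the arc between its ends turns round with it.
op : Counterexample → Counterexample
op C = record
  { V = V ; all = all ; covers = covers ; nodup = nodup ; n = n ; size = size
  ; arcs = flip arcs
  ; loopless′ = loopless′
  ; ore = λ {x} {y} x≢y (h , h′) → subst₂ (λ i j → n + n ≤ i + j) (δ-flip x) (δ-flip y) (ore x≢y (h′ , h))
  ; no-bypass = λ {x} {L} {y} w p e →
      let (L′ , w′ , q) = reverse-walk-↭ (flip arcs) w in no-bypass w′ (permute ([ y ] ∷ L′ ∷ all ∷ [ x ] ∷ L ∷ [])
          (λ { (a ∷ b ∷ c ∷ d ∷ e ∷ []) → a ⊕ b ≈ c , a ⊕ b ≈ d ⊕ e ∷ d ⊕ e ≈ c ∷ [] })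
          refl (q ∷ p ∷ [])) e
  ; no-D₀ = λ A B p eq indep compl → no-D₀ A B p eq
      (λ i j → let (h , h′) = indep i j in h′ , h) (λ i j → let (e , e′) = compl i j in e′ , e)
  ; no-cliques = λ p h → no-cliques p λ i j → let (k , k′) = h i j in k′ , k
  }
  where
  open Counterexample C
  δ-flip : ∀ x → δ x ≡ ∑ (λ v → χ v x) all + ∑ (χ x) all
  δ-flip x = ℕ.+-comm (∑ (χ x) all) _

-- Lemmas that are also applied to the opposite digraph.
module OneSided (C : Counterexample) where
  open Counterexample C

  -- A vertex of degree n whose deletion leaves a hamiltonian digraph
  -- is adjacent to everything, since otherwise it determines a digraph of type D₀.

  -- An alternating 0-1 sequence is determined by its first value.
  synchronous : ∀ (f g : V → ℕ) {s s′ L} → f s ≡ g s′ → Linked (λ u v → f u + f v ≡ 1) (s ∷ L) →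
                Linked (λ u v → g u + g v ≡ 1) (s′ ∷ L) → All (λ v → f v ≡ g v) L
  synchronous f g {L = []} e l l′ = []
  synchronous f g {s} {s′} {v ∷ L} e (r ∷ l) (r′ ∷ l′) = e′ ∷ synchronous f g e′ l l′
    where
    e′ : f v ≡ g v
    e′ = ℕ.+-cancelˡ-≡ (f s) _ _ (trans r (trans (sym r′) (cong (_+ g v) (sym e))))

  module _ {y} (full : n ≤ δ y) where

    Alternating : List V → Set
    Alternating L = Linked (λ u v → χ u y + χ v y ≡ 1) L × Linked (λ u v → χ y u + χ y v ≡ 1) L

    -- From a non-neighbour of `y` both indicator sequences run 0, 1, 0, 1, ... in step, so the
    -- vertices are in turn non-adjacent to `y` and joined to it by both arcs. The start is not
    -- listed; on a closed walk it is counted once, at the end, and both classes have the same size.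
    alternate : ∀ {x L z} → Walk x L z → Alternating (x ∷ L) → NonAdj y x → NonAdj y z →
                ∃ λ A → ∃ λ B → L ↭ A ++ B × length A ≡ length B ×
                All (NonAdj y) A × All (λ b → E y b × E b y) B
    alternate nil l h k = [] , [] , ↭-refl , refl , [] , []
    alternate (e ▹ nil) (r ∷ _ , s ∷ _) (h , h′) (k , k′) =
      ⊥-elim (0≢1 (trans (sym (cong₂ _+_ (χ-no-arc h′) (χ-no-arc k′))) r))
      where
      0≢1 : ¬ (0 ≡ 1)
      0≢1 ()
    alternate {x} (_▹_ {y = b} e (_▹_ {y = a} {L = L} e′ w)) (r ∷ r′ ∷ l , s ∷ s′ ∷ l′) (h , h′) k
      with trans (cong (_+ χ b y) (sym (χ-no-arc h′))) r | trans (cong (_+ χ y b) (sym (χ-no-arc h))) s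
    ... | b→y | y→b with alternate w (l , l′) nonadj-a k
      where
      nonadj-a : NonAdj y a
      nonadj-a = none (ℕ.suc-injective (trans (cong (_+ χ y a) (sym y→b)) s′)) ,
                 none (ℕ.suc-injective (trans (cong (_+ χ a y) (sym b→y)) r′))
    ... | A , B , p , q , as , bs = a ∷ A , b ∷ B , (permute ([ b ] ∷ [ a ] ∷ L ∷ A ∷ B ∷ [])
        (λ { (a ∷ b ∷ c ∷ d ∷ e ∷ []) → a ⊕ b ⊕ c ≈ b ⊕ d ⊕ a ⊕ e , c ≈ d ⊕ e ∷ [] })
        refl (p ∷ [])) , cong suc q ,
          (none (ℕ.suc-injective (trans (cong (_+ χ y a) (sym y→b)) s′)) ,
           none (ℕ.suc-injective (trans (cong (_+ χ a y) (sym b→y)) r′))) ∷ as , (one y→b , one b→y) ∷ bs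

    -- By alternation the cycle neighbours of `a` satisfy u → y → b, so `y` can replace `a` on the
    -- cycle. Since δ y ≤ n, the degree condition gives δ a ≥ n, and the arcs at `a` alternate along
    -- the new cycle in phase with those at `y` along the old one.
    twin : ∀ {a b M u} → E a b → Walk b M u → E u a → y ∷ b ∷ M ++ a ∷ [] ↭ all → NonAdj y a →
           All (λ v → χ v a ≡ χ v y × χ a v ≡ χ y v) (b ∷ M)
    twin {a} {b} {M} {u} e w e′ p (h , h′) = All.zip (same-in , same-out)
      where
      old : Walk a (b ∷ M ++ a ∷ []) a
      old = e ▹ (w ⧺ [ e′ ]ʷ)
      old-in : Linked (λ u v → χ u y + χ v y ≡ 1) (a ∷ b ∷ M ++ a ∷ [])
      old-in = in-alternating old p full
      old-out : Linked (λ u v → χ y u + χ y v ≡ 1) (a ∷ b ∷ M ++ a ∷ [])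
      old-out = out-alternating old p full
      u→y : E u y
      u→y = one (trans (trans (sym (ℕ.+-identityʳ _)) (cong (χ u y +_) (sym (χ-no-arc h′))))
                       (linked-join w (linked-++ʳ (a ∷ []) old-in)))
      y→b : E y b
      y→b = one (trans (cong (_+ χ y b) (sym (χ-no-arc h))) (linked-at [] old-out))
      new : Walk y (b ∷ M ++ y ∷ []) y
      new = y→b ▹ (w ⧺ [ u→y ]ʷ)
      spans : a ∷ b ∷ M ++ y ∷ [] ↭ all
      spans = (permute ([ a ] ∷ [ b ] ∷ M ∷ [ y ] ∷ all ∷ [])
          (λ { (a ∷ b ∷ c ∷ d ∷ e ∷ []) → a ⊕ b ⊕ c ⊕ d ≈ e , d ⊕ b ⊕ c ⊕ a ≈ e ∷ [] })
          refl (p ∷ []))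
      y≢a : y ≢ a
      y≢a = distinct (permute ([ y ] ∷ [ a ] ∷ [ b ] ∷ M ∷ all ∷ [])
          (λ { (a ∷ b ∷ c ∷ d ∷ e ∷ []) → a ⊕ b ⊕ c ⊕ d ≈ e , a ⊕ c ⊕ d ⊕ b ≈ e ∷ [] })
          refl (p ∷ []))
      full-a : n ≤ δ a
      full-a = ℕ.≮⇒≥ λ k → (absurd ((δ a) ∷ n ∷ (δ y) ∷ [])
          (λ { (a ∷ b ∷ c ∷ []) → 𝟙 ⊕ a ≼ b ∷ c ≼ b ∷ b ⊕ b ≼ c ⊕ a ∷ [] })
          refl (k ∷ deg≤n old p ∷ ore y≢a (h , h′) ∷ []))
      same-in : All (λ v → χ v a ≡ χ v y) (b ∷ M)
      same-in = synchronous (λ v → χ v a) (λ v → χ v y) (trans (χ-no-arc h) (sym (χ-no-arc h′)))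
        (linked-++ˡ (y ∷ b ∷ M) (in-alternating new spans full-a)) (linked-++ˡ (a ∷ b ∷ M) old-in)
      same-out : All (λ v → χ a v ≡ χ y v) (b ∷ M)
      same-out = synchronous (χ a) (χ y) (trans (χ-no-arc h′) (sym (χ-no-arc h)))
        (linked-++ˡ (y ∷ b ∷ M) (out-alternating new spans full-a)) (linked-++ˡ (a ∷ b ∷ M) old-out)

    twin-at : ∀ {a L} → Walk a L a → y ∷ L ↭ all → NonAdj y a →
              ∀ {v} → v ∈ L → v ≡ a ⊎ (χ v a ≡ χ v y × χ a v ≡ χ y v)
    twin-at (e ▹ nil) p h i = ⊥-elim (none (χ-loop _) e)
    twin-at {a} (_▹_ {y = b} e w@(_▹_ {y = b′} {L = L} _ _)) p h {v} i =
      let (u , M , w′ , e′ , eq) = walk-∷ʳ w in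
      result (Perm.∈-resp-↭ (prep b (↭-trans (↭-reflexive eq) (Perm.++-comm M (a ∷ [])))) i)
             (twin e w′ e′ (permute ([ y ] ∷ [ b ] ∷ M ∷ [ a ] ∷ all ∷ [ b′ ] ∷ L ∷ [])
                 (λ { (a ∷ b ∷ c ∷ d ∷ e ∷ f ∷ g ∷ []) → a ⊕ b ⊕ c ⊕ d ≈ e , a ⊕ b ⊕ f ⊕ g ≈ e ∷
                       c ⊕ d ≈ f ⊕ g ∷ [] })
                 refl (p ∷ ↭-sym (↭-reflexive eq) ∷ [])) h)
      where
      result : ∀ {M} → v ∈ (b ∷ a ∷ M) → All (λ v → χ v a ≡ χ v y × χ a v ≡ χ y v) (b ∷ M) → v ≡ a ⊎ (χ v a ≡ χ v y × χ a v ≡ χ y v)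
      result (here refl) (same ∷ _) = inj₂ same
      result (there (here refl)) _ = inj₁ refl
      result (there (there j)) (_ ∷ same) = inj₂ (All.lookup same j)

  full-degree : ∀ {y} → Low y → n ≤ δ y → ∀ {x} → x ≢ y → ¬ NonAdj y x
  full-degree {y} low-y full {x} x≢y h with low-closed low-y
  ... | c , L₀ , w₀ , p₀ = contradiction (rotate-closed w₀ (x∈ (Perm.∈-resp-↭ (↭-sym p₀) (covers x))))
    where
    x∈ : ∀ {L} → x ∈ (y ∷ L) → x ∈ L
    x∈ (here e) = ⊥-elim (x≢y e)
    x∈ (there i) = i
    contradiction : (∃ λ L → Walk x L x × L ↭ L₀) → ⊥
    contradiction (L , w , r) with (permute ([ y ] ∷ L ∷ all ∷ L₀ ∷ [])
        (λ { (a ∷ b ∷ c ∷ d ∷ []) → a ⊕ b ≈ c , a ⊕ d ≈ c ∷ b ≈ d ∷ [] })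
        refl (p₀ ∷ r ∷ []))
    ... | p with alternate full w (in-alternating w p full , out-alternating w p full) h h
    ... | A , B , q , eq , as , bs = no-D₀ (y ∷ A) B (permute ([ y ] ∷ A ∷ B ∷ all ∷ L ∷ [])
        (λ { (a ∷ b ∷ c ∷ d ∷ e ∷ []) → a ⊕ b ⊕ c ≈ d , a ⊕ e ≈ d ∷ b ⊕ c ≈ e ∷ [] })
        refl (p ∷ ↭-sym q ∷ [])) (cong suc eq) independent complete
      where
      ∈L : ∀ {v} → v ∈ (A ++ B) → v ∈ L
      ∈L = Perm.∈-resp-↭ (↭-sym q)
      twins : ∀ {a v} → a ∈ A → v ∈ (A ++ B) → v ≡ a ⊎ (χ v a ≡ χ v y × χ a v ≡ χ y v)
      twins i j with rotate-closed w (∈L (Mem.∈-++⁺ˡ i))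
      ... | L′ , w′ , r′ = twin-at full w′ (permute ([ y ] ∷ L′ ∷ all ∷ L ∷ [])
          (λ { (a ∷ b ∷ c ∷ d ∷ []) → a ⊕ b ≈ c , a ⊕ d ≈ c ∷ b ≈ d ∷ [] })
          refl (p ∷ r′ ∷ [])) (All.lookup as i) (Perm.∈-resp-↭ (↭-sym r′) (∈L j))
      independent : ∀ {a a′} → a ∈ (y ∷ A) → a′ ∈ (y ∷ A) → NonAdj a a′
      independent (here refl) (here refl) = none (χ-loop y) , none (χ-loop y)
      independent (here refl) (there j) = All.lookup as j
      independent (there i) (here refl) = let (h₁ , h₂) = All.lookup as i in h₂ , h₁
      independent (there i) (there j) with twins i (Mem.∈-++⁺ˡ j)
      ... | inj₁ refl = none (χ-loop _) , none (χ-loop _)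
      ... | inj₂ (e , e′) = let (h₁ , h₂) = All.lookup as j in
              none (trans e′ (χ-no-arc h₁)) , none (trans e (χ-no-arc h₂))
      complete : ∀ {a b} → a ∈ (y ∷ A) → b ∈ B → E a b × E b a
      complete (here refl) j = All.lookup bs j
      complete (there i) j with twins i (Mem.∈-++⁺ʳ A j)
      ... | inj₁ refl = let (h₁ , _) = All.lookup as i ; (e , _) = All.lookup bs j in ⊥-elim (h₁ e)
      ... | inj₂ (e , e′) = let (e₁ , e₂) = All.lookup bs j in
              one (trans e′ (χ-arc e₁)) , one (trans e (χ-arc e₂))

  -- One of the two endpoints of a gap has degree at most n: all gap vertices are inserted into
  -- the walk between the other endpoint and its neighbour, but the endpoint itself cannot be.
  gap-end : ∀ {y α β α⁻ P z Z} → Walk β P α⁻ → y ∷ α ∷ (β ∷ P) ++ z ∷ Z ↭ all →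
            E β y → E α⁻ y → ¬ E α y → NonAdj α β → All (NonAdj y) (z ∷ Z) →
            All (λ v → n + length (z ∷ Z) ≤ δ v) (z ∷ Z) → ¬ E z α →
            δ α ≤ n × (n ≤ δ α → Low β)
  gap-end {y} {α} {β} {α⁻} {P} {z} {Z} w p β→y α⁻→y α↛y (α↛β , β↛α) nonadj big z↛α with saturate w z Z
  ... | saturated {visited} {rest} {inserted} w′ q r (inj₂ (r₀ , R , eq , stuck)) = ⊥-elim (by-cases inserted refl)
    where
    spans : y ∷ α ∷ (β ∷ visited) ++ rest ↭ all
    spans = (permute ([ y ] ∷ [ α ] ∷ [ β ] ∷ visited ∷ rest ∷ all ∷ P ∷
          [ z ] ∷ Z ∷ inserted ∷ [])
        (λ { (a ∷ b ∷ c ∷ d ∷ e ∷ f ∷ g ∷ h ∷ i ∷ j ∷ []) → a ⊕ b ⊕ c ⊕ d ⊕ e ≈ f , a ⊕ b ⊕ c ⊕ g ⊕ h ⊕ i ≈ f ∷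
              d ≈ g ⊕ j ∷ e ⊕ j ≈ h ⊕ i ∷ [] })
        refl (p ∷ q ∷ ↭-sym r ∷ []))
    members : ∀ {v} → v ∈ rest → v ∈ (z ∷ Z)
    members i = Perm.∈-resp-↭ (↭-sym r) (Mem.∈-++⁺ˡ i)
    -- A vertex left over has d(v) ≤ n - 2 + |rest| + d(v, α). Being at least n + |z ∷ Z|, its
    -- degree forces `rest` to be the whole gap and d(v, α) = 2; for v = z the latter contradicts z
    -- ↛ α.
    excess : ∀ {v} → v ∈ rest → length (z ∷ Z) ≤ length rest × (dg v (α ∷ []) ≤ 1 → ⊥)
    excess {v} i = (ℕ.≮⇒≥ λ h →
        (absurd ((length rest) ∷ (length (z ∷ Z)) ∷ n ∷ (δ v) ∷
              (dg v (y ∷ [])) ∷ (dg v (α ∷ (β ∷ visited) ++ rest)) ∷ (dg v (α ∷ [])) ∷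
              (dg v ((β ∷ visited) ++ rest)) ∷ (dg v (β ∷ visited)) ∷ (dg v rest) ∷ (length (β ∷ visited)) ∷
              (χ v β) ∷ (χ α⁻ v) ∷ (length ((β ∷ visited) ++ rest)) ∷ [])
            (λ { (a ∷ b ∷ c ∷ d ∷ e ∷ f ∷ g ∷ h ∷ i ∷ j ∷ k ∷ l ∷ m ∷ n ∷ []) → 𝟙 ⊕ a ≼ b ∷ c ⊕ b ≼ d ∷
                  d ≼ e ⊕ f ∷ e ≼ ∅ ∷ f ≼ g ⊕ h ∷ h ≼ i ⊕ j ∷ (i ⊕ j) ⊕ 𝟙 ⊕ 𝟙 ⊕ 𝟙 ≼ (k ⊕ l ⊕ m) ⊕ a ⊕ a ∷
                  l ≼ 𝟙 ∷ m ≼ 𝟙 ∷ g ≼ 𝟙 ⊕ 𝟙 ∷ 𝟙 ⊕ 𝟙 ⊕ n ≼ 𝟙 ⊕ c ∷ k ⊕ a ≼ n ∷ [] })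
            refl (h ∷ All.lookup big (members i) ∷
              ≡⇒≤ (trans (dg-↭ v (↭-sym spans)) (dg-++ v (y ∷ []) (α ∷ (β ∷ visited) ++ rest))) ∷
              ≡⇒≤ (dg-nonadj v (not-y ∷ [])) ∷ ≡⇒≤ (dg-++ v (α ∷ []) ((β ∷ visited) ++ rest)) ∷
              ≡⇒≤ (dg-++ v (β ∷ visited) rest) ∷ dg-rest w′ (All.lookup stuck i) i ∷ χ≤1 v β ∷ χ≤1 α⁻ v ∷
              dg≤2 v α ∷ ≡⇒≤ (trans (Perm.↭-length spans) size) ∷ ≡⇒≥ (List.length-++ (β ∷ visited)) ∷ []))) ,
      λ few → (absurd ((length rest) ∷ (length (z ∷ Z)) ∷ n ∷ (δ v) ∷
            (dg v (y ∷ [])) ∷ (dg v (α ∷ (β ∷ visited) ++ rest)) ∷ (dg v (α ∷ [])) ∷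
            (dg v ((β ∷ visited) ++ rest)) ∷ (dg v (β ∷ visited)) ∷ (dg v rest) ∷ (length (β ∷ visited)) ∷
            (χ v β) ∷ (χ α⁻ v) ∷ (length ((β ∷ visited) ++ rest)) ∷ [])
          (λ { (a ∷ b ∷ c ∷ d ∷ e ∷ f ∷ g ∷ h ∷ i ∷ j ∷ k ∷ l ∷ m ∷ n ∷ []) → a ≼ b ∷ c ⊕ b ≼ d ∷ d ≼ e ⊕ f ∷
                e ≼ ∅ ∷ f ≼ g ⊕ h ∷ h ≼ i ⊕ j ∷ (i ⊕ j) ⊕ 𝟙 ⊕ 𝟙 ⊕ 𝟙 ≼ (k ⊕ l ⊕ m) ⊕ a ⊕ a ∷ l ≼ 𝟙 ∷ m ≼ 𝟙 ∷
                g ≼ 𝟙 ∷ 𝟙 ⊕ 𝟙 ⊕ n ≼ 𝟙 ⊕ c ∷ k ⊕ a ≼ n ∷ [] })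
          refl (fewer ∷ All.lookup big (members i) ∷
            ≡⇒≤ (trans (dg-↭ v (↭-sym spans)) (dg-++ v (y ∷ []) (α ∷ (β ∷ visited) ++ rest))) ∷
            ≡⇒≤ (dg-nonadj v (not-y ∷ [])) ∷ ≡⇒≤ (dg-++ v (α ∷ []) ((β ∷ visited) ++ rest)) ∷
            ≡⇒≤ (dg-++ v (β ∷ visited) rest) ∷ dg-rest w′ (All.lookup stuck i) i ∷ χ≤1 v β ∷ χ≤1 α⁻ v ∷ few ∷
            ≡⇒≤ (trans (Perm.↭-length spans) size) ∷ ≡⇒≥ (List.length-++ (β ∷ visited)) ∷ []))
      where
      not-y : NonAdj v y
      not-y = let (h , h′) = All.lookup nonadj (members i) in h′ , h
      fewer : length rest ≤ length (z ∷ Z)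
      fewer = ℕ.≮⇒≥ λ h → (absurd ((length (z ∷ Z)) ∷ (length rest) ∷
            (length inserted) ∷ [])
          (λ { (a ∷ b ∷ c ∷ []) → 𝟙 ⊕ a ≼ b ∷ b ⊕ c ≼ a ∷ [] })
          refl (h ∷ ≡⇒≥ (trans (Perm.↭-length r) (List.length-++ rest)) ∷ []))
    by-cases : ∀ I → I ≡ inserted → ⊥
    by-cases [] refl = proj₂ (excess z∈) (dg≤1ˡ z↛α)
      where
      z∈ : z ∈ rest
      z∈ = Perm.∈-resp-↭ (permute ([ z ] ∷ Z ∷ rest ∷ [])
          (λ { (a ∷ b ∷ c ∷ []) → a ⊕ b ≈ c , a ⊕ b ≈ c ⊕ ∅ ∷ [] })
          refl (r ∷ [])) (here refl)
    by-cases (i ∷ I) refl = (absurd ((length (z ∷ Z)) ∷ (length rest) ∷ (length I) ∷ [])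
        (λ { (a ∷ b ∷ c ∷ []) → a ≼ b ∷ b ⊕ 𝟙 ⊕ c ≼ a ∷ [] })
        refl (proj₁ (excess (subst (r₀ ∈_) (sym eq) (here refl))) ∷
          ≡⇒≥ (trans (Perm.↭-length r) (List.length-++ rest)) ∷ []))
  ... | saturated {visited} {_} {inserted} _ q r (inj₁ (z′ , L , refl , w′ , s)) with insertʷ? w′ α
  -- With `α` inserted as well, the walk from β to α⁻ misses only y, and α⁻ → y extends it to a
  -- hamiltonian path, while β → y.
  ...   | inj₁ (L′ , w″ , s′) = ⊥-elim (no-bypass (w″ ⧺ [ α⁻→y ]ʷ)
          (permute ([ β ] ∷ L′ ∷ [ y ] ∷ all ∷ [ α ] ∷ L ∷ [ z′ ] ∷
                visited ∷ [ z ] ∷ Z ∷ inserted ∷ P ∷ [])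
              (λ { (a ∷ b ∷ c ∷ d ∷ e ∷ f ∷ g ∷ h ∷ i ∷ j ∷ k ∷ l ∷ []) → a ⊕ b ⊕ c ≈ d , b ≈ e ⊕ f ∷
                    f ≈ g ⊕ h ∷ g ⊕ k ≈ i ⊕ j ∷ h ≈ l ⊕ k ∷ c ⊕ e ⊕ (a ⊕ l) ⊕ i ⊕ j ≈ d ∷ [] })
              refl (s′ ∷ s ∷ ↭-sym r ∷ q ∷ p ∷ [])) β→y)
  ...   | inj₂ stuck = bound , tight
    where
    spans : y ∷ α ∷ β ∷ L ↭ all
    spans = (permute ([ y ] ∷ [ α ] ∷ [ β ] ∷ L ∷ all ∷ [ z′ ] ∷
          visited ∷ [ z ] ∷ Z ∷ inserted ∷ P ∷ [])
        (λ { (a ∷ b ∷ c ∷ d ∷ e ∷ f ∷ g ∷ h ∷ i ∷ j ∷ k ∷ []) → a ⊕ b ⊕ c ⊕ d ≈ e , d ≈ f ⊕ g ∷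
              f ⊕ j ≈ h ⊕ i ∷ g ≈ k ⊕ j ∷ a ⊕ b ⊕ (c ⊕ k) ⊕ h ⊕ i ≈ e ∷ [] })
        refl (s ∷ ↭-sym r ∷ q ∷ p ∷ []))
    δα : δ α ≡ dg α (y ∷ []) + dg α (β ∷ L)
    δα = trans (deg-rest (permute ([ α ] ∷ [ y ] ∷ [ β ] ∷ L ∷ all ∷ [])
        (λ { (a ∷ b ∷ c ∷ d ∷ e ∷ []) → a ⊕ b ⊕ c ⊕ d ≈ e , b ⊕ a ⊕ c ⊕ d ≈ e ∷ [] })
        refl (spans ∷ []))) (dg-++ α (y ∷ []) (β ∷ L))
    from-y : dg α (y ∷ []) ≤ 1
    from-y = dg≤1ˡ α↛y
    bound : δ α ≤ n
    bound = ℕ.≮⇒≥ λ h → (absurd (n ∷ (δ α) ∷ (dg α (y ∷ [])) ∷ (dg α (β ∷ L)) ∷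
          (length (β ∷ L)) ∷ (χ α β) ∷ (χ α⁻ α) ∷ [])
        (λ { (a ∷ b ∷ c ∷ d ∷ e ∷ f ∷ g ∷ []) → 𝟙 ⊕ a ≼ b ∷ b ≼ c ⊕ d ∷ c ≼ 𝟙 ∷ d ⊕ 𝟙 ≼ e ⊕ f ⊕ g ∷ f ≼ ∅ ∷
              g ≼ 𝟙 ∷ 𝟙 ⊕ 𝟙 ⊕ e ≼ 𝟙 ⊕ a ∷ [] })
        refl (h ∷ ≡⇒≤ δα ∷ from-y ∷ dg-uninsertable w′ α stuck ∷ ≡⇒≤ (χ-no-arc α↛β) ∷ χ≤1 α⁻ α ∷
          ≡⇒≤ (trans (Perm.↭-length spans) size) ∷ []))
    tight : n ≤ δ α → Low β
    tight full = next w′ spans (tight-uninsertable w′ α stuck (ℕ.≮⇒≥ λ h →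
      (absurd (n ∷ (δ α) ∷ (dg α (y ∷ [])) ∷ (dg α (β ∷ L)) ∷
            (length (β ∷ L)) ∷ (χ α β) ∷ (χ α⁻ α) ∷ [])
          (λ { (a ∷ b ∷ c ∷ d ∷ e ∷ f ∷ g ∷ []) → a ≼ b ∷ b ≼ c ⊕ d ∷ c ≼ 𝟙 ∷ 𝟙 ⊕ d ⊕ 𝟙 ≼ e ⊕ f ⊕ g ∷ f ≼ ∅ ∷
                g ≼ 𝟙 ∷ 𝟙 ⊕ 𝟙 ⊕ e ≼ 𝟙 ⊕ a ∷ [] })
          refl (full ∷ ≡⇒≤ δα ∷ from-y ∷ h ∷ ≡⇒≤ (χ-no-arc α↛β) ∷ χ≤1 α⁻ α ∷
            ≡⇒≤ (trans (Perm.↭-length spans) size) ∷ []))))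
      where
      y→α : E y α
      y→α = arc-χ (ℕ.≮⇒≥ λ h → (absurd ((χ y α) ∷ n ∷ (δ α) ∷ (χ α y) ∷ (dg α (β ∷ L)) ∷
            (length (β ∷ L)) ∷ (χ α β) ∷ (χ α⁻ α) ∷ [])
          (λ { (a ∷ b ∷ c ∷ d ∷ e ∷ f ∷ g ∷ h ∷ []) → 𝟙 ⊕ a ≼ 𝟙 ∷ b ≼ c ∷ c ≼ ((d ⊕ ∅) ⊕ a ⊕ ∅) ⊕ e ∷ d ≼ ∅ ∷
                e ⊕ 𝟙 ≼ f ⊕ g ⊕ h ∷ g ≼ ∅ ∷ h ≼ 𝟙 ∷ 𝟙 ⊕ 𝟙 ⊕ f ≼ 𝟙 ⊕ b ∷ [] })
          refl (h ∷ full ∷ ≡⇒≤ δα ∷ ≡⇒≤ (χ-no-arc α↛y) ∷ dg-uninsertable w′ α stuck ∷ ≡⇒≤ (χ-no-arc α↛β) ∷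
            χ≤1 α⁻ α ∷ ≡⇒≤ (trans (Perm.↭-length spans) size) ∷ [])))
      next : ∀ {L} → Walk β L α⁻ → y ∷ α ∷ β ∷ L ↭ all → Linked (λ u v → χ u α + χ α v ≡ 1) (β ∷ L) → Low β
      next nil t l = ⊥-elim (short (trans (Perm.↭-length t) size) (trans (Perm.↭-length p) size))
        where
        short : 3 ≡ suc n → suc (suc (suc (length (P ++ z ∷ Z)))) ≡ suc n → ⊥
        short h k = (absurd (n ∷ (length (P ++ z ∷ Z)) ∷ (length P) ∷
              (length Z) ∷ [])
            (λ { (a ∷ b ∷ c ∷ d ∷ []) → 𝟙 ⊕ a ≼ 𝟙 ⊕ 𝟙 ⊕ 𝟙 ∷ 𝟙 ⊕ 𝟙 ⊕ 𝟙 ⊕ b ≼ 𝟙 ⊕ a ∷ c ⊕ 𝟙 ⊕ d ≼ b ∷ [] })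
            refl (≡⇒≥ h ∷ ≡⇒≤ k ∷ ≡⇒≥ (List.length-++ P) ∷ []))
      -- At the first pair equality and β ↛ α give α → v, so v ... α⁻ → y → α → v is a cycle missing
      -- only β.
      next (_▹_ {y = v} {L = L} e w″) t (l ∷ _) = v , L ++ y ∷ α ∷ [] , α , w″ ⧺ (α⁻→y ▹ [ y→α ]ʷ) ,
        arc-χ (ℕ.≤-reflexive (sym (trans (cong (_+ χ α v) (sym (χ-no-arc β↛α))) l))) ,
        (permute ([ β ] ∷ [ v ] ∷ L ∷ [ y ] ∷ [ α ] ∷ all ∷ [])
            (λ { (a ∷ b ∷ c ∷ d ∷ e ∷ f ∷ []) → a ⊕ b ⊕ c ⊕ d ⊕ e ≈ f , d ⊕ e ⊕ a ⊕ b ⊕ c ≈ f ∷ [] })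
            refl (t ∷ []))

  -- The situation in which both ends of a hamiltonian path rotate within blocks M and N.
  module _ (no-low : ∀ {y} → ¬ Low y) where

    Clique : List V → Set
    Clique X = ∀ {x y} → x ∈ X → y ∈ X → x ≢ y → E x y

    clique-walk : ∀ {x X R} → Clique (x ∷ X) → (x ∷ X) ++ R ↭ all → ∃ λ y → Walk x X y × y ∈ (x ∷ X)
    clique-walk {x} {[]} c p = x , nil , here refl
    clique-walk {x} {v ∷ X} {R} c p =
      let (y , w , i) = clique-walk {v} {X} {x ∷ R} (λ i j → c (there i) (there j)) (permute ([ v ] ∷ X ∷ [ x ] ∷ R ∷ all ∷ []) (λ { (a ∷ b ∷ c ∷ d ∷ e ∷ []) → (a ⊕ b) ⊕ c ⊕ d ≈ e , (c ⊕ a ⊕ b) ⊕ d ≈ e ∷ [] }) refl (p ∷ []))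
      in y , c (here refl) (there (here refl)) (distinct p) ▹ w , there i

    module _ {κ ω m m′ ν ν′ M N} (clique : Clique (m ∷ M)) (m⇝m′ : Walk m M m′) (ν⇝ν′ : Walk ν N ν′)
             (m′∈ : m′ ∈ (m ∷ M)) (ω→ν : E ω ν) (ν′→κ : E ν′ κ)
             (to-κ : ∀ {x} → x ∈ (m ∷ M) → E x κ) (from-ω : ∀ {x} → x ∈ (m ∷ M) → E ω x) where

      member-apart : ∀ {x z R} → x ∷ z ∷ R ↭ m ∷ M → ∀ {T} → (m ∷ M) ++ T ↭ all → x ≢ z
      member-apart {x} {z} {R} q {T} p = distinct (permute ([ x ] ∷ [ z ] ∷ R ∷ T ∷ all ∷ [ m ] ∷ M ∷ [])
          (λ { (a ∷ b ∷ c ∷ d ∷ e ∷ f ∷ g ∷ []) → a ⊕ b ⊕ c ⊕ d ≈ e , a ⊕ b ⊕ c ≈ f ⊕ g ∷ (f ⊕ g) ⊕ d ≈ e ∷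
                [] })
          refl (q ∷ p ∷ []))

      -- Otherwise x ... z → v ... ω → ν ... ν′ → κ ... u → x is a hamiltonian cycle. Its arc
      -- leaving `x` stays inside the clique, which also contains the reverse arc; so the path from
      -- the successor of `x` round to `x` is a bypass.
      no-block : ∀ {A u v B x z R} → Walk κ A u → Walk v B ω → (m ∷ M) ++ (κ ∷ A) ++ (v ∷ B) ++ (ν ∷ N) ↭ all →
                 m ∷ M ↭ x ∷ R ++ z ∷ [] → ¬ (E u x × E z v)
      no-block {A} {u} {v} {B} {x} {z} {R} w₁ w₂ p q (u→x , z→v)
        with clique-walk {x} {R ++ z ∷ []} {(κ ∷ A) ++ (v ∷ B) ++ ν ∷ N} (λ i j → clique (Perm.∈-resp-↭ (↭-sym q) i) (Perm.∈-resp-↭ (↭-sym q) j))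
               (permute ([ x ] ∷ R ∷ [ z ] ∷ [ κ ] ∷ A ∷ [ v ] ∷ B ∷ [ ν ] ∷
                     N ∷ all ∷ [ m ] ∷ M ∷ [])
                   (λ { (a ∷ b ∷ c ∷ d ∷ e ∷ f ∷ g ∷ h ∷ i ∷ j ∷ k ∷ l ∷ []) → (a ⊕ b ⊕ c) ⊕ (d ⊕ e) ⊕ (f ⊕ g) ⊕ h ⊕ i ≈ j , a ⊕ b ⊕ c ≈ k ⊕ l ∷
                         (k ⊕ l) ⊕ (d ⊕ e) ⊕ (f ⊕ g) ⊕ h ⊕ i ≈ j ∷ [] })
                   refl (↭-sym q ∷ p ∷ []))
      ... | z′ , walk , _ = cycle R walk refl
        where
        end-unique : ∀ {a X b c} → Walk a (X ++ b ∷ []) c → c ≡ b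
        end-unique {X = []} (_ ▹ nil) = refl
        end-unique {X = _ ∷ X} (_ ▹ w) = end-unique {X = X} w
        cycle : ∀ R′ → Walk x (R′ ++ z ∷ []) z′ → R′ ≡ R → ⊥
        cycle R′ walk′ refl with end-unique {X = R} walk′
        cycle [] (_ ▹ nil) refl | refl = no-bypass (z→v ▹ (w₂ ⧺ (ω→ν ▹ (ν⇝ν′ ⧺ (ν′→κ ▹ (w₁ ⧺ [ u→x ]ʷ))))))
          (permute ([ z ] ∷ [ v ] ∷ B ∷ [ ν ] ∷ N ∷ [ κ ] ∷ A ∷ [ x ] ∷
                all ∷ [ m ] ∷ M ∷ [])
              (λ { (a ∷ b ∷ c ∷ d ∷ e ∷ f ∷ g ∷ h ∷ i ∷ j ∷ k ∷ []) → a ⊕ b ⊕ c ⊕ d ⊕ e ⊕ f ⊕ g ⊕ h ≈ i , h ⊕ a ≈ j ⊕ k ∷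
                    (j ⊕ k) ⊕ (f ⊕ g) ⊕ (b ⊕ c) ⊕ d ⊕ e ≈ i ∷ [] })
              refl (↭-sym q ∷ p ∷ []))
          (clique (Perm.∈-resp-↭ (↭-sym q) (there (here refl))) (Perm.∈-resp-↭ (↭-sym q) (here refl)) λ eq → member-apart (↭-sym q) p (sym eq))
        cycle (r ∷ R″) (_ ▹ walk″) refl | refl = no-bypass (walk″ ⧺ (z→v ▹ (w₂ ⧺ (ω→ν ▹ (ν⇝ν′ ⧺ (ν′→κ ▹ (w₁ ⧺ [ u→x ]ʷ)))))))
          (permute ([ r ] ∷ R″ ∷ [ z ] ∷ [ v ] ∷ B ∷ [ ν ] ∷ N ∷
                [ κ ] ∷ A ∷ [ x ] ∷ all ∷ [ m ] ∷ M ∷ [])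
              (λ { (a ∷ b ∷ c ∷ d ∷ e ∷ f ∷ g ∷ h ∷ i ∷ j ∷ k ∷ l ∷ m ∷ []) → a ⊕ (b ⊕ c) ⊕ d ⊕ e ⊕ f ⊕ g ⊕ h ⊕ i ⊕ j ≈ k , j ⊕ a ⊕ b ⊕ c ≈ l ⊕ m ∷
                    (l ⊕ m) ⊕ (h ⊕ i) ⊕ (d ⊕ e) ⊕ f ⊕ g ≈ k ∷ [] })
              refl (↭-sym q ∷ p ∷ []))
          (clique (Perm.∈-resp-↭ (↭-sym q) (there (here refl))) (Perm.∈-resp-↭ (↭-sym q) (here refl)) λ eq → member-apart (↭-sym q) p (sym eq))

      OneWay : V → List V → Set
      OneWay x = Linked (λ u v → χ u x + χ x v ≡ 1)

      enters : ∀ {x u v B} → OneWay x (u ∷ v ∷ B) → ¬ E x v → E u x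
      enters {x} {u} (r ∷ _) x↛v = arc-χ (ℕ.≤-reflexive (sym (trans (sym (ℕ.+-identityʳ _)) (trans (cong (χ u x +_) (sym (χ-no-arc x↛v))) r))))

      leaves : ∀ {x u v B} → OneWay x (u ∷ v ∷ B) → ¬ E u x → E x v
      leaves {x} {u} {v} (r ∷ _) u↛x = arc-χ (ℕ.≤-reflexive (sym (trans (cong (_+ χ x v) (sym (χ-no-arc u↛x))) r)))

      not-both : ∀ {x u v B} → OneWay x (u ∷ v ∷ B) → E u x → ¬ E x v
      not-both (r ∷ _) u→x x→v with trans (sym (cong₂ _+_ (χ-arc u→x) (χ-arc x→v))) r
      ... | ()

      -- z → v is impossible, by `no-block` if z differs from x and by equality at the pair u, v if
      -- z is x. The same equality for z then yields u → z.
      uniform : ∀ {A u v B x z} → Walk κ A u → Walk v B ω → (m ∷ M) ++ (κ ∷ A) ++ (v ∷ B) ++ (ν ∷ N) ↭ all →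
                (∀ {x} → x ∈ (m ∷ M) → OneWay x (u ∷ v ∷ B)) → x ∈ (m ∷ M) → z ∈ (m ∷ M) → E u x → E u z
      uniform {u = u} {v} {x = x} {z} w₁ w₂ p ones i j u→x = enters (ones j) (blocked (Mem.∈-∃++ i))
        where
        blocked : (∃ λ X → ∃ λ Y → m ∷ M ≡ X ++ x ∷ Y) → ¬ E z v
        blocked (X , Y , eq) with Perm.∈-resp-↭ (permute ([ m ] ∷ M ∷ [ x ] ∷ X ∷ Y ∷ [])
            (λ { (a ∷ b ∷ c ∷ d ∷ e ∷ []) → a ⊕ b ≈ c ⊕ d ⊕ e , a ⊕ b ≈ d ⊕ c ⊕ e ∷ [] })
            refl (↭-reflexive eq ∷ [])) j
        ... | here refl = not-both (ones i) u→x
        ... | there k with Mem.∈-∃++ k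
        ...   | X′ , Y′ , eq′ = λ z→v → no-block {R = X′ ++ Y′} w₁ w₂ p
                  (permute ([ m ] ∷ M ∷ [ x ] ∷ X′ ∷ Y′ ∷ [ z ] ∷ X ∷ Y ∷ [])
                      (λ { (a ∷ b ∷ c ∷ d ∷ e ∷ f ∷ g ∷ h ∷ []) → a ⊕ b ≈ c ⊕ (d ⊕ e) ⊕ f , a ⊕ b ≈ g ⊕ c ⊕ h ∷
                            g ⊕ h ≈ d ⊕ f ⊕ e ∷ [] })
                      refl (↭-reflexive eq ∷ ↭-reflexive eq′ ∷ [])) (u→x , z→v)

      -- Domination of the whole block passes from `u` to the next vertex `v` as soon as v → m′. If
      -- v ↛ m′, equality gives an arc from m′ to the vertex after `v`, and a cycle misses only `v`.
      -- Once `v` is `ω`, the path from ω through N, κ ... u and M is a bypass, since ω → m′.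
      climb : ∀ {A u v B} → Walk κ A u → E u v → Walk v B ω → (m ∷ M) ++ (κ ∷ A) ++ (v ∷ B) ++ (ν ∷ N) ↭ all →
              (∀ {x} → x ∈ (m ∷ M) → OneWay x (u ∷ v ∷ B)) → (∀ {x} → x ∈ (m ∷ M) → E u x) → ⊥
      climb {A} w₁ _ nil p ones in-u = no-bypass (ω→ν ▹ (ν⇝ν′ ⧺ (ν′→κ ▹ (w₁ ⧺ (in-u (here refl) ▹ m⇝m′)))))
        (permute ([ ω ] ∷ [ ν ] ∷ N ∷ [ κ ] ∷ A ∷ [ m ] ∷ M ∷ all ∷
              [])
            (λ { (a ∷ b ∷ c ∷ d ∷ e ∷ f ∷ g ∷ h ∷ []) → a ⊕ b ⊕ c ⊕ d ⊕ e ⊕ f ⊕ g ≈ h , (f ⊕ g) ⊕ (d ⊕ e) ⊕ a ⊕ b ⊕ c ≈ h ∷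
                  [] })
            refl (p ∷ [])) (from-ω m′∈)
      climb {A} {u} {v} w₁ e (_▹_ {y = t} {L = B} e′ w₂) p ones in-u with E? v m′
      ... | yes v→m′ = climb (w₁ ⧺ [ e ]ʷ) e′ w₂ p′ ones′ (λ j → uniform (w₁ ⧺ [ e ]ʷ) w₂ p′ ones′ m′∈ j v→m′)
        where
        p′ : (m ∷ M) ++ (κ ∷ A ++ v ∷ []) ++ (t ∷ B) ++ (ν ∷ N) ↭ all
        p′ = (permute ([ m ] ∷ M ∷ [ κ ] ∷ A ∷ [ v ] ∷ [ t ] ∷ B ∷ [ ν ] ∷
              N ∷ all ∷ [])
            (λ { (a ∷ b ∷ c ∷ d ∷ e ∷ f ∷ g ∷ h ∷ i ∷ j ∷ []) → (a ⊕ b) ⊕ (c ⊕ d ⊕ e) ⊕ (f ⊕ g) ⊕ h ⊕ i ≈ j , (a ⊕ b) ⊕ (c ⊕ d) ⊕ (e ⊕ f ⊕ g) ⊕ h ⊕ i ≈ j ∷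
                  [] })
            refl (p ∷ []))
        ones′ : ∀ {x} → x ∈ (m ∷ M) → OneWay x (v ∷ t ∷ B)
        ones′ j = linked-++ʳ (u ∷ []) (ones j)
      ... | no v↛m′ = no-low {v} (m , M ++ t ∷ B ++ ν ∷ N ++ κ ∷ A , u , m⇝m′ ⧺ (leaves (linked-++ʳ (u ∷ []) (ones m′∈)) v↛m′ ▹ (w₂ ⧺ (ω→ν ▹ (ν⇝ν′ ⧺ (ν′→κ ▹ w₁))))) ,
              in-u (here refl) , (permute ([ v ] ∷ [ m ] ∷ M ∷ [ t ] ∷ B ∷ [ ν ] ∷ N ∷ [ κ ] ∷
                    A ∷ all ∷ [])
                  (λ { (a ∷ b ∷ c ∷ d ∷ e ∷ f ∷ g ∷ h ∷ i ∷ j ∷ []) → a ⊕ b ⊕ c ⊕ d ⊕ e ⊕ f ⊕ g ⊕ h ⊕ i ≈ j , (b ⊕ c) ⊕ (h ⊕ i) ⊕ (a ⊕ d ⊕ e) ⊕ f ⊕ g ≈ j ∷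
                        [] })
                  refl (p ∷ [])))

      -- The induction starts at `κ`: if m′ → v, the path from m through M, v ... ω and N to κ would
      -- be a bypass, as m → κ. Hence κ → m′.
      long-middle : ∀ {v B} → E κ v → Walk v B ω → (m ∷ M) ++ (κ ∷ []) ++ (v ∷ B) ++ (ν ∷ N) ↭ all →
                    (∀ {x} → x ∈ (m ∷ M) → OneWay x (κ ∷ v ∷ B)) → ⊥
      long-middle {v} {B} e w p ones = climb nil e w p ones λ j → uniform nil w p ones m′∈ j (enters (ones m′∈) λ m′→v →
        no-bypass (m⇝m′ ⧺ (m′→v ▹ (w ⧺ (ω→ν ▹ (ν⇝ν′ ⧺ [ ν′→κ ]ʷ)))))
          (permute ([ m ] ∷ M ∷ [ v ] ∷ B ∷ [ ν ] ∷ N ∷ [ κ ] ∷ all ∷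
                [])
              (λ { (a ∷ b ∷ c ∷ d ∷ e ∷ f ∷ g ∷ h ∷ []) → a ⊕ b ⊕ c ⊕ d ⊕ e ⊕ f ⊕ g ≈ h , (a ⊕ b) ⊕ g ⊕ (c ⊕ d) ⊕ e ⊕ f ≈ h ∷
                    [] })
              refl (p ∷ [])) (to-κ (here refl)))

    two-blocks : ∀ {κ ω K m M ν N} → Walk κ K ω → (m ∷ M) ++ (κ ∷ K) ++ (ν ∷ N) ↭ all →
                 (∀ {x z} → x ∈ (m ∷ M) → z ∈ (ν ∷ N) → NonAdj x z) →
                 (∀ {x} → x ∈ (m ∷ M) → Uninsertable x (κ ∷ K)) → (∀ {z} → z ∈ (ν ∷ N) → Uninsertable z (κ ∷ K)) → ⊥
    two-blocks nil p apart-MN um uν = no-cliques p apart-MN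
    two-blocks {κ} {ω} {v ∷ B} {m} {M} {ν} {N} (e ▹ w) p apart-MN um uν =
      let (m′ , m⇝m′ , m′∈) = clique-walk clique-M p
          (ν′ , ν⇝ν′ , ν′∈) = clique-walk {R = (m ∷ M) ++ κ ∷ v ∷ B} clique-N (permute ([ ν ] ∷ N ∷ [ m ] ∷ M ∷ [ κ ] ∷ [ v ] ∷ B ∷ all ∷
                [])
              (λ { (a ∷ b ∷ c ∷ d ∷ e ∷ f ∷ g ∷ h ∷ []) → (a ⊕ b) ⊕ (c ⊕ d) ⊕ e ⊕ f ⊕ g ≈ h , (c ⊕ d) ⊕ (e ⊕ f ⊕ g) ⊕ a ⊕ b ≈ h ∷
                    [] })
              refl (p ∷ []))
      in long-middle clique-M m⇝m′ ν⇝ν′ m′∈ (proj₁ (proj₂ (proj₂ (tight-N (here refl))))) (proj₁ (proj₂ (tight-N ν′∈)))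
           (λ i → proj₁ (proj₂ (tight-M i))) (λ i → proj₁ (proj₂ (proj₂ (tight-M i)))) e w p (λ i → proj₂ (proj₂ (proj₂ (tight-M i))))
      where
      tight-M : ∀ {x} → x ∈ (m ∷ M) → Tight x (m ∷ M) κ ω (v ∷ B)
      tight-M i = tight-end (e ▹ w) p apart-MN i (here refl) (um i) (uν (here refl))
      tight-N : ∀ {z} → z ∈ (ν ∷ N) → Tight z (ν ∷ N) κ ω (v ∷ B)
      tight-N j = tight-end {N = m ∷ M} (e ▹ w) (permute ([ ν ] ∷ N ∷ [ κ ] ∷ [ v ] ∷ B ∷ [ m ] ∷ M ∷ all ∷
            [])
          (λ { (a ∷ b ∷ c ∷ d ∷ e ∷ f ∷ g ∷ h ∷ []) → (a ⊕ b) ⊕ (c ⊕ d ⊕ e) ⊕ f ⊕ g ≈ h , (f ⊕ g) ⊕ (c ⊕ d ⊕ e) ⊕ a ⊕ b ≈ h ∷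
                [] })
          refl (p ∷ []))
        (λ k l → let (h , h′) = apart-MN l k in h′ , h) j (here refl) (uν j) (um (here refl))
      clique-M : Clique (m ∷ M)
      clique-M i j x≢z = complete-arc i j x≢z (proj₁ (tight-M i))
      clique-N : Clique (ν ∷ N)
      clique-N i j x≢z = complete-arc i j x≢z (proj₁ (tight-N i))

-- The first vertex of a path is moved into its interior again and again; the vertices that come first
-- infinitely often form a block in which each of them can be made the first one.
module Rotation {V : Set} (arc : V → V → Bool) (Q : List V → Set) (S : List V)
                (spans : ∀ {L} → Q L → L ↭ S)
                (move : ∀ {x L L′} → Q (x ∷ L) → Walks.Insert arc x L L′ → Q L′) where
  open Walks arc

  insert-++ : ∀ {z} B {L L′} → Insert z L L′ → Insert z (B ++ L) (B ++ L′)
  insert-++ [] i = i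
  insert-++ (b ∷ B) i = there (insert-++ B i)

  -- An insertion at the border of the two parts is of the first kind: it leaves `F` intact.
  insert-split : ∀ {z a} C {F L′} → Insert z ((a ∷ C) ++ F) L′ → (∃ λ C′ → L′ ≡ (a ∷ C′) ++ F) ⊎ (∃ λ F′ → Insert z F F′)
  insert-split {z} [] (here _ _) = inj₁ (z ∷ [] , refl)
  insert-split [] (there i) = inj₂ (_ , i)
  insert-split {z} (c ∷ C) (here _ _) = inj₁ (z ∷ c ∷ C , refl)
  insert-split {z} {a} (c ∷ C) (there i) with insert-split C i
  ... | inj₁ (C′ , eq) = inj₁ (c ∷ C′ , cong (a ∷_) eq)
  ... | inj₂ j = inj₂ j

  insert-uninsertable : ∀ {z F F′} → Insert z F F′ → ¬ Uninsertable z F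
  insert-uninsertable (here e e′) (r ∷ _) with subst₂ (λ i j → i + j ≤ 1) (χ-arc e) (χ-arc e′) r
  ... | s≤s ()
  insert-uninsertable (there i@(here _ _)) (_ ∷ l) = insert-uninsertable i l
  insert-uninsertable (there i@(there _)) l = insert-uninsertable i (linked-++ʳ (_ ∷ []) l)

  Front : V → List V → Set
  Front a F = ∃ λ A → Q ((a ∷ A) ++ F)

  -- Behind a non-empty prefix such a suffix is frozen: later moves rearrange only what precedes it.
  Closed : List V → Set
  Closed F = ∀ {a A} → Q ((a ∷ A) ++ F) → Uninsertable a F

  ¬¬-all : ∀ {P : V → Set} L → (∀ {a} → a ∈ L → ¬ ¬ P a) → ¬ ¬ (∀ {a} → a ∈ L → P a)
  ¬¬-all [] h k = k λ ()
  ¬¬-all (x ∷ L) h k = h (here refl) λ px → ¬¬-all L (h ∘ there) λ pL → k λ { (here refl) → px ; (there i) → pL i }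

  module _ (stable : ∀ {m M F} → Q ((m ∷ M) ++ F) → (∀ {a} → a ∈ (m ∷ M) → Front a F × Uninsertable a F) → F ≢ [] → ⊥) where

    Shorter : ℕ → Set
    Shorter N = ∀ {m M F} → length (m ∷ M) < N → Q ((m ∷ M) ++ F) → Closed F → F ≢ [] → ⊥

    -- A vertex a that never becomes the first vertex stays behind a block B, and then a ∷ C ++ F is a longer closed suffix.
    always-front : ∀ {N F} → Shorter N → Closed F → F ≢ [] → ∀ j B {a C} → length B ≤ j →
                   length (B ++ a ∷ C) ≡ N → Q (B ++ (a ∷ C) ++ F) → ¬ Front a F → ⊥
    always-front shorter closed f≢ j [] short eq q ¬front = ¬front (_ , q)
    always-front {N} {F} shorter closed f≢ (suc j) (x ∷ B) {a} {C} (s≤s short) eq q ¬front =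
      shorter {M = B} less q closed′ λ ()
      where
      less : suc (length B) < N
      less = ℕ.≰⇒> λ l → (absurd (N ∷ (length B) ∷ (length (B ++ a ∷ C)) ∷
            (length C) ∷ [])
          (λ { (a ∷ b ∷ c ∷ d ∷ []) → a ≼ 𝟙 ⊕ b ∷ 𝟙 ⊕ c ≼ a ∷ b ⊕ 𝟙 ⊕ d ≼ c ∷ [] })
          refl (l ∷ ≡⇒≤ eq ∷ ≡⇒≥ (List.length-++ B) ∷ []))
      closed′ : Closed ((a ∷ C) ++ F)
      closed′ {b} {B′} q′ with insert? b ((a ∷ C) ++ F)
      ... | inj₂ l = l
      ... | inj₁ (L′ , i) with insert-split C i
      ...   | inj₂ (_ , i′) = ⊥-elim (insert-uninsertable i′ (closed {b} {B′ ++ a ∷ C} (subst Q (cong (b ∷_) (sym (List.++-assoc B′ (a ∷ C) F))) q′)))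
      -- The insertion behind `a` brings `a` one place nearer to the front, hence the smaller bound
      -- `j`.
      ...   | inj₁ (C′ , refl) = ⊥-elim (always-front shorter closed f≢ j B′ {a} {C′} (ℕ.≤-trans (ℕ.≤-reflexive same) short) total
              (move q′ (insert-++ B′ i)) ¬front)
        where
        same : length B′ ≡ length B
        same = ℕ.≤-antisym
          (ℕ.≮⇒≥ λ l → (absurd ((length B) ∷ (length B′) ∷
                (length (B′ ++ (a ∷ C) ++ F)) ∷ (length (B ++ (a ∷ C) ++ F)) ∷ (length ((a ∷ C) ++ F)) ∷ [])
              (λ { (a ∷ b ∷ c ∷ d ∷ e ∷ []) → 𝟙 ⊕ a ≼ b ∷ 𝟙 ⊕ c ≼ 𝟙 ⊕ d ∷ b ⊕ e ≼ c ∷ d ≼ a ⊕ e ∷ [] })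
              refl (l ∷ ≡⇒≤ sizes ∷ ≡⇒≥ (List.length-++ B′) ∷ ≡⇒≤ (List.length-++ B) ∷ [])))
          (ℕ.≮⇒≥ λ l → (absurd ((length B′) ∷ (length B) ∷
                (length (B′ ++ (a ∷ C) ++ F)) ∷ (length (B ++ (a ∷ C) ++ F)) ∷ (length ((a ∷ C) ++ F)) ∷ [])
              (λ { (a ∷ b ∷ c ∷ d ∷ e ∷ []) → 𝟙 ⊕ a ≼ b ∷ 𝟙 ⊕ d ≼ 𝟙 ⊕ c ∷ c ≼ a ⊕ e ∷ b ⊕ e ≼ d ∷ [] })
              refl (l ∷ ≡⇒≥ sizes ∷ ≡⇒≤ (List.length-++ B′) ∷ ≡⇒≥ (List.length-++ B) ∷ [])))
          where
          sizes : suc (length (B′ ++ (a ∷ C) ++ F)) ≡ suc (length (B ++ (a ∷ C) ++ F))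
          sizes = Perm.↭-length (↭-trans (spans q′) (↭-sym (spans q)))
        longer : length C′ ≡ suc (length C)
        longer = ℕ.suc-injective (ℕ.+-cancelʳ-≡ (length F) _ _
          (trans (sym (List.length-++ (a ∷ C′))) (trans (Perm.↭-length (insert-↭ i)) (cong suc (List.length-++ (a ∷ C))))))
        total : length (B′ ++ a ∷ C′) ≡ N
        total = trans (trans (List.length-++ B′) (trans (cong₂ _+_ same (cong suc longer)) (trans (ℕ.+-suc (length B) _) (cong suc (sym (List.length-++ B)))))) eq

    -- Induction on the prefix: either all its vertices can come first with `F` unchanged, which
    -- `stable` refutes, or the closed suffix can be enlarged.
    rotate-closed-suffix : ∀ k {m M F} → length M ≤ k → Q ((m ∷ M) ++ F) → Closed F → F ≢ [] → ⊥
    rotate-closed-suffix k {m} {M} {F} h q closed f≢ =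
      ¬¬-all (m ∷ M) (λ i ¬front → let (B , C , eq) = Mem.∈-∃++ i in
          always-front {length (m ∷ M)} (shorter k h) closed f≢ (length B) B ℕ.≤-refl (cong length (sym eq))
            (subst Q (trans (cong (_++ F) eq) (List.++-assoc B _ F)) q) ¬front)
        λ fronts → stable q (λ i → fronts i , closed (proj₂ (fronts i))) f≢
      where
      shorter : ∀ k → length M ≤ k → Shorter (suc (length M))
      shorter zero h′ (s≤s l) q′ closed′ f≢′ = ℕ.n≮0 (ℕ.≤-trans l h′)
      shorter (suc k) h′ (s≤s l) q′ closed′ f≢′ = rotate-closed-suffix k (ℕ.≤-pred (ℕ.≤-trans l h′)) q′ closed′ f≢′

    rotation : ∀ {m M e} → Q ((m ∷ M) ++ e ∷ []) → ⊥
    rotation {M = M} q = rotate-closed-suffix (length M) ℕ.≤-refl q (λ _ → [-]) λ ()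

-- The Bondy–Thomassen argument for Meyniel's theorem, in a digraph with a vertex ∞ adjacent to all others.
module Meyniel {V : Set} (all : List V) (nodup : ∀ {x L} → ¬ (x ∷ x ∷ L ↭ all))
               (n : ℕ) (size : length all ≡ suc n)
               (arc : V → V → Bool) (loopless : ∀ x → arc x x ≡ false)
               (ore : ∀ {x y} → x ≢ y → Walks.NonAdj arc x y →
                      suc (n + n) ≤ Walks.dg arc x all + Walks.dg arc y all)
               (∞ : V) (universal : ∀ {x} → x ≢ ∞ → Walks.E arc ∞ x × Walks.E arc x ∞) where
  open Spanning all nodup n size arc loopless

  -- Maximality stated negatively: no cycle through `∞` misses fewer than r vertices. The cycle is
  -- cut at a and b, `Q` holds the inner vertices of the return walk and `U` the vertices off the
  -- cycle.
  Longest : ℕ → Set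
  Longest r = ∀ {b P a Q U} → Walk b P a → Walk a (Q ++ b ∷ []) b → (b ∷ P) ++ Q ++ U ↭ all → ∞ ∈ (b ∷ P) → length U < r → ⊥

  middle-≤1 : ∀ {x w z} → ¬ (E x w × E w z) → χ x w + χ w z ≤ 1
  middle-≤1 {x} {w} {z} h with arc x w | arc w z
  ... | true | true = ⊥-elim (h (refl , refl))
  ... | true | false = s≤s z≤n
  ... | false | true = s≤s z≤n
  ... | false | false = z≤n

  -- Each `w` carries at most one of the arcs u → w, w → z and at most one of z → w, w → u.
  through : ∀ u z W → (∀ {w} → w ∈ W → ¬ (E u w × E w z) × ¬ (E z w × E w u)) → dg u W + dg z W ≤ length W + length W
  through u z [] h = z≤n
  through u z (w ∷ W) h = ℕ.≮⇒≥ λ l →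
    (absurd ((length W) ∷ (χ u w) ∷ (∑ (χ u) W) ∷ (χ w u) ∷
          (∑ (λ v → χ v u) W) ∷ (χ z w) ∷ (∑ (χ z) W) ∷ (χ w z) ∷ (∑ (λ v → χ v z) W) ∷ [])
        (λ { (a ∷ b ∷ c ∷ d ∷ e ∷ f ∷ g ∷ h ∷ i ∷ []) → 𝟙 ⊕ (𝟙 ⊕ a) ⊕ 𝟙 ⊕ a ≼ ((b ⊕ c) ⊕ d ⊕ e) ⊕ (f ⊕ g) ⊕ h ⊕ i ∷
              (c ⊕ e) ⊕ g ⊕ i ≼ a ⊕ a ∷ b ⊕ h ≼ 𝟙 ∷ f ⊕ d ≼ 𝟙 ∷ [] })
        refl (l ∷ through u z W (h ∘ there) ∷ middle-≤1 (proj₁ (h (here refl))) ∷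
          middle-≤1 (proj₂ (h (here refl))) ∷ []))

  walk-cut : ∀ {a} Z {b} {x} R → Walk a (Z ++ x ∷ R) b → Walk a (Z ++ x ∷ []) x × Walk x R b
  walk-cut [] R (e ▹ w) = [ e ]ʷ , w
  walk-cut (z ∷ Z) R (e ▹ w) = let (w₁ , w₂) = walk-cut Z R w in e ▹ w₁ , w₂

  -- A detour u ∷ Q off the cycle runs parallel to the segment Z. An arc between the two, or a path
  -- from u to Z or back through one vertex of U, yields a detour around a shorter segment. Once all
  -- these are excluded, u and a vertex of Z that cannot be reinserted are non-adjacent with degree
  -- sum at most 2n.
  no-gap : ∀ {r} → Longest r → ∀ k {b P a Z u Q U} → length Z ≤ k → Walk b P a → Walk a (Z ++ b ∷ []) b → Walk a (u ∷ Q ++ b ∷ []) b →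
           (b ∷ P) ++ Z ++ (u ∷ Q) ++ U ↭ all → ∞ ∈ (b ∷ P) → suc (length Q + length U) ≡ r → ⊥
  no-gap longest k {Z = []} {u} {Q} {U} h w _ q p i refl = longest {Q = u ∷ Q} w q p i (s≤s (ℕ.m≤n+m (length U) (length Q)))
  no-gap longest (suc k) {b} {P} {a} {Z@(z₀ ∷ Z₀)} {u} {Q} {U} (s≤s h) w z⇝ q@(a→u ▹ u⇝b) p i refl = finish (saturate w z₀ Z₀)
    where
    shorter : ∀ {X z Y} → Z ≡ X ++ z ∷ Y → length X ≤ k × length Y ≤ k
    shorter {X} {z} {Y} eq = ℕ.≮⇒≥ (λ l → (absurd (k ∷ (length X) ∷ (length Z₀) ∷ (length Y) ∷ [])
        (λ { (a ∷ b ∷ c ∷ d ∷ []) → 𝟙 ⊕ a ≼ b ∷ b ⊕ 𝟙 ⊕ d ≼ 𝟙 ⊕ c ∷ c ≼ a ∷ [] })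
        refl (l ∷ ≡⇒≥ (trans (cong length eq) (List.length-++ X)) ∷ h ∷ []))) ,
                             ℕ.≮⇒≥ (λ l → (absurd (k ∷ (length Y) ∷ (length Z₀) ∷ (length X) ∷ [])
                                 (λ { (a ∷ b ∷ c ∷ d ∷ []) → 𝟙 ⊕ a ≼ b ∷ d ⊕ 𝟙 ⊕ b ≼ 𝟙 ⊕ c ∷ c ≼ a ∷ [] })
                                 refl (l ∷ ≡⇒≥ (trans (cong length eq) (List.length-++ X)) ∷ h ∷ [])))

    same : ∀ {v R U′} → (v ∷ R) ++ U′ ↭ (u ∷ Q) ++ U → suc (length R + length U′) ≡ suc (length Q + length U)
    same {R = R} s = trans (cong suc (sym (List.length-++ R))) (trans (Perm.↭-length s) (cong suc (List.length-++ Q)))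

    gap-at : ∀ {z X Y} → Z ≡ X ++ z ∷ Y → Walk a (X ++ z ∷ []) z × Walk z (Y ++ b ∷ []) b
    gap-at {z} {X} {Y} eq = walk-cut X (Y ++ b ∷ []) (subst (λ K → Walk a K b) (trans (cong (_++ b ∷ []) eq) (List.++-assoc X (z ∷ Y) (b ∷ []))) z⇝)

    into : ∀ {z X Y} D {U′} → Z ≡ X ++ z ∷ Y → D ≢ [] → Walk a (D ++ z ∷ []) z → D ++ U′ ↭ (u ∷ Q) ++ U → ⊥
    into [] eq D≢ detour s = D≢ refl
    into {z} {X} {Y} (v ∷ R) {U′} eq _ detour s = let (w₁ , w₂) = gap-at eq in
      no-gap longest k (proj₁ (shorter eq)) (w₂ ⧺ w) w₁ detour
        (permute ([ z ] ∷ Y ∷ [ b ] ∷ P ∷ X ∷ [ v ] ∷ R ∷ U′ ∷ all ∷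
              Z ∷ [ u ] ∷ Q ∷ U ∷ [])
            (λ { (a ∷ b ∷ c ∷ d ∷ e ∷ f ∷ g ∷ h ∷ i ∷ j ∷ k ∷ l ∷ m ∷ []) → (a ⊕ (b ⊕ c) ⊕ d) ⊕ e ⊕ (f ⊕ g) ⊕ h ≈ i , e ⊕ a ⊕ b ≈ j ∷
                  (f ⊕ g) ⊕ h ≈ (k ⊕ l) ⊕ m ∷ (c ⊕ d) ⊕ j ⊕ (k ⊕ l) ⊕ m ≈ i ∷ [] })
            refl (↭-sym (↭-reflexive eq) ∷ s ∷ p ∷ []))
        (there (keep i)) (same {v} {R} {U′} s)
      where
      keep : ∞ ∈ (b ∷ P) → ∞ ∈ ((Y ++ b ∷ []) ++ P)
      keep (here refl) = Mem.∈-++⁺ˡ (Mem.∈-++⁺ʳ Y (here refl))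
      keep (there j) = Mem.∈-++⁺ʳ (Y ++ b ∷ []) j

    out-of : ∀ {z X Y} v R {U′} → Z ≡ X ++ z ∷ Y → Walk z ((v ∷ R) ++ b ∷ []) b → (v ∷ R) ++ U′ ↭ (u ∷ Q) ++ U → ⊥
    out-of {z} {X} {Y} v R {U′} eq detour s = let (w₁ , w₂) = gap-at eq in
      no-gap longest k (proj₂ (shorter eq)) (w ⧺ w₁) w₂ detour
        (permute ([ b ] ∷ P ∷ X ∷ [ z ] ∷ Y ∷ [ v ] ∷ R ∷ U′ ∷ all ∷
              Z ∷ [ u ] ∷ Q ∷ U ∷ [])
            (λ { (a ∷ b ∷ c ∷ d ∷ e ∷ f ∷ g ∷ h ∷ i ∷ j ∷ k ∷ l ∷ m ∷ []) → (a ⊕ b ⊕ c ⊕ d) ⊕ e ⊕ (f ⊕ g) ⊕ h ≈ i , c ⊕ d ⊕ e ≈ j ∷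
                  (f ⊕ g) ⊕ h ≈ (k ⊕ l) ⊕ m ∷ (a ⊕ b) ⊕ j ⊕ (k ⊕ l) ⊕ m ≈ i ∷ [] })
            refl (↭-sym (↭-reflexive eq) ∷ s ∷ p ∷ []))
        (Mem.∈-++⁺ˡ i) (same {v} {R} {U′} s)

    nonadj : ∀ {v z} → v ∈ (u ∷ Q) → z ∈ Z → NonAdj v z
    nonadj {v} {z} j j′ =
      let (Q₁ , Q₂ , eq) = Mem.∈-∃++ j
          (X , Y , eq′) = Mem.∈-∃++ j′
          (w₁ , w₂) = walk-cut Q₁ (Q₂ ++ b ∷ []) (subst (λ K → Walk a K b) (trans (cong (_++ b ∷ []) eq) (List.++-assoc Q₁ (v ∷ Q₂) (b ∷ []))) q)
      in (λ e → into (Q₁ ++ v ∷ []) {Q₂ ++ U} eq′ (nonempty Q₁) (w₁ ⧺ [ e ]ʷ)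
             (permute (Q₁ ∷ [ v ] ∷ Q₂ ∷ U ∷ [ u ] ∷ Q ∷ [])
                 (λ { (a ∷ b ∷ c ∷ d ∷ e ∷ f ∷ []) → (a ⊕ b) ⊕ c ⊕ d ≈ (e ⊕ f) ⊕ d , a ⊕ b ⊕ c ≈ e ⊕ f ∷ [] })
                 refl (↭-sym (↭-reflexive eq) ∷ []))) ,
         (λ e → out-of v Q₂ {Q₁ ++ U} eq′ (e ▹ w₂) (permute ([ v ] ∷ Q₂ ∷ Q₁ ∷ U ∷ [ u ] ∷ Q ∷ [])
             (λ { (a ∷ b ∷ c ∷ d ∷ e ∷ f ∷ []) → (a ⊕ b) ⊕ c ⊕ d ≈ (e ⊕ f) ⊕ d , c ⊕ a ⊕ b ≈ e ⊕ f ∷ [] })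
             refl (↭-sym (↭-reflexive eq) ∷ [])))
      where
      nonempty : ∀ A {x : V} → A ++ x ∷ [] ≢ []
      nonempty [] ()
      nonempty (_ ∷ _) ()

    avoid : ∀ {z} → z ∈ Z → ∀ {v} → v ∈ (Q ++ U) → ¬ (E u v × E v z) × ¬ (E z v × E v u)
    avoid {z} j {v} j′ with Mem.∈-++⁻ Q j′
    ... | inj₁ l = let (h , h′) = nonadj (there l) j in (λ (_ , e) → h e) , (λ (e , _) → h′ e)
    ... | inj₂ l = let (U₁ , U₂ , eq) = Mem.∈-∃++ l ; (X , Y , eq′) = Mem.∈-∃++ j in
          (λ (e , e′) → into (u ∷ v ∷ []) {Q ++ U₁ ++ U₂} eq′ (λ ()) (a→u ▹ e ▹ [ e′ ]ʷ)
              (permute ([ u ] ∷ [ v ] ∷ Q ∷ U₁ ∷ U₂ ∷ U ∷ [])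
                  (λ { (a ∷ b ∷ c ∷ d ∷ e ∷ f ∷ []) → (a ⊕ b) ⊕ c ⊕ d ⊕ e ≈ (a ⊕ c) ⊕ f , d ⊕ b ⊕ e ≈ f ∷ [] })
                  refl (↭-sym (↭-reflexive eq) ∷ []))) ,
          (λ (e , e′) → out-of v (u ∷ Q) {U₁ ++ U₂} eq′ (e ▹ e′ ▹ u⇝b) (permute ([ v ] ∷ [ u ] ∷ Q ∷ U₁ ∷ U₂ ∷ U ∷ [])
              (λ { (a ∷ b ∷ c ∷ d ∷ e ∷ f ∷ []) → (a ⊕ b ⊕ c) ⊕ d ⊕ e ≈ (b ⊕ c) ⊕ f , d ⊕ a ⊕ e ≈ f ∷ [] })
              refl (↭-sym (↭-reflexive eq) ∷ [])))

    finish : Saturated b P a Z → ⊥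
    -- The whole segment fits elsewhere on the cycle, so the detour can take its place.
    finish (saturated {visited} {_} {inserted} w′ s r (inj₁ (v , L , refl , w″ , t))) =
      longest {Q = u ∷ Q} w″ q (permute ([ b ] ∷ L ∷ [ u ] ∷ Q ∷ U ∷ all ∷ [ v ] ∷ visited ∷
            P ∷ inserted ∷ Z ∷ [])
          (λ { (a ∷ b ∷ c ∷ d ∷ e ∷ f ∷ g ∷ h ∷ i ∷ j ∷ k ∷ []) → (a ⊕ b) ⊕ (c ⊕ d) ⊕ e ≈ f , b ≈ g ⊕ h ∷
                h ≈ i ⊕ j ∷ g ⊕ j ≈ k ∷ (a ⊕ i) ⊕ k ⊕ (c ⊕ d) ⊕ e ≈ f ∷ [] })
          refl (t ∷ s ∷ ↭-sym r ∷ p ∷ []))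
        (keep i) (s≤s (ℕ.m≤n+m (length U) (length Q)))
      where
      keep : ∞ ∈ (b ∷ P) → ∞ ∈ (b ∷ L)
      keep (here e) = here e
      keep (there j) = there (Perm.∈-resp-↭ (↭-sym t) (there (Perm.∈-resp-↭ (↭-sym s) (Mem.∈-++⁺ˡ j))))
    finish (saturated {visited} {rest} {inserted} w′ s r (inj₂ (v , R , eq , stuck))) with insertʷ? w u
    -- `u` itself fits into the cycle, which is then longer even with Z kept.
    ... | inj₁ (L , w″ , t) = longest {Q = Z} {U = Q ++ U} w″ z⇝ (permute ([ b ] ∷ L ∷ Z ∷ Q ∷ U ∷ all ∷ [ u ] ∷ P ∷ [])
        (λ { (a ∷ b ∷ c ∷ d ∷ e ∷ f ∷ g ∷ h ∷ []) → (a ⊕ b) ⊕ c ⊕ d ⊕ e ≈ f , b ≈ g ⊕ h ∷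
              (a ⊕ h) ⊕ c ⊕ (g ⊕ d) ⊕ e ≈ f ∷ [] })
        refl (t ∷ p ∷ []))
          (keep i) (s≤s (ℕ.≤-reflexive (List.length-++ Q)))
      where
      keep : ∞ ∈ (b ∷ P) → ∞ ∈ (b ∷ L)
      keep (here e) = here e
      keep (there j) = there (Perm.∈-resp-↭ (↭-sym t) (there j))
    ... | inj₂ stuck-u = (absurd (n ∷ (δ u) ∷ (δ v) ∷ (dg u (b ∷ P)) ∷
          (dg u (Z ++ Q ++ U)) ∷ (dg u Z) ∷ (dg u (Q ++ U)) ∷ (length (b ∷ P)) ∷ (χ u b) ∷ (χ a u) ∷
          (dg v (u ∷ [])) ∷ (dg v ((b ∷ visited) ++ rest ++ Q ++ U)) ∷ (dg v (b ∷ visited)) ∷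
          (dg v (rest ++ Q ++ U)) ∷ (dg v rest) ∷ (dg v (Q ++ U)) ∷ (length (b ∷ visited)) ∷ (χ v b) ∷ (χ a v) ∷
          (length rest) ∷ (length (Q ++ U)) ∷ (length ((b ∷ P) ++ Z ++ Q ++ U)) ∷ (length (Z ++ Q ++ U)) ∷
          (length Z) ∷ (length inserted) ∷ [])
        (λ { (a ∷ b ∷ c ∷ d ∷ e ∷ f ∷ g ∷ h ∷ i ∷ j ∷ k ∷ l ∷ m ∷ n ∷ o ∷ p ∷ q ∷ r ∷ s ∷ t ∷ u ∷ v ∷ w ∷ x ∷ y ∷ []) → 𝟙 ⊕ a ⊕ a ≼ b ⊕ c ∷
              b ≼ d ⊕ e ∷ e ≼ f ⊕ g ∷ f ≼ ∅ ∷ d ⊕ 𝟙 ≼ h ⊕ i ⊕ j ∷ i ≼ 𝟙 ∷ j ≼ 𝟙 ∷ c ≼ k ⊕ l ∷ k ≼ ∅ ∷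
              l ≼ m ⊕ n ∷ n ≼ o ⊕ p ∷ (m ⊕ o) ⊕ 𝟙 ⊕ 𝟙 ⊕ 𝟙 ≼ (q ⊕ r ⊕ s) ⊕ t ⊕ t ∷ r ≼ 𝟙 ∷ s ≼ 𝟙 ∷
              g ⊕ p ≼ u ⊕ u ∷ v ≼ a ∷ v ≼ a ∷ h ⊕ w ≼ v ∷ h ⊕ w ≼ v ∷ x ⊕ u ≼ w ∷ x ⊕ u ≼ w ∷ t ⊕ y ≼ x ∷
              t ⊕ y ≼ x ∷ q ≼ h ⊕ y ∷ [] })
        refl (ore u≢v (nonadj (here refl) v∈) ∷ ≡⇒≤ (trans (deg-rest pu) (dg-++ u (b ∷ P) (Z ++ Q ++ U))) ∷
          ≡⇒≤ (dg-++ u Z (Q ++ U)) ∷ ≡⇒≤ (dg-nonadj u (All.tabulate λ j → nonadj (here refl) j)) ∷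
          dg-uninsertable w u stuck-u ∷ χ≤1 u b ∷ χ≤1 a u ∷
          ≡⇒≤ (trans (dg-↭ v (↭-sym spans)) (dg-++ v (u ∷ []) ((b ∷ visited) ++ rest ++ Q ++ U))) ∷
          ≡⇒≤ (dg-nonadj v (swap (nonadj (here refl) v∈) ∷ [])) ∷ ≡⇒≤ (dg-++ v (b ∷ visited) (rest ++ Q ++ U)) ∷
          ≡⇒≤ (dg-++ v rest (Q ++ U)) ∷ dg-rest w′ (All.lookup stuck v∈rest) v∈rest ∷ χ≤1 v b ∷ χ≤1 a v ∷
          through u v (Q ++ U) (avoid v∈) ∷ ≡⇒≤ (size-rest pu) ∷ ≡⇒≤ (size-rest pu) ∷
          ≡⇒≥ (List.length-++ (b ∷ P)) ∷ ≡⇒≥ (List.length-++ (b ∷ P)) ∷ ≡⇒≥ (List.length-++ Z) ∷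
          ≡⇒≥ (List.length-++ Z) ∷ ≡⇒≥ (trans (Perm.↭-length r) (List.length-++ rest)) ∷
          ≡⇒≥ (trans (Perm.↭-length r) (List.length-++ rest)) ∷
          ≡⇒≤ (cong suc (trans (Perm.↭-length s) (List.length-++ P))) ∷ []))
      where
      swap : ∀ {x z} → NonAdj x z → NonAdj z x
      swap (h , h′) = h′ , h
      v∈rest : v ∈ rest
      v∈rest = subst (v ∈_) (sym eq) (here refl)
      v∈ : v ∈ Z
      v∈ = Perm.∈-resp-↭ (↭-sym r) (Mem.∈-++⁺ˡ v∈rest)
      pu : u ∷ (b ∷ P) ++ Z ++ Q ++ U ↭ all
      pu = (permute ([ u ] ∷ [ b ] ∷ P ∷ Z ∷ Q ∷ U ∷ all ∷ [])
          (λ { (a ∷ b ∷ c ∷ d ∷ e ∷ f ∷ g ∷ []) → a ⊕ (b ⊕ c) ⊕ d ⊕ e ⊕ f ≈ g , (b ⊕ c) ⊕ d ⊕ (a ⊕ e) ⊕ f ≈ g ∷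
                [] })
          refl (p ∷ []))
      u≢v : u ≢ v
      u≢v = apart pu (Mem.∈-++⁺ʳ (b ∷ P) (Mem.∈-++⁺ˡ v∈))
      spans : u ∷ (b ∷ visited) ++ rest ++ Q ++ U ↭ all
      spans = (permute ([ u ] ∷ [ b ] ∷ visited ∷ rest ∷ Q ∷ U ∷ all ∷ P ∷
            Z ∷ inserted ∷ [])
          (λ { (a ∷ b ∷ c ∷ d ∷ e ∷ f ∷ g ∷ h ∷ i ∷ j ∷ []) → a ⊕ (b ⊕ c) ⊕ d ⊕ e ⊕ f ≈ g , (b ⊕ h) ⊕ i ⊕ (a ⊕ e) ⊕ f ≈ g ∷
                c ≈ h ⊕ j ∷ d ⊕ j ≈ i ∷ [] })
          refl (p ∷ s ∷ ↭-sym r ∷ []))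

  module _ (no-hamiltonian : ∀ {L} → Walk ∞ L ∞ → ¬ (L ↭ all)) where

    -- Cutting the cycle twice at `∞` makes the rest of it the segment Z, and for a missed vertex u
    -- the walk ∞ → u → ∞ is a detour. The universal vertex thus replaces the search for a path
    -- leaving and re-entering the cycle.
    longest : ∀ r → Longest r
    longest (suc r) {b} {P} {a} {Q} {U} w q p i (s≤s h) =
      let (L , w′ , t) = rotate-closed (w ⧺ q) (at-∞ i) in extend L w′ t U h p
      where
      at-∞ : ∞ ∈ (b ∷ P) → ∞ ∈ (P ++ Q ++ b ∷ [])
      at-∞ (here refl) = Mem.∈-++⁺ʳ P (Mem.∈-++⁺ʳ Q (here refl))
      at-∞ (there j) = Mem.∈-++⁺ˡ j
      extend : ∀ L → Walk ∞ L ∞ → L ↭ P ++ Q ++ b ∷ [] → ∀ U → length U ≤ r → (b ∷ P) ++ Q ++ U ↭ all → ⊥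
      extend L w′ t [] h p = no-hamiltonian w′ (permute (L ∷ all ∷ P ∷ Q ∷ [ b ] ∷ [])
          (λ { (a ∷ b ∷ c ∷ d ∷ e ∷ []) → a ≈ b , a ≈ c ⊕ d ⊕ e ∷ (e ⊕ c) ⊕ d ⊕ ∅ ≈ b ∷ [] })
          refl (t ∷ p ∷ []))
      extend [] w′ t (u ∷ U) h p = (absurd ((length P) ∷ (length Q) ∷ [])
          (λ { (a ∷ b ∷ []) → a ⊕ b ⊕ 𝟙 ≼ ∅ ∷ [] })
          refl (≡⇒≥ (trans (Perm.↭-length t) (trans (List.length-++ P) (cong (length P +_) (List.length-++ Q)))) ∷
            []))
      extend (l ∷ L) w′ t (u ∷ U) h p = let (_ , Z , _ , _ , eq) = walk-∷ʳ w′ in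
        no-gap {suc (length U)} (λ v v′ s j l → longest r v v′ s j (ℕ.≤-trans l h)) (length Z) {U = U} ℕ.≤-refl nil (subst (λ K → Walk ∞ K ∞) eq w′)
          (proj₁ (universal (u≢∞ Z eq)) ▹ [ proj₂ (universal (u≢∞ Z eq)) ]ʷ)
          (permute ([ ∞ ] ∷ Z ∷ [ u ] ∷ U ∷ all ∷ [ l ] ∷ L ∷ P ∷ Q ∷
                [ b ] ∷ [])
              (λ { (a ∷ b ∷ c ∷ d ∷ e ∷ f ∷ g ∷ h ∷ i ∷ j ∷ []) → a ⊕ b ⊕ c ⊕ d ≈ e , b ⊕ a ≈ f ⊕ g ∷
                    f ⊕ g ≈ h ⊕ i ⊕ j ∷ (j ⊕ h) ⊕ i ⊕ c ⊕ d ≈ e ∷ [] })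
              refl (↭-sym (↭-reflexive eq) ∷ t ∷ p ∷ []))
          (here refl) refl
        where
        u≢∞ : ∀ Z → l ∷ L ≡ Z ++ ∞ ∷ [] → u ≢ ∞
        u≢∞ Z eq = distinct (permute ([ u ] ∷ [ ∞ ] ∷ Z ∷ U ∷ all ∷ [ l ] ∷ L ∷ P ∷ Q ∷
              [ b ] ∷ [])
            (λ { (a ∷ b ∷ c ∷ d ∷ e ∷ f ∷ g ∷ h ∷ i ∷ j ∷ []) → a ⊕ b ⊕ c ⊕ d ≈ e , c ⊕ b ≈ f ⊕ g ∷
                  f ⊕ g ≈ h ⊕ i ⊕ j ∷ (j ⊕ h) ⊕ i ⊕ a ⊕ d ≈ e ∷ [] })
            refl (↭-sym (↭-reflexive eq) ∷ t ∷ p ∷ []))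

    hamiltonian : ∀ {x U} → x ∷ ∞ ∷ U ↭ all → ⊥
    hamiltonian {x} {U} p = longest (suc (length U)) {Q = x ∷ []} nil (proj₁ x-∞ ▹ [ proj₂ x-∞ ]ʷ)
      (permute ([ ∞ ] ∷ [ x ] ∷ U ∷ all ∷ [])
          (λ { (a ∷ b ∷ c ∷ d ∷ []) → a ⊕ b ⊕ c ≈ d , b ⊕ a ⊕ c ≈ d ∷ [] })
          refl (p ∷ [])) (here refl) ℕ.≤-refl
      where
      x-∞ : E ∞ x × E x ∞
      x-∞ = universal (distinct p)

module NoCounterexample (C : Counterexample) where
  open Counterexample C

  full-degree : ∀ {y} → Low y → n ≤ δ y → ∀ {x} → x ≢ y → ¬ NonAdj y x
  full-degree = OneSided.full-degree C

  -- Vertices of degree below n: gaps in their neighbourhood on a cycle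

  module _ {y} (small : δ y < n) where

    -- The degree condition lifts non-neighbours of `y` above n, while a cycle missing only z caps
    -- its degree at n.
    high : ∀ {z} → y ≢ z → NonAdj y z → ¬ Low z
    high {z} y≢z h l = (absurd ((δ y) ∷ n ∷ (δ z) ∷ [])
        (λ { (a ∷ b ∷ c ∷ []) → 𝟙 ⊕ a ≼ b ∷ b ⊕ b ≼ a ⊕ c ∷ c ≼ b ∷ [] })
        refl (small ∷ ore y≢z h ∷ low-deg l ∷ []))

    -- The patterns that make absorbing the gap into the rest of the cycle fatal: in the first, `y`
    -- closes a cycle missing one gap vertex; in the others, a hamiltonian cycle or path of G - y
    -- has ends that both dominate `y` or are both dominated by it.
    data Kind (a b : V) : Set where
      in-out : E a y → E y b → Kind a b
      in-in : E a y → E b y → Kind a b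
      out-out : E y a → E y b → Kind a b

    -- A gap: the vertices Z of a cycle avoiding y which lie between consecutive neighbours a, b of y.
    record Gap (b : V) (P : List V) (a z : V) (Z : List V) : Set where
      constructor gap
      field
        walk : Walk b P a
        across : Walk a ((z ∷ Z) ++ b ∷ []) b
        spans : y ∷ P ++ (z ∷ Z) ++ b ∷ [] ↭ all
        nonadj : All (NonAdj y) (z ∷ Z)

      spans′ : y ∷ (b ∷ P) ++ z ∷ Z ↭ all
      spans′ = (permute ([ y ] ∷ [ b ] ∷ P ∷ [ z ] ∷ Z ∷ all ∷ [])
          (λ { (a ∷ b ∷ c ∷ d ∷ e ∷ f ∷ []) → a ⊕ b ⊕ c ⊕ d ⊕ e ≈ f , a ⊕ c ⊕ d ⊕ e ⊕ b ≈ f ∷ [] })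
          refl (spans ∷ []))

      apart′ : ∀ {v} → v ∈ (z ∷ Z) → y ≢ v
      apart′ i = apart spans (Mem.∈-++⁺ʳ P (Mem.∈-++⁺ˡ i))

      δ-y : δ y ≡ dg y (b ∷ P)
      δ-y = trans (deg-rest spans′) (trans (dg-++ y (b ∷ P) (z ∷ Z))
              (trans (cong (dg y (b ∷ P) +_) (dg-nonadj y nonadj)) (ℕ.+-identityʳ _)))

      length-gap : length (b ∷ P) + length (z ∷ Z) ≡ n
      length-gap = trans (sym (List.length-++ (b ∷ P))) (size-rest spans′)

    -- The gap cannot be absorbed entirely, so some `v` gets stuck and has degree at most n - 1 + |z
    -- ∷ Z|; the degree condition for y and v gives the bound.
    count : ∀ {b P a z Z} → Gap b P a z Z → Kind a b → suc n ≤ δ y + length (z ∷ Z)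
    count {b} {P} {a} {z} {Z} g kind with saturate (Gap.walk g) z Z
    ... | saturated {visited} {rest} {inserted} w q r (inj₂ (v , R , eq , stuck)) = ℕ.≮⇒≥ λ h →
        (absurd ((δ y) ∷ (length (z ∷ Z)) ∷ n ∷ (δ v) ∷
              (dg v (y ∷ [])) ∷ (dg v ((b ∷ visited) ++ rest)) ∷ (dg v (b ∷ visited)) ∷ (dg v rest) ∷
              (length (b ∷ visited)) ∷ (χ v b) ∷ (χ a v) ∷ (length rest) ∷ (length inserted) ∷ [])
            (λ { (a ∷ b ∷ c ∷ d ∷ e ∷ f ∷ g ∷ h ∷ i ∷ j ∷ k ∷ l ∷ m ∷ []) → 𝟙 ⊕ a ⊕ b ≼ 𝟙 ⊕ c ∷
                  c ⊕ c ≼ a ⊕ d ∷ d ≼ e ⊕ f ∷ e ≼ ∅ ∷ f ≼ g ⊕ h ∷ (g ⊕ h) ⊕ 𝟙 ⊕ 𝟙 ⊕ 𝟙 ≼ (i ⊕ j ⊕ k) ⊕ l ⊕ l ∷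
                  j ≼ 𝟙 ∷ k ≼ 𝟙 ∷ i ⊕ l ≼ c ∷ l ⊕ m ≼ b ∷ [] })
            refl (h ∷ ore (Gap.apart′ g v∈) (All.lookup (Gap.nonadj g) v∈) ∷
              ≡⇒≤ (trans (dg-↭ v (↭-sym spans)) (dg-++ v (y ∷ []) ((b ∷ visited) ++ rest))) ∷
              ≡⇒≤ (dg-nonadj v (swap (All.lookup (Gap.nonadj g) v∈) ∷ [])) ∷ ≡⇒≤ (dg-++ v (b ∷ visited) rest) ∷
              dg-rest w (All.lookup stuck i) i ∷ χ≤1 v b ∷ χ≤1 a v ∷
              ≡⇒≤ (trans (sym (List.length-++ (b ∷ visited))) (size-rest spans)) ∷
              ≡⇒≥ (trans (Perm.↭-length r) (List.length-++ rest)) ∷ []))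
      where
      i : v ∈ rest
      i = subst (v ∈_) (sym eq) (here refl)
      v∈ : v ∈ (z ∷ Z)
      v∈ = Perm.∈-resp-↭ (↭-sym r) (Mem.∈-++⁺ˡ i)
      swap : ∀ {u} → NonAdj y u → NonAdj u y
      swap (h , h′) = h′ , h
      spans : y ∷ (b ∷ visited) ++ rest ↭ all
      spans = (permute ([ y ] ∷ [ b ] ∷ visited ∷ rest ∷ all ∷ P ∷ [ z ] ∷
            Z ∷ inserted ∷ [])
          (λ { (a ∷ b ∷ c ∷ d ∷ e ∷ f ∷ g ∷ h ∷ i ∷ []) → a ⊕ b ⊕ c ⊕ d ≈ e , a ⊕ b ⊕ f ⊕ g ⊕ h ≈ e ∷
                c ≈ f ⊕ i ∷ d ⊕ i ≈ g ⊕ h ∷ [] })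
          refl (Gap.spans′ g ∷ q ∷ ↭-sym r ∷ []))
    ... | saturated {visited} {_} {inserted} w q r (inj₁ (v , L , refl , w′ , s)) = ⊥-elim (impossible kind)
      where
      v∈ : v ∈ (z ∷ Z)
      v∈ = Perm.∈-resp-↭ (↭-sym r) (here refl)
      full : y ∷ b ∷ L ↭ all
      full = (permute ([ y ] ∷ [ b ] ∷ L ∷ all ∷ [ v ] ∷ visited ∷ [ z ] ∷
            Z ∷ inserted ∷ P ∷ [])
          (λ { (a ∷ b ∷ c ∷ d ∷ e ∷ f ∷ g ∷ h ∷ i ∷ j ∷ []) → a ⊕ b ⊕ c ≈ d , c ≈ e ⊕ f ∷ e ⊕ i ≈ g ⊕ h ∷
                f ≈ j ⊕ i ∷ a ⊕ b ⊕ j ⊕ g ⊕ h ≈ d ∷ [] })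
          refl (s ∷ ↭-sym r ∷ q ∷ Gap.spans′ g ∷ []))
      impossible : Kind a b → ⊥
      impossible (in-out e e′) = high (Gap.apart′ g v∈) (All.lookup (Gap.nonadj g) v∈)
        (b , visited ++ y ∷ [] , y , w ⧺ [ e ]ʷ , e′ ,
         (permute ([ v ] ∷ [ b ] ∷ visited ∷ [ y ] ∷ all ∷ L ∷ [])
             (λ { (a ∷ b ∷ c ∷ d ∷ e ∷ f ∷ []) → a ⊕ b ⊕ c ⊕ d ≈ e , a ⊕ c ≈ f ∷ d ⊕ b ⊕ f ≈ e ∷ [] })
             refl (↭-sym s ∷ full ∷ [])))
      impossible (in-in e e′) = no-consecutive-in w′ full (e , e′)
      impossible (out-out e e′) = no-consecutive-out w′ full (e , e′)

    one-of : ∀ {i j} → i + j ≡ 1 → i ≡ 1 → j ≡ 0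
    one-of refl refl = refl

    other-of : ∀ {i j} → i + j ≡ 1 → i ≡ 0 → j ≡ 1
    other-of e refl = e

    1≢0 : ∀ {k} → k ≡ 1 → k ≡ 0 → ⊥
    1≢0 refl ()

    -- As b is joined to y by both arcs, alternation makes c a non-neighbour and c′ again a
    -- neighbour by both arcs. Then c alone is a gap, and `count` for a gap of one vertex says n ≤ δ
    -- y.
    no-alternating-gap : ∀ {b c P a z Z} → E b c → Walk c P a → Walk a ((z ∷ Z) ++ b ∷ []) b →
      y ∷ (c ∷ P) ++ (z ∷ Z) ++ b ∷ [] ↭ all → E b y → E y b → E a y →
      Linked (λ u v → χ u y + χ v y ≡ 1) (b ∷ c ∷ P) → Linked (λ u v → χ y u + χ y v ≡ 1) (b ∷ c ∷ P) → ⊥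
    no-alternating-gap e nil q p b→y y→b a→y (r ∷ _) _ = 1≢0 (χ-arc a→y) (one-of r (χ-arc b→y))
    no-alternating-gap {b} {c} {z = z} {Z} e (_▹_ {y = c′} {L = P} e′ w) q p b→y y→b a→y (r ∷ r′ ∷ _) (s ∷ s′ ∷ _) =
      (absurd ((δ y) ∷ n ∷ [])
          (λ { (a ∷ b ∷ []) → 𝟙 ⊕ a ≼ b ∷ 𝟙 ⊕ b ≼ a ⊕ 𝟙 ∷ [] })
          refl (small ∷ count shorter (in-out b→y (arc-χ (ℕ.≤-reflexive (sym (other-of s′ no-out))))) ∷ []))
      where
      no-in : χ c y ≡ 0
      no-in = one-of r (χ-arc b→y)
      no-out : χ y c ≡ 0
      no-out = one-of s (χ-arc y→b)
      shorter : Gap c′ (P ++ (z ∷ Z) ++ b ∷ []) b c []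
      shorter = gap (w ⧺ q) (e ▹ [ e′ ]ʷ)
        (permute ([ y ] ∷ P ∷ [ z ] ∷ Z ∷ [ b ] ∷ [ c ] ∷ [ c′ ] ∷
              all ∷ [])
            (λ { (a ∷ b ∷ c ∷ d ∷ e ∷ f ∷ g ∷ h ∷ []) → a ⊕ (b ⊕ c ⊕ d ⊕ e) ⊕ f ⊕ g ≈ h , a ⊕ f ⊕ g ⊕ b ⊕ c ⊕ d ⊕ e ≈ h ∷
                  [] })
            refl (p ∷ []))
        (((λ i → 1≢0 (χ-arc i) no-out) , (λ i → 1≢0 (χ-arc i) no-in)) ∷ [])

    -- With k = |b ∷ P|, `count` gives δ y ≥ k + 1, and the bounds for in- and out-degree add up to
    -- δ y ≤ k + 1; so both ends are joined to `y` by both arcs and everything alternates. If P is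
    -- empty, the ends coincide in the only neighbour of `y`, a cut vertex.
    no-gap : ∀ {b P a z Z} → Gap b P a z Z → ¬ Kind a b
    no-gap {b} {[]} {z = z} {Z} (gap nil q p nonadj) kind =
      no-cliques {y} {[]} {b} {z} {Z} (permute ([ y ] ∷ [ b ] ∷ [ z ] ∷ Z ∷ all ∷ [])
          (λ { (a ∷ b ∷ c ∷ d ∷ e ∷ []) → a ⊕ b ⊕ c ⊕ d ≈ e , a ⊕ c ⊕ d ⊕ b ≈ e ∷ [] })
          refl (p ∷ [])) λ { (here refl) j → All.lookup nonadj j }
    no-gap {b} {P@(c ∷ P′)} {a} {z} {Z} g@(gap w@(e ▹ w₁) q p nonadj) kind =
      no-alternating-gap e w₁ q p b→y y→b a→y tight-in tight-out
      where
      I O : ℕ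
      I = ∑ (λ v → χ v y) (b ∷ P)
      O = ∑ (χ y) (b ∷ P)
      enough : length (b ∷ P) + 1 ≤ O + I
      enough = ℕ.≮⇒≥ λ h → (absurd (O ∷ I ∷ (length (b ∷ P)) ∷ n ∷ (δ y) ∷
            (length (z ∷ Z)) ∷ [])
          (λ { (a ∷ b ∷ c ∷ d ∷ e ∷ f ∷ []) → 𝟙 ⊕ a ⊕ b ≼ c ⊕ 𝟙 ∷ 𝟙 ⊕ d ≼ e ⊕ f ∷ e ≼ a ⊕ b ∷ c ⊕ f ≼ d ∷ [] })
          refl (h ∷ count g kind ∷ ≡⇒≤ (Gap.δ-y g) ∷ ≡⇒≤ (Gap.length-gap g) ∷ []))
      i-bound : I + I + 1 ≤ length (b ∷ P) + (χ b y + χ a y)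
      i-bound = in-bound w q p
      o-bound : O + O + 1 ≤ length (b ∷ P) + (χ y b + χ y a)
      o-bound = out-bound w q p
      b→y : E b y
      b→y = arc-χ (ℕ.≮⇒≥ λ h → (absurd ((χ b y) ∷ (χ a y) ∷ (χ y b) ∷ (χ y a) ∷
            (length (b ∷ P)) ∷ O ∷ I ∷ [])
          (λ { (a ∷ b ∷ c ∷ d ∷ e ∷ f ∷ g ∷ []) → 𝟙 ⊕ a ≼ 𝟙 ∷ b ≼ 𝟙 ∷ c ≼ 𝟙 ∷ d ≼ 𝟙 ∷ e ⊕ 𝟙 ≼ f ⊕ g ∷
                e ⊕ 𝟙 ≼ f ⊕ g ∷ (g ⊕ g) ⊕ 𝟙 ≼ e ⊕ a ⊕ b ∷ (f ⊕ f) ⊕ 𝟙 ≼ e ⊕ c ⊕ d ∷ [] })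
          refl (h ∷ χ≤1 a y ∷ χ≤1 y b ∷ χ≤1 y a ∷ enough ∷ enough ∷ i-bound ∷ o-bound ∷ [])))
      y→b : E y b
      y→b = arc-χ (ℕ.≮⇒≥ λ h → (absurd ((χ y b) ∷ (χ a y) ∷ (χ b y) ∷ (χ y a) ∷
            (length (b ∷ P)) ∷ O ∷ I ∷ [])
          (λ { (a ∷ b ∷ c ∷ d ∷ e ∷ f ∷ g ∷ []) → 𝟙 ⊕ a ≼ 𝟙 ∷ b ≼ 𝟙 ∷ c ≼ 𝟙 ∷ d ≼ 𝟙 ∷ e ⊕ 𝟙 ≼ f ⊕ g ∷
                e ⊕ 𝟙 ≼ f ⊕ g ∷ (g ⊕ g) ⊕ 𝟙 ≼ e ⊕ c ⊕ b ∷ (f ⊕ f) ⊕ 𝟙 ≼ e ⊕ a ⊕ d ∷ [] })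
          refl (h ∷ χ≤1 a y ∷ χ≤1 b y ∷ χ≤1 y a ∷ enough ∷ enough ∷ i-bound ∷ o-bound ∷ [])))
      a→y : E a y
      a→y = arc-χ (ℕ.≮⇒≥ λ h → (absurd ((χ a y) ∷ (χ b y) ∷ (χ y b) ∷ (χ y a) ∷
            (length (b ∷ P)) ∷ O ∷ I ∷ [])
          (λ { (a ∷ b ∷ c ∷ d ∷ e ∷ f ∷ g ∷ []) → 𝟙 ⊕ a ≼ 𝟙 ∷ b ≼ 𝟙 ∷ c ≼ 𝟙 ∷ d ≼ 𝟙 ∷ e ⊕ 𝟙 ≼ f ⊕ g ∷
                e ⊕ 𝟙 ≼ f ⊕ g ∷ (g ⊕ g) ⊕ 𝟙 ≼ e ⊕ b ⊕ a ∷ (f ⊕ f) ⊕ 𝟙 ≼ e ⊕ c ⊕ d ∷ [] })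
          refl (h ∷ χ≤1 b y ∷ χ≤1 y b ∷ χ≤1 y a ∷ enough ∷ enough ∷ i-bound ∷ o-bound ∷ [])))
      tight-in : Linked (λ u v → χ u y + χ v y ≡ 1) (b ∷ P)
      tight-in = in-tight w q p (ℕ.≮⇒≥ λ h → (absurd (I ∷ (length (b ∷ P)) ∷ (χ b y) ∷ (χ a y) ∷
            (χ y b) ∷ (χ y a) ∷ O ∷ [])
          (λ { (a ∷ b ∷ c ∷ d ∷ e ∷ f ∷ g ∷ []) → 𝟙 ⊕ (a ⊕ a) ⊕ 𝟙 ≼ b ⊕ c ⊕ d ∷ c ≼ 𝟙 ∷ d ≼ 𝟙 ∷ e ≼ 𝟙 ∷
                f ≼ 𝟙 ∷ b ⊕ 𝟙 ≼ g ⊕ a ∷ b ⊕ 𝟙 ≼ g ⊕ a ∷ (g ⊕ g) ⊕ 𝟙 ≼ b ⊕ e ⊕ f ∷ [] })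
          refl (h ∷ χ≤1 b y ∷ χ≤1 a y ∷ χ≤1 y b ∷ χ≤1 y a ∷ enough ∷ enough ∷ o-bound ∷ [])))
      tight-out : Linked (λ u v → χ y u + χ y v ≡ 1) (b ∷ P)
      tight-out = out-tight w q p (ℕ.≮⇒≥ λ h → (absurd (O ∷ (length (b ∷ P)) ∷ (χ y b) ∷ (χ y a) ∷
            (χ b y) ∷ (χ a y) ∷ I ∷ [])
          (λ { (a ∷ b ∷ c ∷ d ∷ e ∷ f ∷ g ∷ []) → 𝟙 ⊕ (a ⊕ a) ⊕ 𝟙 ≼ b ⊕ c ⊕ d ∷ e ≼ 𝟙 ∷ f ≼ 𝟙 ∷ c ≼ 𝟙 ∷
                d ≼ 𝟙 ∷ b ⊕ 𝟙 ≼ a ⊕ g ∷ b ⊕ 𝟙 ≼ a ⊕ g ∷ (g ⊕ g) ⊕ 𝟙 ≼ b ⊕ e ⊕ f ∷ [] })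
          refl (h ∷ χ≤1 b y ∷ χ≤1 a y ∷ χ≤1 y b ∷ χ≤1 y a ∷ enough ∷ enough ∷ i-bound ∷ [])))

    first-neighbour : ∀ {x L w} → Walk x L w →
      (∃ λ A → ∃ λ v → ∃ λ B → Walk x (A ++ v ∷ []) v × Walk v B w × L ≡ A ++ v ∷ B × All (NonAdj y) A × ¬ NonAdj y v)
      ⊎ All (NonAdj y) L
    first-neighbour nil = inj₂ []
    first-neighbour (_▹_ {y = v} e w) with nonadj? y v
    ... | no adj = inj₁ ([] , v , _ , [ e ]ʷ , w , refl , [] , adj)
    ... | yes h with first-neighbour w
    ...   | inj₁ (A , u , B , w₁ , w₂ , eq , hs , adj) = inj₁ (v ∷ A , u , B , e ▹ w₁ , w₂ , cong (v ∷_) eq , h ∷ hs , adj)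
    ...   | inj₂ hs = inj₂ (h ∷ hs)

    LastNeighbour : V → List V → V → Set
    LastNeighbour x L w = ∃ λ P → ∃ λ a → ∃ λ Z → Walk x P a × Walk a Z w × L ≡ P ++ Z × All (NonAdj y) Z × ¬ NonAdj y a

    last-neighbour? : ∀ {x L w} → Walk x L w → LastNeighbour x L w ⊎ All (NonAdj y) L
    last-neighbour? nil = inj₂ []
    last-neighbour? (_▹_ {y = v} e w) with last-neighbour? w
    ... | inj₁ (P , a , Z , w₁ , w₂ , eq , hs , adj) = inj₁ (v ∷ P , a , Z , e ▹ w₁ , w₂ , cong (v ∷_) eq , hs , adj)
    ... | inj₂ hs with nonadj? y v
    ...   | yes h = inj₂ (h ∷ hs)
    ...   | no adj = inj₁ (v ∷ [] , v , _ , [ e ]ʷ , w , refl , hs , adj)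

    last-neighbour : ∀ {b L w} → Walk b L w → ¬ NonAdj y b → LastNeighbour b L w
    last-neighbour {b} {L} w adj with last-neighbour? w
    ... | inj₁ l = l
    ... | inj₂ hs = [] , b , L , nil , w , refl , hs , adj

    gap-type : ∀ {b P a z Z} → Gap b P a z Z → ¬ NonAdj y a → ¬ NonAdj y b → (E y a × ¬ E a y) × (E b y × ¬ E y b)
    gap-type {b} {P} {a} g adj-a adj-b with E? a y
    ... | yes a→y = ⊥-elim (adj-b ((λ e → no-gap g (in-out a→y e)) , (λ e → no-gap g (in-in a→y e))))
    ... | no a↛y with E? y a
    ...   | no y↛a = ⊥-elim (adj-a (y↛a , a↛y))
    ...   | yes y→a with E? b y
    ...     | no b↛y = ⊥-elim (adj-b ((λ e → no-gap g (out-out y→a e)) , b↛y))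
    ...     | yes b→y = (y→a , a↛y) , b→y , (λ e → no-gap g (out-out y→a e))

    after-nonadj : ∀ {v M u} → Walk v M u → E u v → y ∷ v ∷ M ↭ all → NonAdj y u → ¬ NonAdj y v → E v y × ¬ E y v
    after-nonadj {v} {M} w e p h adj with last-neighbour w adj
    ... | P , a , [] , w₁ , nil , eq , _ , adj′ = ⊥-elim (adj′ h)
    ... | P , a , z ∷ Z , w₁ , w₂ , refl , hs , adj′ = proj₂ (gap-type
            (gap w₁ (w₂ ⧺ [ e ]ʷ) (permute ([ y ] ∷ P ∷ [ z ] ∷ Z ∷ [ v ] ∷ all ∷ [])
                (λ { (a ∷ b ∷ c ∷ d ∷ e ∷ f ∷ []) → a ⊕ b ⊕ c ⊕ d ⊕ e ≈ f , a ⊕ e ⊕ b ⊕ c ⊕ d ≈ f ∷ [] })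
                refl (p ∷ [])) hs) adj′ adj)

    before-nonadj : ∀ {v M u} → Walk v M u → E u v → y ∷ v ∷ M ↭ all → NonAdj y v → ¬ NonAdj y u → E y u × ¬ E u y
    before-nonadj {v} {[]} nil e p h adj = ⊥-elim (adj h)
    before-nonadj {v} {M@(_ ∷ _)} w e p h adj with first-neighbour w
    ... | inj₂ hs = ⊥-elim (adj (All.lookup hs (end∈ w)))
    ... | inj₁ (A , b , B , w₁ , w₂ , eq , hs , adj′) = proj₁ (gap-type
            (gap w₂ (e ▹ w₁) (permute ([ y ] ∷ B ∷ [ v ] ∷ A ∷ [ b ] ∷ all ∷ M ∷ [])
                (λ { (a ∷ b ∷ c ∷ d ∷ e ∷ f ∷ g ∷ []) → a ⊕ b ⊕ c ⊕ d ⊕ e ≈ f , a ⊕ c ⊕ g ≈ f ∷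
                      d ⊕ e ⊕ b ≈ g ∷ [] })
                refl (p ∷ ↭-sym (↭-reflexive eq) ∷ [])) (h ∷ hs)) adj adj′)

    nonadj-somewhere : ∀ L → All (λ v → ¬ NonAdj y v) L ⊎ (∃ λ z → z ∈ L × NonAdj y z)
    nonadj-somewhere [] = inj₁ []
    nonadj-somewhere (v ∷ L) with nonadj? y v
    ... | yes h = inj₂ (v , here refl , h)
    ... | no adj with nonadj-somewhere L
    ...   | inj₁ adjs = inj₁ (adj ∷ adjs)
    ...   | inj₂ (z , i , h) = inj₂ (z , there i , h)

    all-adjacent : ∀ {L} → All (λ v → ¬ NonAdj y v) L → length L ≤ dg y L
    all-adjacent [] = z≤n
    all-adjacent {v ∷ L} (adj ∷ adjs) = ℕ.≮⇒≥ λ h →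
      (absurd ((χ y v) ∷ (∑ (χ y) L) ∷ (χ v y) ∷
            (∑ (λ u → χ u y) L) ∷ (length L) ∷ [])
          (λ { (a ∷ b ∷ c ∷ d ∷ e ∷ []) → 𝟙 ⊕ (a ⊕ b) ⊕ c ⊕ d ≼ 𝟙 ⊕ e ∷ e ≼ b ⊕ d ∷ 𝟙 ≼ a ⊕ c ∷ [] })
          refl (h ∷ all-adjacent adjs ∷ once ∷ []))
      where
      once : 1 ≤ χ y v + χ v y
      once with arcs y v | arcs v y
      ... | true | _ = s≤s z≤n
      ... | false | true = s≤s z≤n
      ... | false | false = ⊥-elim (adj ((λ ()) , (λ ())))

    SomeGap : Set
    SomeGap = ∃ λ b → ∃ λ P → ∃ λ a → ∃ λ z → ∃ λ Z → Gap b P a z Z × ¬ NonAdj y a × ¬ NonAdj y b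

    gap-around : ∀ {z L} → Walk z L z → y ∷ L ↭ all → NonAdj y z → SomeGap
    gap-around {z} {L} w p h with first-neighbour w
    ... | inj₂ hs = ⊥-elim (isolated (L-nonempty w p))
      where
      L-nonempty : ∀ {L} → Walk z L z → y ∷ L ↭ all → ∃ λ L′ → z ∷ y ∷ L′ ↭ all
      L-nonempty nil p with Perm.∈-resp-↭ (↭-sym p) (covers z)
      ... | here refl = ⊥-elim ((absurd ((δ y) ∷ n ∷ [])
          (λ { (a ∷ b ∷ []) → 𝟙 ⊕ a ≼ b ∷ b ≼ ∅ ∷ [] })
          refl (small ∷ ≡⇒≤ (sym (size-rest p)) ∷ [])))
      L-nonempty w@(_▹_ {y = v} {L = L} _ _) p with Mem.∈-∃++ (end∈ w)
      ... | A , B , eq = A ++ B , (permute ([ z ] ∷ [ y ] ∷ A ∷ B ∷ all ∷ [ v ] ∷ L ∷ [])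
          (λ { (a ∷ b ∷ c ∷ d ∷ e ∷ f ∷ g ∷ []) → a ⊕ b ⊕ c ⊕ d ≈ e , b ⊕ f ⊕ g ≈ e ∷ c ⊕ a ⊕ d ≈ f ⊕ g ∷ [] })
          refl (p ∷ ↭-sym (↭-reflexive eq) ∷ []))
      isolated : (∃ λ L′ → z ∷ y ∷ L′ ↭ all) → ⊥
      isolated (L′ , q) = (absurd (n ∷ (δ y) ∷ (δ z) ∷ (dg z (y ∷ [])) ∷ (dg z L′) ∷
            (length L′) ∷ [])
          (λ { (a ∷ b ∷ c ∷ d ∷ e ∷ f ∷ []) → a ⊕ a ≼ b ⊕ c ∷ b ≼ ∅ ∷ c ≼ d ⊕ e ∷ d ≼ ∅ ∷ e ≼ f ⊕ f ∷
                𝟙 ⊕ f ≼ a ∷ 𝟙 ⊕ f ≼ a ∷ [] })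
          refl (ore (λ e → distinct q (sym e)) h ∷ ≡⇒≤ (trans (deg-rest p) (dg-nonadj y hs)) ∷
            ≡⇒≤ (trans (deg-rest q) (dg-++ z (y ∷ []) L′)) ∷ ≡⇒≤ (dg-nonadj z ((proj₂ h , proj₁ h) ∷ [])) ∷
            dg-length z L′ ∷ ≡⇒≤ (size-rest q) ∷ ≡⇒≤ (size-rest q) ∷ []))
    ... | inj₁ (A , b , B , w₁ , w₂ , refl , hs , adj) with last-neighbour w₂ adj
    ...   | P , a , [] , w₃ , nil , eq , _ , adj′ = ⊥-elim (adj′ h)
    ...   | P , a , z′ ∷ Z , w₃ , w₄ , refl , hs′ , adj′ = b , P , a , z′ , Z ++ A ,
            gap w₃ (subst (λ K → Walk a (z′ ∷ K) b) (sym (List.++-assoc Z A (b ∷ []))) (w₄ ⧺ w₁))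
              (permute ([ y ] ∷ P ∷ [ z′ ] ∷ Z ∷ A ∷ [ b ] ∷ all ∷ [])
                  (λ { (a ∷ b ∷ c ∷ d ∷ e ∷ f ∷ g ∷ []) → a ⊕ b ⊕ c ⊕ (d ⊕ e) ⊕ f ≈ g , a ⊕ e ⊕ f ⊕ b ⊕ c ⊕ d ≈ g ∷
                        [] })
                  refl (p ∷ [])) (All.++⁺ hs′ hs) , adj′ , adj

    some-gap : Low y → SomeGap
    some-gap l with low-closed l
    ... | c , L , w , p with nonadj-somewhere L
    ...   | inj₁ adjs = ⊥-elim ((absurd ((δ y) ∷ n ∷ (dg y L) ∷ (length L) ∷ [])
        (λ { (a ∷ b ∷ c ∷ d ∷ []) → 𝟙 ⊕ a ≼ b ∷ c ≼ a ∷ d ≼ c ∷ b ≼ d ∷ [] })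
        refl (small ∷ ≡⇒≥ (deg-rest p) ∷ all-adjacent adjs ∷ ≡⇒≥ (size-rest p) ∷ [])))
    ...   | inj₂ (z , i , h) with rotate-closed w i
    ...     | L′ , w′ , q = gap-around w′ (permute ([ y ] ∷ L′ ∷ all ∷ L ∷ [])
        (λ { (a ∷ b ∷ c ∷ d ∷ []) → a ⊕ b ≈ c , a ⊕ d ≈ c ∷ b ≈ d ∷ [] })
        refl (p ∷ q ∷ [])) h

    last-across : ∀ {a b z Z} → Walk a ((z ∷ Z) ++ b ∷ []) b → ∃ λ u → Walk a (z ∷ Z) u × E u b
    last-across {a} {b} {z} {Z} q with walk-∷ʳ q
    ... | u , L , w , e , eq with List.∷ʳ-injectiveˡ (z ∷ Z) L eq
    ...   | refl = u , w , e

    -- The gap is inserted into y → β⁺ ... α. If all of it fits, β → α closes a bypass, and α → β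
    -- closes a cycle missing only the last gap vertex, whose degree exceeds n. A vertex that gets
    -- stuck has d(v) ≤ n - 2 + |rest| + d(v, β), too small in either case.
    nonadjacent-ends : ∀ {α β β⁺ P z Z u} → Walk β⁺ P α → Walk α (z ∷ Z) u →
      y ∷ β ∷ β⁺ ∷ P ++ z ∷ Z ↭ all → E β y → E y β⁺ → All (NonAdj y) (z ∷ Z) →
      All (λ v → n + length (z ∷ Z) ≤ δ v) (z ∷ Z) → ¬ E β u → NonAdj α β
    nonadjacent-ends {α} {β} {β⁺} {P} {z} {Z} {u} w q p β→y y→β⁺ nonadj big β↛u with saturate (y→β⁺ ▹ w) z Z
    ... | saturated {visited} {rest} {inserted} w′ s r (inj₁ (v , L , refl , w″ , t)) =
          (λ e → (absurd (n ∷ (length Z) ∷ (δ v) ∷ [])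
              (λ { (a ∷ b ∷ c ∷ []) → a ⊕ 𝟙 ⊕ b ≼ c ∷ c ≼ a ∷ [] })
              refl (All.lookup big v∈ ∷ low-deg (β , y ∷ visited , α , β→y ▹ w′ , e ,
                   (permute ([ v ] ∷ [ β ] ∷ [ y ] ∷ visited ∷ all ∷ [ β⁺ ] ∷
                P ∷ inserted ∷ [ z ] ∷ Z ∷ [])
              (λ { (a ∷ b ∷ c ∷ d ∷ e ∷ f ∷ g ∷ h ∷ i ∷ j ∷ []) → a ⊕ b ⊕ c ⊕ d ≈ e , d ≈ (f ⊕ g) ⊕ h ∷
                    a ⊕ h ≈ i ⊕ j ∷ c ⊕ b ⊕ f ⊕ g ⊕ i ⊕ j ≈ e ∷ [] })
              refl (s ∷ ↭-sym r ∷ p ∷ []))) ∷ []))) ,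
          no-bypass (β→y ▹ w″) (permute ([ β ] ∷ [ y ] ∷ L ∷ all ∷ [ v ] ∷ visited ∷
                [ β⁺ ] ∷ P ∷ inserted ∷ [ z ] ∷ Z ∷ [])
              (λ { (a ∷ b ∷ c ∷ d ∷ e ∷ f ∷ g ∷ h ∷ i ∷ j ∷ k ∷ []) → a ⊕ b ⊕ c ≈ d , c ≈ e ⊕ f ∷
                    f ≈ (g ⊕ h) ⊕ i ∷ e ⊕ i ≈ j ⊕ k ∷ b ⊕ a ⊕ g ⊕ h ⊕ j ⊕ k ≈ d ∷ [] })
              refl (t ∷ s ∷ ↭-sym r ∷ p ∷ []))
      where
      v∈ : v ∈ (z ∷ Z)
      v∈ = Perm.∈-resp-↭ (↭-sym r) (here refl)
    ... | saturated {visited} {rest} {inserted} w′ s r (inj₂ (v₀ , R , eq , stuck)) = ⊥-elim (by-cases inserted refl)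
      where
      spans : β ∷ (y ∷ visited) ++ rest ↭ all
      spans = (permute ([ β ] ∷ [ y ] ∷ visited ∷ rest ∷ all ∷ [ β⁺ ] ∷ P ∷
            [ z ] ∷ Z ∷ inserted ∷ [])
          (λ { (a ∷ b ∷ c ∷ d ∷ e ∷ f ∷ g ∷ h ∷ i ∷ j ∷ []) → a ⊕ b ⊕ c ⊕ d ≈ e , b ⊕ a ⊕ f ⊕ g ⊕ h ⊕ i ≈ e ∷
                c ≈ (f ⊕ g) ⊕ j ∷ d ⊕ j ≈ h ⊕ i ∷ [] })
          refl (p ∷ s ∷ ↭-sym r ∷ []))
      lengths : length (z ∷ Z) ≡ length rest + length inserted
      lengths = trans (Perm.↭-length r) (List.length-++ rest)
      bound : ∀ {v} → v ∈ rest → length (z ∷ Z) + 2 ≤ length rest + dg v (β ∷ [])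
      bound {v} i = ℕ.≮⇒≥ λ h →
        (absurd ((length rest) ∷ (dg v (β ∷ [])) ∷
              (length (z ∷ Z)) ∷ n ∷ (δ v) ∷ (dg v ((y ∷ visited) ++ rest)) ∷ (dg v (y ∷ visited)) ∷
              (dg v rest) ∷ (length (y ∷ visited)) ∷ (χ v y) ∷ (χ α v) ∷ [])
            (λ { (a ∷ b ∷ c ∷ d ∷ e ∷ f ∷ g ∷ h ∷ i ∷ j ∷ k ∷ []) → 𝟙 ⊕ a ⊕ b ≼ c ⊕ 𝟙 ⊕ 𝟙 ∷ d ⊕ c ≼ e ∷
                  e ≼ b ⊕ f ∷ f ≼ g ⊕ h ∷ (g ⊕ h) ⊕ 𝟙 ⊕ 𝟙 ⊕ 𝟙 ≼ (i ⊕ j ⊕ k) ⊕ a ⊕ a ∷ j ≼ ∅ ∷ k ≼ 𝟙 ∷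
                  i ⊕ a ≼ d ∷ [] })
            refl (h ∷ All.lookup big v∈ ∷
              ≡⇒≤ (trans (dg-↭ v (↭-sym spans)) (dg-++ v (β ∷ []) ((y ∷ visited) ++ rest))) ∷
              ≡⇒≤ (dg-++ v (y ∷ visited) rest) ∷ dg-rest w′ (All.lookup stuck i) i ∷
              ≡⇒≤ (χ-no-arc (proj₂ (All.lookup nonadj v∈))) ∷ χ≤1 α v ∷
              ≡⇒≤ (trans (sym (List.length-++ (y ∷ visited))) (size-rest spans)) ∷ []))
        where
        v∈ : v ∈ (z ∷ Z)
        v∈ = Perm.∈-resp-↭ (↭-sym r) (Mem.∈-++⁺ˡ i)
      by-cases : ∀ I → I ≡ inserted → ⊥
      by-cases [] refl = (absurd ((length (z ∷ Z)) ∷ (length rest) ∷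
            (dg u (β ∷ [])) ∷ [])
          (λ { (a ∷ b ∷ c ∷ []) → a ⊕ 𝟙 ⊕ 𝟙 ≼ b ⊕ c ∷ c ≼ 𝟙 ∷ b ⊕ ∅ ≼ a ∷ [] })
          refl (bound (Perm.∈-resp-↭ (permute ([ z ] ∷ Z ∷ rest ∷ [])
          (λ { (a ∷ b ∷ c ∷ []) → a ⊕ b ≈ c , a ⊕ b ≈ c ⊕ ∅ ∷ [] })
          refl (r ∷ [])) (end∈ q)) ∷ dg≤1ʳ β↛u ∷ ≡⇒≥ lengths ∷ []))
      by-cases (i ∷ I) refl = (absurd ((length (z ∷ Z)) ∷ (length rest) ∷
            (dg v₀ (β ∷ [])) ∷ (length I) ∷ [])
          (λ { (a ∷ b ∷ c ∷ d ∷ []) → a ⊕ 𝟙 ⊕ 𝟙 ≼ b ⊕ c ∷ c ≼ 𝟙 ⊕ 𝟙 ∷ b ⊕ 𝟙 ⊕ d ≼ a ∷ [] })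
          refl (bound (subst (v₀ ∈_) (sym eq) (here refl)) ∷ dg≤2 v₀ β ∷ ≡⇒≥ lengths ∷ []))

    neighbour-out : ∀ {v} → ¬ NonAdj y v → ¬ E v y → E y v
    neighbour-out {v} adj v↛y with E? y v
    ... | yes e = e
    ... | no y↛v = ⊥-elim (adj (y↛v , v↛y))

    neighbour-in : ∀ {v} → ¬ NonAdj y v → ¬ E y v → E v y
    neighbour-in {v} adj y↛v with E? v y
    ... | yes e = e
    ... | no v↛y = ⊥-elim (adj (y↛v , v↛y))

    module _ {α β β⁺ P z Z} (e : E β β⁺) (w : Walk β⁺ P α) (q : Walk α ((z ∷ Z) ++ β ∷ []) β)
             (p : y ∷ (β⁺ ∷ P) ++ (z ∷ Z) ++ β ∷ [] ↭ all) (nonadj : All (NonAdj y) (z ∷ Z))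
             (y→α : E y α) (α↛y : ¬ E α y) (β→y : E β y) (y↛β : ¬ E y β) where

      spans : y ∷ β ∷ β⁺ ∷ P ++ z ∷ Z ↭ all
      spans = (permute ([ y ] ∷ [ β ] ∷ [ β⁺ ] ∷ P ∷ [ z ] ∷ Z ∷ all ∷ [])
          (λ { (a ∷ b ∷ c ∷ d ∷ e ∷ f ∷ g ∷ []) → a ⊕ b ⊕ c ⊕ d ⊕ e ⊕ f ≈ g , a ⊕ (c ⊕ d) ⊕ e ⊕ f ⊕ b ≈ g ∷
                [] })
          refl (p ∷ []))

      successor : E y β⁺
      successor with nonadj? y β⁺
      -- A neighbour of y directly before a non-neighbour is dominated by y, and β is not.
      ... | yes h = ⊥-elim (y↛β (proj₁ (before-nonadj (w ⧺ q) e p h λ (_ , h′) → h′ β→y)))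
      ... | no adj = neighbour-out adj λ e′ → no-consecutive-in (w ⧺ q) p (β→y , e′)

      predecessor : ∀ {α⁻ P′} → Walk β P′ α⁻ → E α⁻ α → β⁺ ∷ P ≡ P′ ++ α ∷ [] → E α⁻ y
      predecessor {α⁻} {P′} w′ e′ eq = by-cases (nonadj? y α⁻)
        where
        p′ : y ∷ α ∷ ((z ∷ Z) ++ β ∷ []) ++ P′ ↭ all
        p′ = (permute ([ y ] ∷ [ α ] ∷ [ z ] ∷ Z ∷ [ β ] ∷ P′ ∷ all ∷
              [ β⁺ ] ∷ P ∷ [])
            (λ { (a ∷ b ∷ c ∷ d ∷ e ∷ f ∷ g ∷ h ∷ i ∷ []) → a ⊕ b ⊕ (c ⊕ d ⊕ e) ⊕ f ≈ g , a ⊕ (h ⊕ i) ⊕ c ⊕ d ⊕ e ≈ g ∷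
                  f ⊕ b ≈ h ⊕ i ∷ [] })
            refl (p ∷ ↭-sym (↭-reflexive eq) ∷ []))
        by-cases : Dec (NonAdj y α⁻) → E α⁻ y
        by-cases (yes h) = ⊥-elim (α↛y (proj₁ (after-nonadj (q ⧺ w′) e′ p′ h λ (h′ , _) → h′ y→α)))
        by-cases (no adj) = neighbour-in adj λ e″ → no-consecutive-out (q ⧺ w′) p′ (e″ , y→α)

      -- Of the four possible arcs between y and the gap ends only β → y and y → α are present, so
      -- in- and out-degree of y are each at most half of n - |z ∷ Z|. The degree condition
      -- transfers the deficit to the gap vertices.
      big : All (λ v → n + length (z ∷ Z) ≤ δ v) (z ∷ Z)
      big = All.tabulate λ {v} i → ℕ.≮⇒≥ λ h →
        (absurd ((δ v) ∷ n ∷ (length (z ∷ Z)) ∷ (δ y) ∷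
              (∑ (χ y) (β ∷ β⁺ ∷ P)) ∷ (∑ (λ v → χ v y) (β ∷ β⁺ ∷ P)) ∷ (length (β ∷ β⁺ ∷ P)) ∷ (χ y β) ∷
              (χ y α) ∷ (χ β y) ∷ (χ α y) ∷ [])
            (λ { (a ∷ b ∷ c ∷ d ∷ e ∷ f ∷ g ∷ h ∷ i ∷ j ∷ k ∷ []) → 𝟙 ⊕ a ≼ b ⊕ c ∷ 𝟙 ⊕ a ≼ b ⊕ c ∷
                  b ⊕ b ≼ d ⊕ a ∷ b ⊕ b ≼ d ⊕ a ∷ d ≼ e ⊕ f ∷ d ≼ e ⊕ f ∷ (e ⊕ e) ⊕ 𝟙 ≼ g ⊕ h ⊕ i ∷
                  (f ⊕ f) ⊕ 𝟙 ≼ g ⊕ j ⊕ k ∷ h ≼ ∅ ∷ i ≼ 𝟙 ∷ k ≼ ∅ ∷ j ≼ 𝟙 ∷ g ⊕ c ≼ b ∷ g ⊕ c ≼ b ∷ [] })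
            refl (h ∷ h ∷ ore (Gap.apart′ g i) (All.lookup nonadj i) ∷
              ore (Gap.apart′ g i) (All.lookup nonadj i) ∷ ≡⇒≤ (Gap.δ-y g) ∷ ≡⇒≤ (Gap.δ-y g) ∷
              out-bound (e ▹ w) q p ∷ in-bound (e ▹ w) q p ∷ ≡⇒≤ (χ-no-arc y↛β) ∷ χ≤1 y α ∷ ≡⇒≤ (χ-no-arc α↛y) ∷
              χ≤1 β y ∷ ≡⇒≤ (Gap.length-gap g) ∷ ≡⇒≤ (Gap.length-gap g) ∷ []))
        where
        g : Gap β (β⁺ ∷ P) α z Z
        g = gap (e ▹ w) q p nonadj

    module _ {α β β⁺ P z Z} (e : E β β⁺) (w : Walk β⁺ P α) (q : Walk α ((z ∷ Z) ++ β ∷ []) β)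
             (p : y ∷ (β⁺ ∷ P) ++ (z ∷ Z) ++ β ∷ [] ↭ all) (nonadj : All (NonAdj y) (z ∷ Z))
             (y→α : E y α) (α↛y : ¬ E α y) (β→y : E β y) (y↛β : ¬ E y β) where

      private
        y→β⁺ : E y β⁺
        y→β⁺ = successor e w q p nonadj y→α α↛y β→y y↛β
        large : All (λ v → n + length (z ∷ Z) ≤ δ v) (z ∷ Z)
        large = big e w q p nonadj y→α α↛y β→y y↛β
        spans₁ : y ∷ β ∷ β⁺ ∷ P ++ z ∷ Z ↭ all
        spans₁ = spans e w q p nonadj y→α α↛y β→y y↛β

      z↛α : ¬ E z α
      z↛α = from q
        where
        from : Walk α ((z ∷ Z) ++ β ∷ []) β → ¬ E z α
        from (_ ▹ q′) = no-bypass (q′ ⧺ (β→y ▹ y→β⁺ ▹ w))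
          (permute ([ z ] ∷ Z ∷ [ β ] ∷ [ y ] ∷ [ β⁺ ] ∷ P ∷ all ∷ [])
              (λ { (a ∷ b ∷ c ∷ d ∷ e ∷ f ∷ g ∷ []) → a ⊕ (b ⊕ c) ⊕ d ⊕ e ⊕ f ≈ g , d ⊕ c ⊕ e ⊕ f ⊕ a ⊕ b ≈ g ∷
                    [] })
              refl (spans₁ ∷ []))

      β↛end : ∀ {u} → Walk α (z ∷ Z) u → ¬ E β u
      β↛end w′ = no-bypass (β→y ▹ y→β⁺ ▹ (w ⧺ w′)) (permute ([ β ] ∷ [ y ] ∷ [ β⁺ ] ∷ P ∷ [ z ] ∷ Z ∷ all ∷ [])
          (λ { (a ∷ b ∷ c ∷ d ∷ e ∷ f ∷ g ∷ []) → a ⊕ b ⊕ c ⊕ d ⊕ e ⊕ f ≈ g , b ⊕ a ⊕ c ⊕ d ⊕ e ⊕ f ≈ g ∷ [] })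
          refl (spans₁ ∷ []))

      ends-nonadj : NonAdj α β
      ends-nonadj with last-across q
      ... | u , w′ , _ = nonadjacent-ends w w′ spans₁ β→y y→β⁺ nonadj large (β↛end w′)

      α-end : δ α ≤ n × (n ≤ δ α → Low β)
      α-end with walk-∷ʳ (e ▹ w)
      ... | α⁻ , P′ , w′ , e′ , eq = OneSided.gap-end C w′ (permute ([ y ] ∷ [ α ] ∷ [ β ] ∷ P′ ∷ [ z ] ∷ Z ∷ all ∷
            [ β⁺ ] ∷ P ∷ [])
          (λ { (a ∷ b ∷ c ∷ d ∷ e ∷ f ∷ g ∷ h ∷ i ∷ []) → a ⊕ b ⊕ (c ⊕ d) ⊕ e ⊕ f ≈ g , a ⊕ c ⊕ h ⊕ i ⊕ e ⊕ f ≈ g ∷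
                d ⊕ b ≈ h ⊕ i ∷ [] })
          refl (spans₁ ∷ ↭-sym (↭-reflexive eq) ∷ []))
              β→y (predecessor e w q p nonadj y→α α↛y β→y y↛β w′ e′ eq) α↛y ends-nonadj nonadj large z↛α

      -- `gap-end` in the opposite digraph: α and β exchange roles, and the last gap vertex replaces
      -- the first.
      β-end : δ β ≤ n
      β-end = let (u , w′ , _) = last-across q ; (A , B , eq) = Mem.∈-∃++ (end∈ w′) in
              from (β↛end w′) (permute ([ z ] ∷ Z ∷ [ u ] ∷ A ∷ B ∷ [])
                  (λ { (a ∷ b ∷ c ∷ d ∷ e ∷ []) → a ⊕ b ≈ c ⊕ d ⊕ e , a ⊕ b ≈ d ⊕ c ⊕ e ∷ [] })
                  refl (↭-reflexive eq ∷ []))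
        where
        δ-flip : ∀ v → Counterexample.δ (op C) v ≡ δ v
        δ-flip v = ℕ.+-comm (∑ (λ v′ → χ v′ v) all) _
        from : ∀ {u Z′} → ¬ E β u → z ∷ Z ↭ u ∷ Z′ → δ β ≤ n
        from {u} {Z′} β↛u r = let (P′ , v , s) = reverse-walk-↭ arcs w in
          subst (_≤ n) (δ-flip β) (proj₁ (OneSided.gap-end (op C) v
            (permute ([ y ] ∷ [ β ] ∷ [ α ] ∷ P′ ∷ [ u ] ∷ Z′ ∷ all ∷
                  [ β⁺ ] ∷ P ∷ [ z ] ∷ Z ∷ [])
                (λ { (a ∷ b ∷ c ∷ d ∷ e ∷ f ∷ g ∷ h ∷ i ∷ j ∷ k ∷ []) → a ⊕ b ⊕ (c ⊕ d) ⊕ e ⊕ f ≈ g , a ⊕ b ⊕ h ⊕ i ⊕ j ⊕ k ≈ g ∷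
                      c ⊕ d ≈ h ⊕ i ∷ e ⊕ f ≈ j ⊕ k ∷ [] })
                refl (spans₁ ∷ s ∷ ↭-sym r ∷ []))
            y→α y→β⁺ y↛β ends-nonadj
            (All.map (λ { (h , h′) → h′ , h }) (Perm.All-resp-↭ r nonadj))
            (All.map (λ {v} h → subst₂ _≤_ (cong (n +_) (Perm.↭-length r)) (sym (δ-flip v)) h) (Perm.All-resp-↭ r large))
            β↛u))

      -- Non-adjacent ends of degree at most n have degree exactly n. Then a cycle misses only β, so
      -- β would have to be adjacent to α by `full-degree`.
      contradiction : ⊥
      contradiction = full-degree (proj₂ α-end α-full) β-full α≢β (let (h , h′) = ends-nonadj in h′ , h)
        where
        α≢β : α ≢ β
        α≢β refl = α↛y β→y
        α-full : n ≤ δ α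
        α-full = ℕ.≮⇒≥ λ h → (absurd ((δ α) ∷ n ∷ (δ β) ∷ [])
            (λ { (a ∷ b ∷ c ∷ []) → 𝟙 ⊕ a ≼ b ∷ c ≼ b ∷ b ⊕ b ≼ a ⊕ c ∷ [] })
            refl (h ∷ β-end ∷ ore α≢β ends-nonadj ∷ []))
        β-full : n ≤ δ β
        β-full = ℕ.≮⇒≥ λ h → (absurd ((δ β) ∷ n ∷ (δ α) ∷ [])
            (λ { (a ∷ b ∷ c ∷ []) → 𝟙 ⊕ a ≼ b ∷ c ≼ b ∷ b ⊕ b ≼ c ⊕ a ∷ [] })
            refl (h ∷ proj₁ α-end ∷ ore α≢β ends-nonadj ∷ []))

    low-full : ¬ Low y
    low-full l with some-gap l
    ... | b , P , a , z , Z , g , adj-a , adj-b = from (Gap.walk g) (Gap.across g) (Gap.spans g) (Gap.nonadj g) (gap-type g adj-a adj-b)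
      where
      from : ∀ {P} → Walk b P a → Walk a ((z ∷ Z) ++ b ∷ []) b → y ∷ P ++ (z ∷ Z) ++ b ∷ [] ↭ all → All (NonAdj y) (z ∷ Z) →
             (E y a × ¬ E a y) × (E b y × ¬ E y b) → ⊥
      from nil q p h ((y→a , _) , (_ , y↛b)) = y↛b y→a
      from (e ▹ w) q p h ((y→a , a↛y) , (b→y , y↛b)) = contradiction e w q p h y→a a↛y b→y y↛b

  low⇒full : ∀ {y} → Low y → n ≤ δ y
  low⇒full l = ℕ.≮⇒≥ λ h → low-full h l

  -- A vertex y of full degree whose deletion leaves a hamiltonian digraph dominates one colour class
  -- of an alternating 2-colouring of the cycle, and is dominated by the other.
  Dominates : V → V → Set
  Dominates u v = E u v × ¬ E v u

  NoT₅ : Set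
  NoT₅ = ∀ {z₁ z₂ z₃ z₄ w} → z₁ ∷ z₂ ∷ z₃ ∷ z₄ ∷ w ∷ [] ↭ all →
         Dominates z₁ z₂ → Dominates z₂ z₃ → Dominates z₃ z₄ → Dominates z₄ z₁ →
         Dominates z₁ w → Dominates z₃ w → Dominates w z₂ → Dominates w z₄ →
         Dominates z₁ z₃ → Dominates z₂ z₄ → ⊥

  NoC₃ : Set
  NoC₃ = ∀ {x y z} → x ∷ y ∷ z ∷ [] ↭ all → Dominates x y → Dominates y z → Dominates z x → ⊥

  module _ {y} (low-y : Low y) where

    -- Every other vertex is adjacent to `y`, so for it `false` means being dominated by `y`;
    -- `single-in` shows that on the cycle the two colours exclude each other.
    τ : V → Bool
    τ v = arcs v y

    out-arc : ∀ {v} → y ≢ v → τ v ≡ false → E y v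
    out-arc {v} y≢v e with E? y v
    ... | yes e′ = e′
    ... | no y↛v = ⊥-elim (full-degree low-y (low⇒full low-y) (λ eq → y≢v (sym eq)) (y↛v , λ e′ → false≢true (trans (sym e) e′)))
      where
      false≢true : ¬ (false ≡ true)
      false≢true ()

    ends-differ : ∀ {v L u} → Walk v L u → y ∷ v ∷ L ↭ all → τ v ≢ τ u
    ends-differ {v} {L} {u} w p eq with τ v in e
    ... | true = no-consecutive-in w p (sym eq , e)
    ... | false = no-consecutive-out w p (out-arc (apart p (last∈ w)) (sym eq) , out-arc (apart p (here refl)) e)

    alternating : ∀ {c L} → Walk c L c → y ∷ L ↭ all → Linked (λ u v → τ u ≢ τ v) (c ∷ L)
    alternating {c} {L} w p = linked-pairs w λ {u} {v} {A} {B} w₁ e w₂ eq eq′ →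
      ends-differ (w₂ ⧺ w₁) (permute ([ y ] ∷ [ v ] ∷ B ∷ A ∷ all ∷ L ∷ [])
          (λ { (a ∷ b ∷ c ∷ d ∷ e ∷ f ∷ []) → a ⊕ b ⊕ c ⊕ d ≈ e , a ⊕ f ≈ e ∷ d ⊕ b ⊕ c ≈ f ∷ [] })
          refl (p ∷ ↭-sym (↭-reflexive eq) ∷ [])) (sym eq′)

    ≢-≢ : ∀ {i j k : Bool} → i ≢ j → j ≢ k → i ≡ k
    ≢-≢ {false} {false} h _ = ⊥-elim (h refl)
    ≢-≢ {false} {true} {false} _ _ = refl
    ≢-≢ {false} {true} {true} _ h = ⊥-elim (h refl)
    ≢-≢ {true} {true} h _ = ⊥-elim (h refl)
    ≢-≢ {true} {false} {true} _ _ = refl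
    ≢-≢ {true} {false} {false} _ h = ⊥-elim (h refl)

    -- Among three alternately coloured consecutive vertices, one dominating `y` is followed by one
    -- dominated by `y`.
    insert-y : ∀ {x a b M u} → Walk x (a ∷ b ∷ M) u → τ x ≢ τ a → τ a ≢ τ b → y ≢ a → y ≢ b →
               ∃ λ L → Walk x L u × L ↭ y ∷ a ∷ b ∷ M
    insert-y {x} {a} {b} {M} (e ▹ e′ ▹ w) h h′ y≢a y≢b with τ x in ex | τ a in ea | τ b in eb
    ... | true | true | _ = ⊥-elim (h refl)
    ... | true | false | _ = _ , (ex ▹ out-arc y≢a ea ▹ e′ ▹ w) , ↭-refl
    ... | false | false | _ = ⊥-elim (h refl)
    ... | false | true | true = ⊥-elim (h′ refl)
    ... | false | true | false = a ∷ y ∷ b ∷ M , (e ▹ ea ▹ out-arc y≢b eb ▹ w) , (permute ([ a ] ∷ [ y ] ∷ [ b ] ∷ M ∷ [])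
        (λ { (a ∷ b ∷ c ∷ d ∷ []) → a ⊕ b ⊕ c ⊕ d ≈ b ⊕ a ⊕ c ⊕ d , [] })
        refl ([]))

    -- The successor of `v` has the other colour and is dominated by `y`; with y → v there would be
    -- two consecutive out-neighbours.
    single-in : ∀ {v a M u} → Walk v (a ∷ M) u → E u v → y ∷ v ∷ a ∷ M ↭ all → E v y → ¬ E y v
    single-in {v} {a} {M} {u} (e ▹ w) e′ p v→y y→v =
      no-consecutive-out (w ⧺ [ e′ ]ʷ) (permute ([ y ] ∷ [ a ] ∷ M ∷ [ v ] ∷ all ∷ [])
          (λ { (a ∷ b ∷ c ∷ d ∷ e ∷ []) → a ⊕ b ⊕ c ⊕ d ≈ e , a ⊕ d ⊕ b ⊕ c ≈ e ∷ [] })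
          refl (p ∷ []))
        (y→v , out-arc (apart p (there (here refl))) (other v→y λ eq → ends-differ (w ⧺ [ e′ ]ʷ) (permute ([ y ] ∷ [ a ] ∷ M ∷ [ v ] ∷ all ∷ [])
            (λ { (a ∷ b ∷ c ∷ d ∷ e ∷ []) → a ⊕ b ⊕ c ⊕ d ≈ e , a ⊕ d ⊕ b ⊕ c ≈ e ∷ [] })
            refl (p ∷ [])) eq))
      where
      other : ∀ {i j : Bool} → j ≡ true → i ≢ j → i ≡ false
      other {false} _ _ = refl
      other {true} refl h = ⊥-elim (h refl)

    -- With `y` inserted, the walk from d round to c is a hamiltonian path of G, which d → c would
    -- make a bypass.
    no-reverse : ∀ {c d a b M} → E c d → Walk d (a ∷ b ∷ M) c → y ∷ d ∷ a ∷ b ∷ M ↭ all → ¬ E d c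
    no-reverse {c} {d} {a} {b} {M} e w p d→c with alternating (e ▹ w) p
    ... | _ ∷ r ∷ s ∷ _ with insert-y w r s (apart p (there (here refl))) (apart p (there (there (here refl))))
    ...   | L , w′ , q = no-bypass w′ (permute ([ d ] ∷ L ∷ all ∷ [ y ] ∷ [ a ] ∷ [ b ] ∷ M ∷ [])
        (λ { (a ∷ b ∷ c ∷ d ∷ e ∷ f ∷ g ∷ []) → a ⊕ b ≈ c , b ≈ d ⊕ e ⊕ f ⊕ g ∷ d ⊕ a ⊕ e ⊕ f ⊕ g ≈ c ∷ [] })
        refl (q ∷ p ∷ [])) d→c

    -- Both cycle neighbours of `c` have the opposite colour, hence the same one; reinserting `c`
    -- would give a hamiltonian path of G - y joining them.
    uninsertable : ∀ {c d M u} → E c d → Walk d M u → E u c → y ∷ c ∷ d ∷ M ↭ all → Uninsertable c (d ∷ M)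
    uninsertable {c} {d} {M} {u} e w e′ p with insertʷ? w c
    ... | inj₂ l = l
    ... | inj₁ (L , w′ , q) = ⊥-elim (ends-differ w′ (permute ([ y ] ∷ [ d ] ∷ L ∷ all ∷ [ c ] ∷ M ∷ [])
        (λ { (a ∷ b ∷ c ∷ d ∷ e ∷ f ∷ []) → a ⊕ b ⊕ c ≈ d , a ⊕ e ⊕ b ⊕ f ≈ d ∷ c ≈ e ⊕ f ∷ [] })
        refl (p ∷ q ∷ []))
          (≢-≢ (λ eq → ends-differ (w ⧺ [ e′ ]ʷ) (permute ([ y ] ∷ [ d ] ∷ M ∷ [ c ] ∷ all ∷ [])
              (λ { (a ∷ b ∷ c ∷ d ∷ e ∷ []) → a ⊕ b ⊕ c ⊕ d ≈ e , a ⊕ d ⊕ b ⊕ c ≈ e ∷ [] })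
              refl (p ∷ [])) eq)
               (ends-differ (e ▹ w) p)))

    -- The chord u → d skips `c`, and `y` can be inserted into the shortened cycle.
    chord-low : ∀ {c d a b M u} → E c d → Walk d (a ∷ b ∷ M) u → E u c → y ∷ c ∷ d ∷ a ∷ b ∷ M ↭ all → E u d → Low c
    chord-low {c} {d} {a} {b} {M} {u} e w e′ p f
      with alternating (e ▹ (w ⧺ [ e′ ]ʷ)) (permute ([ y ] ∷ [ d ] ∷ [ a ] ∷ [ b ] ∷ M ∷ [ c ] ∷ all ∷
            [])
          (λ { (a ∷ b ∷ c ∷ d ∷ e ∷ f ∷ g ∷ []) → a ⊕ b ⊕ c ⊕ d ⊕ e ⊕ f ≈ g , a ⊕ f ⊕ b ⊕ c ⊕ d ⊕ e ≈ g ∷ [] })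
          refl (p ∷ []))
    ... | _ ∷ r ∷ s ∷ _ with insert-y w r s (apart p (there (there (here refl)))) (apart p (there (there (there (here refl)))))
    ...   | L , w′ , q = d , L , u , w′ , f , (permute ([ c ] ∷ [ d ] ∷ L ∷ all ∷ [ y ] ∷ [ a ] ∷ [ b ] ∷
          M ∷ [])
        (λ { (a ∷ b ∷ c ∷ d ∷ e ∷ f ∷ g ∷ h ∷ []) → a ⊕ b ⊕ c ≈ d , c ≈ e ⊕ f ⊕ g ⊕ h ∷
              e ⊕ a ⊕ b ⊕ f ⊕ g ⊕ h ≈ d ∷ [] })
        refl (q ∷ p ∷ []))

    opposite : ∀ {i j : Bool} → i ≢ j → i ≡ true → j ≡ false
    opposite {j = false} h e = refl
    opposite {j = true} h e = ⊥-elim (h e)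

    opposite′ : ∀ {i j : Bool} → i ≢ j → i ≡ false → j ≡ true
    opposite′ {j = true} h e = refl
    opposite′ {j = false} h e = ⊥-elim (h e)

    not-true : ∀ {v} → τ v ≡ false → ¬ E v y
    not-true e e′ with trans (sym e) e′
    ... | ()

    module _ (no-T₅ : NoT₅) where

      module _ {c c₁ c₂ c₃} (e : E c c₁) (e₁ : E c₁ c₂) (e₂ : E c₂ c₃) (e₃ : E c₃ c) (f : E c₃ c₁)
               (p : y ∷ c ∷ c₁ ∷ c₂ ∷ c₃ ∷ [] ↭ all) where

        c₁↛c : ¬ E c₁ c
        c₁↛c = no-reverse e (e₁ ▹ e₂ ▹ e₃ ▹ nil) (permute ([ y ] ∷ [ c₁ ] ∷ [ c₂ ] ∷ [ c₃ ] ∷ [ c ] ∷ all ∷ [])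
            (λ { (a ∷ b ∷ c ∷ d ∷ e ∷ f ∷ []) → a ⊕ b ⊕ c ⊕ d ⊕ e ≈ f , a ⊕ e ⊕ b ⊕ c ⊕ d ≈ f ∷ [] })
            refl (p ∷ []))

        c₂↛c₁ : ¬ E c₂ c₁
        c₂↛c₁ = no-reverse e₁ (e₂ ▹ e₃ ▹ e ▹ nil) (permute ([ y ] ∷ [ c₂ ] ∷ [ c₃ ] ∷ [ c ] ∷ [ c₁ ] ∷ all ∷ [])
            (λ { (a ∷ b ∷ c ∷ d ∷ e ∷ f ∷ []) → a ⊕ b ⊕ c ⊕ d ⊕ e ≈ f , a ⊕ d ⊕ e ⊕ b ⊕ c ≈ f ∷ [] })
            refl (p ∷ []))

        c₃↛c₂ : ¬ E c₃ c₂
        c₃↛c₂ = no-reverse e₂ (e₃ ▹ e ▹ e₁ ▹ nil) (permute ([ y ] ∷ [ c₃ ] ∷ [ c ] ∷ [ c₁ ] ∷ [ c₂ ] ∷ all ∷ [])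
            (λ { (a ∷ b ∷ c ∷ d ∷ e ∷ f ∷ []) → a ⊕ b ⊕ c ⊕ d ⊕ e ≈ f , a ⊕ c ⊕ d ⊕ e ⊕ b ≈ f ∷ [] })
            refl (p ∷ []))

        c↛c₃ : ¬ E c c₃
        c↛c₃ = no-reverse e₃ (e ▹ e₁ ▹ e₂ ▹ nil) p

        adjacent : ¬ NonAdj c c₂
        adjacent = full-degree low-c (low⇒full low-c) λ eq → distinct (permute ([ c ] ∷ [ c₂ ] ∷ [ y ] ∷ [ c₁ ] ∷ [ c₃ ] ∷ all ∷ [])
            (λ { (a ∷ b ∷ c ∷ d ∷ e ∷ f ∷ []) → a ⊕ b ⊕ c ⊕ d ⊕ e ≈ f , c ⊕ a ⊕ d ⊕ b ⊕ e ≈ f ∷ [] })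
            refl (p ∷ [])) (sym eq)
          where
          low-c : Low c
          low-c = chord-low e (e₁ ▹ e₂ ▹ nil) e₃ p f

        colours : τ c ≢ τ c₁ × τ c₁ ≢ τ c₂ × τ c₂ ≢ τ c₃
        colours with alternating (e ▹ e₁ ▹ e₂ ▹ e₃ ▹ nil) (permute ([ y ] ∷ [ c₁ ] ∷ [ c₂ ] ∷ [ c₃ ] ∷ [ c ] ∷ all ∷ [])
            (λ { (a ∷ b ∷ c ∷ d ∷ e ∷ f ∷ []) → a ⊕ b ⊕ c ⊕ d ⊕ e ≈ f , a ⊕ e ⊕ b ⊕ c ⊕ d ≈ f ∷ [] })
            refl (p ∷ []))
        ... | r ∷ s ∷ t ∷ _ = r , s , t

        no-triangle-in : E c y → ⊥
        no-triangle-in c→y with E? c c₂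
        ... | yes g = no-bypass (g ▹ c₂→y ▹ y→c₃ ▹ f ▹ nil) (permute ([ c ] ∷ [ c₂ ] ∷ [ y ] ∷ [ c₃ ] ∷ [ c₁ ] ∷ all ∷ [])
            (λ { (a ∷ b ∷ c ∷ d ∷ e ∷ f ∷ []) → a ⊕ b ⊕ c ⊕ d ⊕ e ≈ f , c ⊕ a ⊕ e ⊕ b ⊕ d ≈ f ∷ [] })
            refl (p ∷ [])) e
          where
          c₂→y : E c₂ y
          c₂→y = opposite′ (proj₁ (proj₂ colours)) (opposite (proj₁ colours) c→y)
          y→c₃ : E y c₃
          y→c₃ = out-arc (apart p (there (there (there (here refl))))) (opposite (proj₂ (proj₂ colours)) c₂→y)
        -- The listing starts at c₂ so that the first and third vertices dominate y; c₂ → c and c₃ →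
        -- c₁ become the two diagonals of T₅.
        ... | no c↛c₂ = no-T₅ (permute ([ c₂ ] ∷ [ c₃ ] ∷ [ c ] ∷ [ c₁ ] ∷ [ y ] ∷ all ∷ [])
            (λ { (a ∷ b ∷ c ∷ d ∷ e ∷ f ∷ []) → a ⊕ b ⊕ c ⊕ d ⊕ e ≈ f , e ⊕ c ⊕ d ⊕ a ⊕ b ≈ f ∷ [] })
            refl (p ∷ []))
              (e₂ , c₃↛c₂) (e₃ , c↛c₃) (e , c₁↛c) (e₁ , c₂↛c₁)
              (c₂→y , single-in (e₂ ▹ e₃ ▹ e ▹ nil) e₁ (permute ([ y ] ∷ [ c₂ ] ∷ [ c₃ ] ∷ [ c ] ∷ [ c₁ ] ∷ all ∷ [])
                  (λ { (a ∷ b ∷ c ∷ d ∷ e ∷ f ∷ []) → a ⊕ b ⊕ c ⊕ d ⊕ e ≈ f , a ⊕ d ⊕ e ⊕ b ⊕ c ≈ f ∷ [] })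
                  refl (p ∷ [])) c₂→y)
              (c→y , single-in (e ▹ e₁ ▹ e₂ ▹ nil) e₃ p c→y)
              (y→c₃ , not-true c₃-out) (y→c₁ , not-true c₁-out) (c₂→c , c↛c₂) (f , c₁↛c₃)
          where
          c₁-out : τ c₁ ≡ false
          c₁-out = opposite (proj₁ colours) c→y
          c₂→y : E c₂ y
          c₂→y = opposite′ (proj₁ (proj₂ colours)) c₁-out
          c₃-out : τ c₃ ≡ false
          c₃-out = opposite (proj₂ (proj₂ colours)) c₂→y
          y→c₁ : E y c₁
          y→c₁ = out-arc (apart p (there (here refl))) c₁-out
          y→c₃ : E y c₃
          y→c₃ = out-arc (apart p (there (there (there (here refl))))) c₃-out
          c₂→c : E c₂ c
          c₂→c with E? c₂ c
          ... | yes g = g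
          ... | no c₂↛c = ⊥-elim (adjacent (c↛c₂ , c₂↛c))
          c₁↛c₃ : ¬ E c₁ c₃
          c₁↛c₃ g = no-bypass (e₁ ▹ c₂→c ▹ c→y ▹ y→c₃ ▹ nil) (permute ([ c₁ ] ∷ [ c₂ ] ∷ [ c ] ∷ [ y ] ∷ [ c₃ ] ∷ all ∷ [])
              (λ { (a ∷ b ∷ c ∷ d ∷ e ∷ f ∷ []) → a ⊕ b ⊕ c ⊕ d ⊕ e ≈ f , d ⊕ c ⊕ a ⊕ b ⊕ e ≈ f ∷ [] })
              refl (p ∷ [])) g

        no-triangle-out : τ c ≡ false → ⊥
        no-triangle-out c-out with E? c₂ c
        ... | yes g = no-bypass (e₂ ▹ f ▹ c₁→y ▹ y→c ▹ nil) (permute ([ c₂ ] ∷ [ c₃ ] ∷ [ c₁ ] ∷ [ y ] ∷ [ c ] ∷ all ∷ [])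
            (λ { (a ∷ b ∷ c ∷ d ∷ e ∷ f ∷ []) → a ⊕ b ⊕ c ⊕ d ⊕ e ≈ f , d ⊕ e ⊕ c ⊕ a ⊕ b ≈ f ∷ [] })
            refl (p ∷ [])) g
          where
          c₁→y : E c₁ y
          c₁→y = opposite′ (proj₁ colours) c-out
          y→c : E y c
          y→c = out-arc (apart p (here refl)) c-out
        ... | no c₂↛c = no-T₅ (permute ([ c₃ ] ∷ [ c ] ∷ [ c₁ ] ∷ [ c₂ ] ∷ [ y ] ∷ all ∷ [])
            (λ { (a ∷ b ∷ c ∷ d ∷ e ∷ f ∷ []) → a ⊕ b ⊕ c ⊕ d ⊕ e ≈ f , e ⊕ b ⊕ c ⊕ d ⊕ a ≈ f ∷ [] })
            refl (p ∷ []))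
              (e₃ , c↛c₃) (e , c₁↛c) (e₁ , c₂↛c₁) (e₂ , c₃↛c₂)
              (c₃→y , single-in (e₃ ▹ e ▹ e₁ ▹ nil) e₂ (permute ([ y ] ∷ [ c₃ ] ∷ [ c ] ∷ [ c₁ ] ∷ [ c₂ ] ∷ all ∷ [])
                  (λ { (a ∷ b ∷ c ∷ d ∷ e ∷ f ∷ []) → a ⊕ b ⊕ c ⊕ d ⊕ e ≈ f , a ⊕ c ⊕ d ⊕ e ⊕ b ≈ f ∷ [] })
                  refl (p ∷ [])) c₃→y)
              (c₁→y , single-in (e₁ ▹ e₂ ▹ e₃ ▹ nil) e (permute ([ y ] ∷ [ c₁ ] ∷ [ c₂ ] ∷ [ c₃ ] ∷ [ c ] ∷ all ∷ [])
                  (λ { (a ∷ b ∷ c ∷ d ∷ e ∷ f ∷ []) → a ⊕ b ⊕ c ⊕ d ⊕ e ≈ f , a ⊕ e ⊕ b ⊕ c ⊕ d ≈ f ∷ [] })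
                  refl (p ∷ [])) c₁→y)
              (y→c , not-true c-out) (y→c₂ , not-true c₂-out) (f , c₁↛c₃) (c→c₂ , c₂↛c)
          where
          c₁→y : E c₁ y
          c₁→y = opposite′ (proj₁ colours) c-out
          c₂-out : τ c₂ ≡ false
          c₂-out = opposite (proj₁ (proj₂ colours)) c₁→y
          c₃→y : E c₃ y
          c₃→y = opposite′ (proj₂ (proj₂ colours)) c₂-out
          y→c : E y c
          y→c = out-arc (apart p (here refl)) c-out
          y→c₂ : E y c₂
          y→c₂ = out-arc (apart p (there (there (here refl)))) c₂-out
          c→c₂ : E c c₂
          c→c₂ with E? c c₂
          ... | yes g = g
          ... | no c↛c₂ = ⊥-elim (adjacent (c↛c₂ , c₂↛c))
          c₁↛c₃ : ¬ E c₁ c₃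
          c₁↛c₃ g = no-bypass (e ▹ g ▹ c₃→y ▹ y→c₂ ▹ nil) (permute ([ c ] ∷ [ c₁ ] ∷ [ c₃ ] ∷ [ y ] ∷ [ c₂ ] ∷ all ∷ [])
              (λ { (a ∷ b ∷ c ∷ d ∷ e ∷ f ∷ []) → a ⊕ b ⊕ c ⊕ d ⊕ e ≈ f , d ⊕ a ⊕ b ⊕ e ⊕ c ≈ f ∷ [] })
              refl (p ∷ [])) c→c₂

        no-triangle₄ : ⊥
        no-triangle₄ = by-colour (τ c) refl
          where
          by-colour : ∀ b → τ c ≡ b → ⊥
          by-colour true eq = no-triangle-in eq
          by-colour false eq = no-triangle-out eq

      -- A chord makes `c` adjacent to everything. On a cycle of at least five vertices, an arc in
      -- either direction between c and the vertex b three steps after it gives a hamiltonian path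
      -- of G - y with ends of equal colour. Three vertices cannot be 2-coloured, and four lead to
      -- T₅.
      no-chord : ∀ {c d M u} → E c d → Walk d M u → E u c → y ∷ c ∷ d ∷ M ↭ all → ¬ E u d
      no-chord e nil e′ p f = none (χ-loop _) f
      no-chord {c} {d} e w@(_▹_ {y = a} _ nil) e′ p f =
        ends-differ (e ▹ w) p (≢-≢ (λ eq → ends-differ (w ⧺ [ e′ ]ʷ) (permute ([ y ] ∷ [ d ] ∷ [ a ] ∷ [ c ] ∷ all ∷ [])
            (λ { (a ∷ b ∷ c ∷ d ∷ e ∷ []) → a ⊕ b ⊕ c ⊕ d ≈ e , a ⊕ d ⊕ b ⊕ c ≈ e ∷ [] })
            refl (p ∷ [])) (sym eq))
          (λ eq → ends-differ (e′ ▹ e ▹ nil) (permute ([ y ] ∷ [ a ] ∷ [ c ] ∷ [ d ] ∷ all ∷ [])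
              (λ { (a ∷ b ∷ c ∷ d ∷ e ∷ []) → a ⊕ b ⊕ c ⊕ d ≈ e , a ⊕ c ⊕ d ⊕ b ≈ e ∷ [] })
              refl (p ∷ [])) (sym eq)))
      no-chord e (e₁ ▹ e₂ ▹ nil) e′ p f = no-triangle₄ e e₁ e₂ e′ f p
      no-chord {c} {d} {u = u} e w@(_▹_ {y = a} e₁ (_▹_ {y = b} e₂ (_▹_ {y = b′} {L = M} e₃ w₃))) e′ p f
        with alternating (e ▹ (w ⧺ [ e′ ]ʷ)) (permute ([ y ] ∷ [ d ] ∷ [ a ] ∷ [ b ] ∷ [ b′ ] ∷ M ∷
              [ c ] ∷ all ∷ [])
            (λ { (a ∷ b ∷ c ∷ d ∷ e ∷ f ∷ g ∷ h ∷ []) → a ⊕ b ⊕ c ⊕ d ⊕ e ⊕ f ⊕ g ≈ h , a ⊕ g ⊕ b ⊕ c ⊕ d ⊕ e ⊕ f ≈ h ∷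
                  [] })
            refl (p ∷ []))
      ... | r₁ ∷ r₂ ∷ r₃ ∷ r₄ ∷ _ = full-degree low-c (low⇒full low-c)
              (λ eq → distinct (permute ([ c ] ∷ [ b ] ∷ [ y ] ∷ [ d ] ∷ [ a ] ∷ [ b′ ] ∷
                    M ∷ all ∷ [])
                  (λ { (a ∷ b ∷ c ∷ d ∷ e ∷ f ∷ g ∷ h ∷ []) → a ⊕ b ⊕ c ⊕ d ⊕ e ⊕ f ⊕ g ≈ h , c ⊕ a ⊕ d ⊕ e ⊕ b ⊕ f ⊕ g ≈ h ∷
                        [] })
                  refl (p ∷ [])) (sym eq))
              ((λ c→b → ends-differ (c→b ▹ e₃ ▹ (w₃ ⧺ (f ▹ e₁ ▹ nil)))
                  (permute ([ y ] ∷ [ c ] ∷ [ b ] ∷ [ b′ ] ∷ M ∷ [ d ] ∷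
                        [ a ] ∷ all ∷ [])
                      (λ { (a ∷ b ∷ c ∷ d ∷ e ∷ f ∷ g ∷ h ∷ []) → a ⊕ b ⊕ c ⊕ d ⊕ e ⊕ f ⊕ g ≈ h , a ⊕ b ⊕ f ⊕ g ⊕ c ⊕ d ⊕ e ≈ h ∷
                            [] })
                      refl (p ∷ [])) (≢-≢ r₁ r₂)) ,
               (λ b→c → ends-differ (w₃ ⧺ (f ▹ e₁ ▹ e₂ ▹ b→c ▹ nil))
                  (permute ([ y ] ∷ [ b′ ] ∷ M ∷ [ d ] ∷ [ a ] ∷ [ b ] ∷
                        [ c ] ∷ all ∷ [])
                      (λ { (a ∷ b ∷ c ∷ d ∷ e ∷ f ∷ g ∷ h ∷ []) → a ⊕ b ⊕ c ⊕ d ⊕ e ⊕ f ⊕ g ≈ h , a ⊕ g ⊕ d ⊕ e ⊕ f ⊕ b ⊕ c ≈ h ∷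
                            [] })
                      refl (p ∷ [])) (sym (trans (≢-≢ r₁ r₂) (≢-≢ r₃ r₄)))))
        where
        low-c : Low c
        low-c = chord-low e w e′ p f

  -- Hamiltonian paths, by adjoining a universal vertex

  arc⁺ : Maybe V → Maybe V → Bool
  arc⁺ nothing nothing = false
  arc⁺ nothing (just _) = true
  arc⁺ (just _) nothing = true
  arc⁺ (just u) (just v) = arcs u v

  all⁺ : List (Maybe V)
  all⁺ = nothing ∷ map just all

  private
    module G⁺ = Walks arc⁺

  catMaybes-just : ∀ (L : List V) → Data.List.catMaybes (map just L) ≡ L
  catMaybes-just [] = refl
  catMaybes-just (x ∷ L) = cong (x ∷_) (catMaybes-just L)

  catMaybes-++ : ∀ (L : List V) R → Data.List.catMaybes (map just L ++ R) ≡ L ++ Data.List.catMaybes R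
  catMaybes-++ [] R = refl
  catMaybes-++ (x ∷ L) R = cong (x ∷_) (catMaybes-++ L R)

  without-∞ : ∀ {L} → L ↭ all⁺ → Data.List.catMaybes L ↭ all
  without-∞ p = subst (_ ↭_) (catMaybes-just all) (Perm.catMaybes-↭ p)

  nothing∉ : ∀ {L : List V} → ¬ (nothing ∈ map just L)
  nothing∉ {_ ∷ L} (there i) = nothing∉ i

  nodup⁺ : ∀ {x L} → ¬ (x ∷ x ∷ L ↭ all⁺)
  nodup⁺ {nothing} p = nothing∉ (Perm.∈-resp-↭ (Perm.drop-∷ p) (here refl))
  nodup⁺ {just x} p = nodup (without-∞ p)

  loopless⁺ : ∀ x → arc⁺ x x ≡ false
  loopless⁺ nothing = refl
  loopless⁺ (just x) = loopless′ x

  universal : ∀ {x} → x ≢ nothing → G⁺.E nothing x × G⁺.E x nothing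
  universal {nothing} h = ⊥-elim (h refl)
  universal {just x} h = refl , refl

  ∑-just : ∀ (f : Maybe V → ℕ) L → ∑ f (map just L) ≡ ∑ (f ∘ just) L
  ∑-just f L = cong sum (sym (List.map-∘ L))

  dg-just : ∀ x → G⁺.dg (just x) all⁺ ≡ suc (suc (δ x))
  dg-just x = trans (cong₂ (λ i j → suc i + suc j) (∑-just (G⁺.χ (just x)) all) (∑-just (λ v → G⁺.χ v (just x)) all)) (cong suc (ℕ.+-suc _ _))

  -- The two extra arcs in each direction raise the degree sum to at least 2n + 4, against the
  -- required 2(n + 1) + 1.
  ore⁺ : ∀ {x y} → x ≢ y → G⁺.NonAdj x y → suc (suc n + suc n) ≤ G⁺.dg x all⁺ + G⁺.dg y all⁺
  ore⁺ {nothing} {nothing} x≢y h = ⊥-elim (x≢y refl)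
  ore⁺ {nothing} {just y} x≢y (h , _) = ⊥-elim (h refl)
  ore⁺ {just x} {nothing} x≢y (h , _) = ⊥-elim (h refl)
  ore⁺ {just x} {just y} x≢y h = ℕ.≮⇒≥ λ l →
    (absurd ((G⁺.dg (just x) all⁺) ∷ (G⁺.dg (just y) all⁺) ∷ n ∷
          (δ x) ∷ (δ y) ∷ [])
        (λ { (a ∷ b ∷ c ∷ d ∷ e ∷ []) → 𝟙 ⊕ a ⊕ b ≼ 𝟙 ⊕ (𝟙 ⊕ c) ⊕ 𝟙 ⊕ c ∷ 𝟙 ⊕ 𝟙 ⊕ d ≼ a ∷ 𝟙 ⊕ 𝟙 ⊕ e ≼ b ∷
              c ⊕ c ≼ d ⊕ e ∷ [] })
        refl (l ∷ ≡⇒≥ (dg-just x) ∷ ≡⇒≥ (dg-just y) ∷ ore (λ e → x≢y (cong just e)) h ∷ []))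

  strip : ∀ {x L} → G⁺.Walk (just x) L nothing → ∃ λ L′ → ∃ λ e → ∃ λ R → L ≡ map just L′ ++ nothing ∷ R × Walk x L′ e × G⁺.Walk nothing R nothing
  strip {x} (G⁺._▹_ {y = nothing} {L = R} e w) = [] , x , R , refl , nil , w
  strip (G⁺._▹_ {y = just v} e w) = let (L′ , z , R , eq , w₁ , w₂) = strip w in v ∷ L′ , z , R , cong (just v ∷_) eq , e ▹ w₁ , w₂

  traceable : ¬ ¬ (∃ λ x → ∃ λ L → ∃ λ e → Walk x L e × x ∷ L ↭ all)
  traceable no-path = Meyniel.hamiltonian all⁺ nodup⁺ (suc n) (cong suc (trans (List.length-map just all) size)) arc⁺ loopless⁺ ore⁺ nothing universal
    no-hamiltonian (proj₂ (proj₂ first))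
    where
    no-hamiltonian : ∀ {L} → G⁺.Walk nothing L nothing → ¬ (L ↭ all⁺)
    no-hamiltonian G⁺.nil p with Perm.↭-length p
    ... | ()
    no-hamiltonian (G⁺._▹_ {y = nothing} () w) p
    no-hamiltonian (G⁺._▹_ {y = just x} e w) p with strip w
    ... | L′ , z , [] , refl , w₁ , _ = no-path (x , L′ , z , w₁ ,
          subst (_↭ all) (cong (x ∷_) (trans (catMaybes-++ L′ (nothing ∷ [])) (List.++-identityʳ L′))) (without-∞ p))
    ... | L′ , z , r ∷ R , refl , w₁ , w₂ = twice (Mem.∈-∃++ (G⁺.end∈ w₂))
      where
      twice : (∃ λ A → ∃ λ B → r ∷ R ≡ A ++ nothing ∷ B) → ⊥
      twice (A , B , eq) = nodup⁺ (repeated (map just L′) p)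
        where
        repeated : ∀ J → just x ∷ J ++ nothing ∷ r ∷ R ↭ all⁺ → nothing ∷ nothing ∷ just x ∷ J ++ A ++ B ↭ all⁺
        repeated J p = (permute ([ nothing ] ∷ [ (just x) ] ∷ J ∷ A ∷ B ∷ all⁺ ∷
              [ r ] ∷ R ∷ [])
            (λ { (a ∷ b ∷ c ∷ d ∷ e ∷ f ∷ g ∷ h ∷ []) → a ⊕ a ⊕ b ⊕ c ⊕ d ⊕ e ≈ f , d ⊕ a ⊕ e ≈ g ⊕ h ∷
                  b ⊕ c ⊕ a ⊕ g ⊕ h ≈ f ∷ [] })
            refl (↭-sym (↭-reflexive eq) ∷ p ∷ []))
    first : ∃ λ x → ∃ λ U → just x ∷ nothing ∷ U ↭ all⁺
    first = from all refl
      where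
      from : ∀ L → L ≡ all → ∃ λ x → ∃ λ U → just x ∷ nothing ∷ U ↭ all⁺
      from [] eq with trans (cong length eq) size
      ... | ()
      from (x ∷ L) eq = x , map just L , ↭-trans (_↭_.swap (just x) nothing ↭-refl) (↭-reflexive (cong (λ K → nothing ∷ map just K) eq))

  -- No vertex deletion leaves a hamiltonian digraph

  module _ (2≤n : 2 ≤ n) (no-T₅ : NoT₅) where

    module _ {y} (low-y : Low y) where

      degree-from-y : ∀ {c a M u} → Walk c (a ∷ M) u → E u c → y ∷ c ∷ a ∷ M ↭ all → dg c (y ∷ []) ≤ 1
      degree-from-y {c} w e p with E? c y
      ... | yes c→y = dg≤1ʳ (single-in low-y w e p c→y)
      ... | no c↛y = dg≤1ˡ c↛y

      -- y, c₁ and u contribute at most one arc each. Into the walk c₂ ... u′ on the other n - 3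
      -- vertices `c` cannot be inserted, and both boundary arcs would be chords skipping one
      -- vertex, so this walk contributes at most n - 4.
      chordless-degree : ∀ {c c₁ c₂ M u′ u} → E c c₁ → E c₁ c₂ → Walk c₂ M u′ → E u′ u → E u c →
                         y ∷ c ∷ c₁ ∷ c₂ ∷ M ++ u ∷ [] ↭ all → δ c < n
      chordless-degree {c} {c₁} {c₂} {M} {u′} {u} e e₁ w e′ e″ p = ℕ.≰⇒> λ h →
        (absurd (n ∷ (δ c) ∷ (dg c (y ∷ [])) ∷
              (dg c (c₁ ∷ u ∷ c₂ ∷ M)) ∷ (dg c (c₁ ∷ [])) ∷ (dg c (u ∷ c₂ ∷ M)) ∷ (dg c (u ∷ [])) ∷
              (dg c (c₂ ∷ M)) ∷ (length (c₂ ∷ M)) ∷ (χ c c₂) ∷ (χ u′ c) ∷ [])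
            (λ { (a ∷ b ∷ c ∷ d ∷ e ∷ f ∷ g ∷ h ∷ i ∷ j ∷ k ∷ []) → a ≼ b ∷ b ≼ c ⊕ d ∷ d ≼ e ⊕ f ∷
                  f ≼ g ⊕ h ∷ c ≼ 𝟙 ∷ e ≼ 𝟙 ∷ g ≼ 𝟙 ∷ h ⊕ 𝟙 ≼ i ⊕ j ⊕ k ∷ j ≼ ∅ ∷ k ≼ ∅ ∷ 𝟙 ⊕ 𝟙 ⊕ 𝟙 ⊕ i ≼ a ∷ [] })
            refl (h ∷ ≡⇒≤ (trans (deg-rest q) (dg-++ c (y ∷ []) (c₁ ∷ u ∷ c₂ ∷ M))) ∷
              ≡⇒≤ (dg-++ c (c₁ ∷ []) (u ∷ c₂ ∷ M)) ∷ ≡⇒≤ (dg-++ c (u ∷ []) (c₂ ∷ M)) ∷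
              degree-from-y (e ▹ e₁ ▹ (w ⧺ [ e′ ]ʷ)) e″ p ∷
              dg≤1ʳ (reverse-first (w ⧺ (e′ ▹ [ e″ ]ʷ)) (permute ([ y ] ∷ [ c₁ ] ∷ [ c₂ ] ∷ M ∷ [ u ] ∷ [ c ] ∷ all ∷
              [])
            (λ { (a ∷ b ∷ c ∷ d ∷ e ∷ f ∷ g ∷ []) → a ⊕ b ⊕ c ⊕ d ⊕ e ⊕ f ≈ g , a ⊕ f ⊕ b ⊕ c ⊕ d ⊕ e ≈ g ∷
                  [] })
            refl (p ∷ []))) ∷ dg≤1ˡ (no-reverse low-y e″ (e ▹ e₁ ▹ (w ⧺ [ e′ ]ʷ)) p) ∷
              dg-uninsertable w c free ∷
              ≡⇒≤ (χ-no-arc (no-chord low-y no-T₅ e₁ (w ⧺ (e′ ▹ [ e″ ]ʷ)) e (permute ([ y ] ∷ [ c₁ ] ∷ [ c₂ ] ∷ M ∷ [ u ] ∷ [ c ] ∷ all ∷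
              [])
            (λ { (a ∷ b ∷ c ∷ d ∷ e ∷ f ∷ g ∷ []) → a ⊕ b ⊕ c ⊕ d ⊕ e ⊕ f ≈ g , a ⊕ f ⊕ b ⊕ c ⊕ d ⊕ e ≈ g ∷
                  [] })
            refl (p ∷ [])))) ∷
              ≡⇒≤ (χ-no-arc (no-chord low-y no-T₅ e″ (e ▹ e₁ ▹ w) e′ (permute ([ y ] ∷ [ u ] ∷ [ c ] ∷ [ c₁ ] ∷ [ c₂ ] ∷ M ∷ all ∷
              [])
            (λ { (a ∷ b ∷ c ∷ d ∷ e ∷ f ∷ g ∷ []) → a ⊕ b ⊕ c ⊕ d ⊕ e ⊕ f ≈ g , a ⊕ c ⊕ d ⊕ e ⊕ f ⊕ b ≈ g ∷
                  [] })
            refl (p ∷ [])))) ∷ ≡⇒≤ (size-rest q) ∷ []))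
        where
        q : c ∷ y ∷ c₁ ∷ u ∷ c₂ ∷ M ↭ all
        q = (permute ([ c ] ∷ [ y ] ∷ [ c₁ ] ∷ [ u ] ∷ [ c₂ ] ∷ M ∷ all ∷
              [])
            (λ { (a ∷ b ∷ c ∷ d ∷ e ∷ f ∷ g ∷ []) → a ⊕ b ⊕ c ⊕ d ⊕ e ⊕ f ≈ g , b ⊕ a ⊕ c ⊕ e ⊕ f ⊕ d ≈ g ∷
                  [] })
            refl (p ∷ []))
        free : Uninsertable c (c₂ ∷ M)
        free = linked-++ˡ (c₂ ∷ M) (linked-++ʳ (c₁ ∷ []) (uninsertable low-y e (e₁ ▹ (w ⧺ [ e′ ]ʷ)) e″ p))
        reverse-first : ∀ {K} → Walk c₂ K c → y ∷ c₁ ∷ c₂ ∷ K ↭ all → ¬ E c₁ c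
        reverse-first nil r = ⊥-elim ((absurd (n ∷ (length M) ∷ [])
            (λ { (a ∷ b ∷ []) → 𝟙 ⊕ a ≼ 𝟙 ⊕ 𝟙 ⊕ 𝟙 ∷ 𝟙 ⊕ 𝟙 ⊕ 𝟙 ⊕ 𝟙 ⊕ b ≼ a ∷ [] })
            refl (≡⇒≥ (trans (Perm.↭-length r) size) ∷ ≡⇒≤ (size-rest q) ∷ [])))
        reverse-first (d ▹ v) r = no-reverse low-y e (e₁ ▹ d ▹ v) r

      small : ∀ {x L} → Walk x L x → y ∷ L ↭ all → δ x < n
      small nil p = ⊥-elim ((absurd (n ∷ [])
          (λ { (a ∷ []) → 𝟙 ⊕ 𝟙 ≼ a ∷ a ≼ ∅ ∷ [] })
          refl (2≤n ∷ ≡⇒≥ (size-rest p) ∷ [])))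
      small (e ▹ nil) p = ⊥-elim (none (χ-loop _) e)
      small {x} (_▹_ {y = v} e (e₁ ▹ nil)) p = ⊥-elim (by-colour (τ low-y x) refl)
        where
        differ : τ low-y x ≢ τ low-y v
        differ = ends-differ low-y (e ▹ nil) (permute ([ y ] ∷ [ x ] ∷ [ v ] ∷ all ∷ [])
            (λ { (a ∷ b ∷ c ∷ d ∷ []) → a ⊕ b ⊕ c ≈ d , a ⊕ c ⊕ b ≈ d ∷ [] })
            refl (p ∷ []))
        by-colour : ∀ b → τ low-y x ≡ b → ⊥
        by-colour true eq = no-bypass (eq ▹ out-arc low-y (apart p (here refl)) (opposite low-y differ eq) ▹ nil)
          (permute ([ x ] ∷ [ y ] ∷ [ v ] ∷ all ∷ [])
              (λ { (a ∷ b ∷ c ∷ d ∷ []) → a ⊕ b ⊕ c ≈ d , b ⊕ c ⊕ a ≈ d ∷ [] })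
              refl (p ∷ [])) e
        by-colour false eq = no-bypass (opposite′ low-y differ eq ▹ out-arc low-y (apart p (there (here refl))) eq ▹ nil)
          (permute ([ v ] ∷ [ y ] ∷ [ x ] ∷ all ∷ [])
              (λ { (a ∷ b ∷ c ∷ d ∷ []) → a ⊕ b ⊕ c ≈ d , b ⊕ a ⊕ c ≈ d ∷ [] })
              refl (p ∷ [])) e₁
      small {x} (_▹_ {y = c₁} e (_▹_ {y = c₂} e₁ w@(_▹_ {y = b} {L = M} _ _))) p with walk-∷ʳ w
      ... | u , [] , nil , e″ , refl = ⊥-elim (odd (alternating low-y (e ▹ e₁ ▹ w) p))
        where
        odd : ¬ Linked (λ u v → τ low-y u ≢ τ low-y v) (x ∷ c₁ ∷ c₂ ∷ x ∷ [])
        odd (r₁ ∷ r₂ ∷ r₃ ∷ _) = r₃ (sym (≢-≢ low-y r₁ r₂))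
      ... | u , d ∷ M′ , w′ , e″ , eq with walk-∷ʳ w′
      ...   | u′ , M″ , w″ , e′ , eq′ = chordless-degree e e₁ w″ e′ e″
              (permute ([ y ] ∷ [ x ] ∷ [ c₁ ] ∷ [ c₂ ] ∷ M″ ∷ [ u ] ∷
                    all ∷ [ b ] ∷ M ∷ [ d ] ∷ M′ ∷ [])
                  (λ { (a ∷ b ∷ c ∷ d ∷ e ∷ f ∷ g ∷ h ∷ i ∷ j ∷ k ∷ []) → a ⊕ b ⊕ c ⊕ d ⊕ e ⊕ f ≈ g , a ⊕ c ⊕ d ⊕ h ⊕ i ≈ g ∷
                        j ⊕ k ⊕ b ≈ h ⊕ i ∷ e ⊕ f ≈ j ⊕ k ∷ [] })
                  refl (p ∷ ↭-sym (↭-reflexive eq) ∷ ↭-sym (↭-reflexive eq′) ∷ []))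

    -- All cycle vertices have degree below n, so each has a non-neighbour. It is not y, by
    -- `full-degree`, and a second cycle vertex violates the degree condition.
    no-low : ∀ {y} → ¬ Low y
    no-low {y} low-y with low-closed low-y
    ... | c , L , w , p = from w p
      where
      small∈ : ∀ {L v} → Walk c L c → y ∷ L ↭ all → v ∈ L → δ v < n
      small∈ {L} w p i with rotate-closed w i
      ... | L′ , w′ , q = small low-y w′ (permute ([ y ] ∷ L′ ∷ all ∷ L ∷ [])
          (λ { (a ∷ b ∷ c ∷ d ∷ []) → a ⊕ b ≈ c , a ⊕ d ≈ c ∷ b ≈ d ∷ [] })
          refl (p ∷ q ∷ []))
      from : ∀ {L} → Walk c L c → y ∷ L ↭ all → ⊥
      from nil p = (absurd (n ∷ [])
          (λ { (a ∷ []) → 𝟙 ⊕ 𝟙 ≼ a ∷ a ≼ ∅ ∷ [] })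
          refl (2≤n ∷ ≡⇒≥ (size-rest p) ∷ []))
      from w@(_▹_ {y = x} {L = L} _ _) p with nonadj-somewhere (small∈ w p (here refl)) (y ∷ L)
      ... | inj₁ adjs = (absurd ((δ x) ∷ n ∷ (dg x (y ∷ L)) ∷ (length (y ∷ L)) ∷ [])
          (λ { (a ∷ b ∷ c ∷ d ∷ []) → 𝟙 ⊕ a ≼ b ∷ c ≼ a ∷ d ≼ c ∷ b ≼ d ∷ [] })
          refl (small∈ w p (here refl) ∷ ≡⇒≥ (deg-rest q) ∷ all-adjacent (small∈ w p (here refl)) adjs ∷
            ≡⇒≥ (size-rest q) ∷ []))
        where
        q : x ∷ y ∷ L ↭ all
        q = (permute ([ x ] ∷ [ y ] ∷ L ∷ all ∷ [])
            (λ { (a ∷ b ∷ c ∷ d ∷ []) → a ⊕ b ⊕ c ≈ d , b ⊕ a ⊕ c ≈ d ∷ [] })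
            refl (p ∷ []))
      ... | inj₂ (z , here refl , h) = full-degree low-y (low⇒full low-y) (λ eq → apart p (here refl) (sym eq)) (let (h₁ , h₂) = h in h₂ , h₁)
      ... | inj₂ (z , there i , h) = (absurd ((δ x) ∷ n ∷ (δ z) ∷ [])
          (λ { (a ∷ b ∷ c ∷ []) → 𝟙 ⊕ a ≼ b ∷ 𝟙 ⊕ c ≼ b ∷ b ⊕ b ≼ a ⊕ c ∷ [] })
          refl (small∈ w p (here refl) ∷ small∈ w p (there i) ∷
            ore (apart (permute ([ x ] ∷ [ y ] ∷ L ∷ all ∷ [])
          (λ { (a ∷ b ∷ c ∷ d ∷ []) → a ⊕ b ⊕ c ≈ d , b ⊕ a ⊕ c ≈ d ∷ [] })
          refl (p ∷ [])) (there i)) h ∷ []))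

    private
      module Gᵒᵖ = Walks (flip arcs)

    no-lowᵒᵖ : ∀ {y} → ¬ Counterexample.Low (op C) y
    no-lowᵒᵖ {y} (v , L , u , w , e , p) = let (L′ , w′ , q) = reverse-walk-↭ (flip arcs) w in
      no-low (u , L′ , v , w′ , e , (permute ([ y ] ∷ [ u ] ∷ L′ ∷ all ∷ [ v ] ∷ L ∷ [])
          (λ { (a ∷ b ∷ c ∷ d ∷ e ∷ f ∷ []) → a ⊕ b ⊕ c ≈ d , b ⊕ c ≈ e ⊕ f ∷ a ⊕ e ⊕ f ≈ d ∷ [] })
          refl (q ∷ p ∷ [])))

    walk-split : ∀ {x} A {f F e} → Walk x (A ++ f ∷ F) e → ∃ λ q → Walk x A q × E q f × Walk f F e
    walk-split {x} [] (e ▹ w) = x , nil , e , w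
    walk-split (a ∷ A) (e ▹ w) = let (q , w₁ , e′ , w₂) = walk-split A w in q , e ▹ w₁ , e′ , w₂

    walk-splitᵒᵖ : ∀ {x} A {f F e} → Gᵒᵖ.Walk x (A ++ f ∷ F) e → Gᵒᵖ.Walk f F e
    walk-splitᵒᵖ [] (e Gᵒᵖ.▹ w) = w
    walk-splitᵒᵖ (a ∷ A) (e Gᵒᵖ.▹ w) = walk-splitᵒᵖ A w

    -- Rotation at both ends of a hamiltonian path

    data PathTo (e : V) : List V → Set where
      path-to : ∀ {x L} → Walk x L e → x ∷ L ↭ all → NonAdj x e → PathTo e (x ∷ L)

    path-to-spans : ∀ {e L} → PathTo e L → L ↭ all
    path-to-spans (path-to _ p _) = p

    -- The new path from v to e excludes v → e as a bypass, and e → v would close the old path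
    -- without `x` to a cycle.
    path-to-move : ∀ {e x L L′} → PathTo e (x ∷ L) → Insert x L L′ → PathTo e L′
    path-to-move {e} {x} (path-to (_▹_ {y = v} {L = L} _ w) p _) i with insert-walk w i
    ... | L″ , refl , w′ = path-to w′ p′ (no-bypass w′ p′ , λ e→v → no-low (v , L , e , w , e→v , p))
      where
      p′ : v ∷ L″ ↭ all
      p′ = (permute ([ v ] ∷ L″ ∷ all ∷ [ x ] ∷ L ∷ [])
          (λ { (a ∷ b ∷ c ∷ d ∷ e ∷ []) → a ⊕ b ≈ c , a ⊕ b ≈ d ⊕ a ⊕ e ∷ d ⊕ a ⊕ e ≈ c ∷ [] })
          refl (insert-↭ i ∷ p ∷ []))

    -- The last vertex of a path now moves, while the block M keeps its rotations.
    module _ {m M f} (blocks : ∀ {a} → a ∈ (m ∷ M) → ∃ λ A → ∃ λ q → Walk a A q × E q f × a ∷ A ↭ m ∷ M) where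

      data PathFrom (S : List V) : List V → Set where
        path-from : ∀ {ν L} → Gᵒᵖ.Walk ν L f → ν ∷ L ↭ S → (m ∷ M) ++ S ↭ all → (∀ {a} → a ∈ (m ∷ M) → NonAdj a ν) →
                    (∀ {a} → a ∈ (m ∷ M) → Gᵒᵖ.Uninsertable a (ν ∷ L)) → PathFrom S (ν ∷ L)

      path-from-spans : ∀ {S L} → PathFrom S L → L ↭ S
      path-from-spans (path-from _ p _ _ _) = p

      -- Inserting `ν` creates two new pairs, each containing `ν`, which is not adjacent to `a`;
      -- neither can receive `a`.
      uninsertable-insert : ∀ {a ν L L′} → NonAdj a ν → Gᵒᵖ.Uninsertable a L → Gᵒᵖ.Insert ν L L′ → Gᵒᵖ.Uninsertable a L′
      uninsertable-insert {a} {ν} (h , h′) (r ∷ l) (Gᵒᵖ.here {u} {v} _ _) =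
        subst (λ k → χ a u + k ≤ 1) (sym (χ-no-arc h′)) (subst (_≤ 1) (sym (ℕ.+-identityʳ _)) (χ≤1 a u)) ∷
        subst (λ k → k + χ v a ≤ 1) (sym (χ-no-arc h)) (χ≤1 v a) ∷ l
      uninsertable-insert h [-] (Gᵒᵖ.there ())
      uninsertable-insert h (r ∷ l) (Gᵒᵖ.there i@(Gᵒᵖ.here _ _)) = r ∷ uninsertable-insert h l i
      uninsertable-insert h (r ∷ l) (Gᵒᵖ.there i@(Gᵒᵖ.there _)) = r ∷ uninsertable-insert h l i

      -- Any `a` of the block starts a walk through the whole block into `f`. Continued along the
      -- new path it excludes a → v as a bypass; continued along the old path without `ν`, it turns
      -- v → a into a cycle missing only `ν`.
      path-from-move : ∀ {S ν L L′} → PathFrom S (ν ∷ L) → Gᵒᵖ.Insert ν L L′ → PathFrom S L′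
      path-from-move {S} {ν} (path-from (Gᵒᵖ._▹_ {y = v} {L = L} _ w) p s h l) i with Gᵒᵖ.insert-walk w i
      ... | L″ , refl , w′ = path-from w′ p′ s (λ j → never-to j , never-from j) λ j → uninsertable-insert (h j) (linked-++ʳ (ν ∷ []) (l j)) i
        where
        p′ : v ∷ L″ ↭ S
        p′ = (permute ([ v ] ∷ L″ ∷ S ∷ [ ν ] ∷ L ∷ [])
            (λ { (a ∷ b ∷ c ∷ d ∷ e ∷ []) → a ⊕ b ≈ c , a ⊕ b ≈ d ⊕ a ⊕ e ∷ d ⊕ a ⊕ e ≈ c ∷ [] })
            refl (Gᵒᵖ.insert-↭ i ∷ p ∷ []))
        never-to : ∀ {a} → a ∈ (m ∷ M) → ¬ E a v
        never-to {a} j = let (A , q , w₁ , e , r) = blocks j ; (R , w₂ , t) = reverse-walk-↭ (flip arcs) w′ in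
          no-bypass (w₁ ⧺ (e ▹ w₂)) (permute ([ a ] ∷ A ∷ [ f ] ∷ R ∷ all ∷ [ m ] ∷ M ∷ [ v ] ∷
                L″ ∷ S ∷ [])
              (λ { (a ∷ b ∷ c ∷ d ∷ e ∷ f ∷ g ∷ h ∷ i ∷ j ∷ []) → a ⊕ b ⊕ c ⊕ d ≈ e , a ⊕ b ≈ f ⊕ g ∷
                    c ⊕ d ≈ h ⊕ i ∷ h ⊕ i ≈ j ∷ (f ⊕ g) ⊕ j ≈ e ∷ [] })
              refl (r ∷ t ∷ p′ ∷ s ∷ []))
        never-from : ∀ {a} → a ∈ (m ∷ M) → ¬ E v a
        never-from {a} j v→a = let (A , q , w₁ , e , r) = blocks j ; (R , w₂ , t) = reverse-walk-↭ (flip arcs) w in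
          no-low {ν} (a , A ++ f ∷ R , v , w₁ ⧺ (e ▹ w₂) , v→a ,
            (permute ([ ν ] ∷ [ a ] ∷ A ∷ [ f ] ∷ R ∷ all ∷ [ m ] ∷ M ∷
                  [ v ] ∷ L ∷ S ∷ [])
                (λ { (a ∷ b ∷ c ∷ d ∷ e ∷ f ∷ g ∷ h ∷ i ∷ j ∷ k ∷ []) → a ⊕ b ⊕ c ⊕ d ⊕ e ≈ f , b ⊕ c ≈ g ⊕ h ∷
                      d ⊕ e ≈ i ⊕ j ∷ a ⊕ i ⊕ j ≈ k ∷ (g ⊕ h) ⊕ k ≈ f ∷ [] })
                refl (r ∷ t ∷ p ∷ s ∷ [])))

      no-path-from : ∀ {S ν N} → ¬ PathFrom S ((ν ∷ N) ++ f ∷ [])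
      no-path-from {S} = Rotation.rotation (flip arcs) (PathFrom S) S path-from-spans path-from-move stable
        where
        stable : ∀ {ν N F} → PathFrom S ((ν ∷ N) ++ F) →
                 (∀ {z} → z ∈ (ν ∷ N) → (∃ λ Z → PathFrom S ((z ∷ Z) ++ F)) × Gᵒᵖ.Uninsertable z F) → F ≢ [] → ⊥
        stable {F = []} _ _ F≢ = F≢ refl
        stable {ν} {N} {k ∷ K} (path-from w p s _ l) fronts _ = OneSided.two-blocks (op C) no-lowᵒᵖ (walk-splitᵒᵖ N w)
          (permute ([ m ] ∷ M ∷ [ k ] ∷ K ∷ [ ν ] ∷ N ∷ all ∷ S ∷ [])
              (λ { (a ∷ b ∷ c ∷ d ∷ e ∷ f ∷ g ∷ h ∷ []) → (a ⊕ b) ⊕ (c ⊕ d) ⊕ e ⊕ f ≈ g , e ⊕ f ⊕ c ⊕ d ≈ h ∷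
                    (a ⊕ b) ⊕ h ≈ g ∷ [] })
              refl (p ∷ s ∷ []))
          (λ i j → swap (apart-at (proj₂ (proj₁ (fronts j))) i)) (λ i → linked-++ʳ (ν ∷ N) (l i)) (λ j → proj₂ (fronts j))
          where
          swap : ∀ {x z} → NonAdj x z → Gᵒᵖ.NonAdj x z
          swap (h , h′) = h′ , h
          apart-at : ∀ {a z Z} → PathFrom S ((z ∷ Z) ++ k ∷ K) → a ∈ (m ∷ M) → NonAdj a z
          apart-at (path-from _ _ _ h _) = h

    no-path-to : ∀ {e m M} → ¬ PathTo e ((m ∷ M) ++ e ∷ [])
    no-path-to {e} = Rotation.rotation arcs (PathTo e) all path-to-spans path-to-move stable
      where
      stable : ∀ {m M F} → PathTo e ((m ∷ M) ++ F) →
               (∀ {a} → a ∈ (m ∷ M) → (∃ λ A → PathTo e ((a ∷ A) ++ F)) × Uninsertable a F) → F ≢ [] → ⊥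
      stable {F = []} _ _ F≢ = F≢ refl
      stable {m} {M} {f ∷ F} (path-to w p _) fronts _ = last-block F (proj₂ (proj₂ (proj₂ (walk-split M w)))) p λ i → proj₂ (fronts i)
        where
        nonadj-e : ∀ {a} → a ∈ (m ∷ M) → NonAdj a e
        nonadj-e i with proj₁ (fronts i)
        ... | _ , path-to _ _ h = h
        blocks : ∀ {a} → a ∈ (m ∷ M) → ∃ λ A → ∃ λ q → Walk a A q × E q f × a ∷ A ↭ m ∷ M
        blocks {a} i with proj₁ (fronts i)
        ... | A , path-to w′ p′ _ = let (q , w₁ , e′ , _) = walk-split A w′ in A , q , w₁ , e′ , (permute ([ a ] ∷ A ∷ [ m ] ∷ M ∷ [ f ] ∷ F ∷ all ∷ [])
            (λ { (a ∷ b ∷ c ∷ d ∷ e ∷ f ∷ g ∷ []) → a ⊕ b ≈ c ⊕ d , a ⊕ b ⊕ e ⊕ f ≈ g ∷ g ≈ c ⊕ d ⊕ e ⊕ f ∷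
                  [] })
            refl (p′ ∷ ↭-sym p ∷ []))
        last-block : ∀ F → Walk f F e → (m ∷ M) ++ f ∷ F ↭ all → (∀ {a} → a ∈ (m ∷ M) → Uninsertable a (f ∷ F)) → ⊥
        -- Here `f` is the end `e` itself, and the last vertex of the block dominates it although
        -- all block vertices are non-adjacent to `e`.
        last-block [] nil _ _ = let (_ , w₁ , e′ , _) = walk-split M w in proj₁ (nonadj-e (last∈ w₁)) e′
        last-block (v ∷ F) w′ p′ u = from (reverse-walk arcs w′) w′
          where
          uᵒᵖ : ∀ {a R} → e ∷ R ≡ reverse (f ∷ v ∷ F) → a ∈ (m ∷ M) → Gᵒᵖ.Uninsertable a (e ∷ R)
          uᵒᵖ {a} eq i = subst (Gᵒᵖ.Uninsertable a) (sym eq)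
            (linked-map (λ {x} {z} r → subst (_≤ 1) (ℕ.+-comm (χ z a) _) r) (linked-reverse (f ∷ v ∷ F) (u i)))
          from : (∃ λ R → Gᵒᵖ.Walk e R f × e ∷ R ≡ reverse (f ∷ v ∷ F)) → Walk f (v ∷ F) e → ⊥
          from (R , wᵒᵖ , eq) _ = ends R wᵒᵖ (uᵒᵖ eq) (subst (_↭ f ∷ v ∷ F) (sym eq) (Perm.↭-reverse (f ∷ v ∷ F)))
            where
            ends : ∀ R → Gᵒᵖ.Walk e R f → (∀ {a} → a ∈ (m ∷ M) → Gᵒᵖ.Uninsertable a (e ∷ R)) → e ∷ R ↭ f ∷ v ∷ F → ⊥
            ends [] _ _ r with Perm.↭-length r
            ... | ()
            ends (r ∷ R) wᵒᵖ l q with Gᵒᵖ.walk-∷ʳ wᵒᵖ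
            ... | _ , L , _ , _ , eq′ = no-path-from blocks (subst (PathFrom blocks (f ∷ v ∷ F)) (cong (e ∷_) eq′) (path-from wᵒᵖ q p′ nonadj-e l))

    no-nonadjacent-ends : ∀ {x L e} → Walk x L e → x ∷ L ↭ all → x ≢ e → NonAdj x e → ⊥
    no-nonadjacent-ends nil p x≢e h = x≢e refl
    no-nonadjacent-ends {x} {v ∷ L} {e} w p x≢e h with walk-∷ʳ w
    ... | _ , L′ , _ , _ , eq = no-path-to (subst (PathTo e) (cong (x ∷_) eq) (path-to w p h))

    open-walk : ∀ {x v L e} → Walk x (v ∷ L) e → x ∷ v ∷ L ↭ all → ¬ E e x → ⊥
    open-walk w p h = no-nonadjacent-ends w p (apart p (end∈ w)) (no-bypass w p , h)

    -- Hamiltonian cycles and the final contradiction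

    not-all-small : (∀ v → δ v < n) → ⊥
    not-all-small small = from all refl
      where
      from : ∀ L → L ≡ all → ⊥
      from [] eq with trans (cong length eq) size
      ... | ()
      from (x ∷ L) eq with nonadj-somewhere (small x) L
      ... | inj₁ adjs = (absurd ((δ x) ∷ n ∷ (dg x L) ∷ (length L) ∷ [])
          (λ { (a ∷ b ∷ c ∷ d ∷ []) → 𝟙 ⊕ a ≼ b ∷ c ≼ a ∷ d ≼ c ∷ b ≼ d ∷ [] })
          refl (small x ∷ ≡⇒≥ (deg-rest (↭-reflexive eq)) ∷ all-adjacent (small x) adjs ∷
            ≡⇒≥ (size-rest (↭-reflexive eq)) ∷ []))
      ... | inj₂ (z , i , h) = (absurd ((δ x) ∷ n ∷ (δ z) ∷ [])
          (λ { (a ∷ b ∷ c ∷ []) → 𝟙 ⊕ a ≼ b ∷ 𝟙 ⊕ c ≼ b ∷ b ⊕ b ≼ a ⊕ c ∷ [] })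
          refl (small x ∷ small z ∷ ore (apart (↭-reflexive eq) i) h ∷ []))

    -- Inserting v into v₁ ... u gives a hamiltonian path whose ends are non-adjacent, since u → v₁
    -- would close a cycle missing only v. So v is uninsertable, and the arcs v → v₂ and u′ → v
    -- would likewise give a cycle missing one vertex. The count is 1 + 1 + (n - 3).
    small-degree : ∀ {v v₁ v₂ M u′ u} → E v v₁ → E v₁ v₂ → Walk v₂ M u′ → E u′ u → E u v →
                   v ∷ v₁ ∷ v₂ ∷ M ++ u ∷ [] ↭ all → δ v < n
    small-degree {v} {v₁} {v₂} {M} {u′} {u} e e₁ w e′ e″ p = bound (insertʷ? (e₁ ▹ (w ⧺ [ e′ ]ʷ)) v)
      where
      bound : (∃ λ L → Walk v₁ L u × L ↭ v ∷ v₂ ∷ M ++ u ∷ []) ⊎ Uninsertable v (v₁ ∷ v₂ ∷ M ++ u ∷ []) → δ v < n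
      bound (inj₁ ([] , w′ , q)) with Perm.↭-length q
      ... | ()
      bound (inj₁ (r ∷ L , w′ , q)) = ⊥-elim (open-walk w′ (permute ([ v₁ ] ∷ [ r ] ∷ L ∷ all ∷ [ v ] ∷ [ v₂ ] ∷ M ∷
            [ u ] ∷ [])
          (λ { (a ∷ b ∷ c ∷ d ∷ e ∷ f ∷ g ∷ h ∷ []) → a ⊕ b ⊕ c ≈ d , b ⊕ c ≈ e ⊕ f ⊕ g ⊕ h ∷
                e ⊕ a ⊕ f ⊕ g ⊕ h ≈ d ∷ [] })
          refl (q ∷ p ∷ []))
        λ u→v₁ → no-low {v} (v₁ , v₂ ∷ M ++ u ∷ [] , u , e₁ ▹ (w ⧺ [ e′ ]ʷ) , u→v₁ , p))
      bound (inj₂ stuck) = ℕ.≰⇒> λ h →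
        (absurd (n ∷ (δ v) ∷ (dg v (v₁ ∷ [])) ∷
              (dg v (u ∷ v₂ ∷ M)) ∷ (dg v (u ∷ [])) ∷ (dg v (v₂ ∷ M)) ∷ (length (v₂ ∷ M)) ∷ (χ v v₂) ∷
              (χ u′ v) ∷ [])
            (λ { (a ∷ b ∷ c ∷ d ∷ e ∷ f ∷ g ∷ h ∷ i ∷ []) → a ≼ b ∷ b ≼ c ⊕ d ∷ d ≼ e ⊕ f ∷ c ≼ 𝟙 ∷ e ≼ 𝟙 ∷
                  f ⊕ 𝟙 ≼ g ⊕ h ⊕ i ∷ h ≼ ∅ ∷ i ≼ ∅ ∷ 𝟙 ⊕ 𝟙 ⊕ g ≼ a ∷ [] })
            refl (h ∷ ≡⇒≤ (trans (deg-rest q) (dg-++ v (v₁ ∷ []) (u ∷ v₂ ∷ M))) ∷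
              ≡⇒≤ (dg-++ v (u ∷ []) (v₂ ∷ M)) ∷
              dg≤1ʳ (no-bypass (e₁ ▹ (w ⧺ (e′ ▹ [ e″ ]ʷ))) (permute ([ v₁ ] ∷ [ v₂ ] ∷ M ∷ [ u ] ∷ [ v ] ∷ all ∷ [])
            (λ { (a ∷ b ∷ c ∷ d ∷ e ∷ f ∷ []) → a ⊕ b ⊕ c ⊕ d ⊕ e ≈ f , e ⊕ a ⊕ b ⊕ c ⊕ d ≈ f ∷ [] })
            refl (p ∷ []))) ∷ dg≤1ˡ (no-bypass (e ▹ e₁ ▹ (w ⧺ [ e′ ]ʷ)) p) ∷
              dg-uninsertable w v (linked-++ˡ (v₂ ∷ M) (linked-++ʳ (v₁ ∷ []) stuck)) ∷
              ≡⇒≤ (χ-no-arc (λ v→v₂ → no-low {v₁} (v₂ , M ++ u ∷ v ∷ [] , v , w ⧺ (e′ ▹ [ e″ ]ʷ) , v→v₂ , (permute ([ v₁ ] ∷ [ v₂ ] ∷ M ∷ [ u ] ∷ [ v ] ∷ all ∷ [])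
            (λ { (a ∷ b ∷ c ∷ d ∷ e ∷ f ∷ []) → a ⊕ b ⊕ c ⊕ d ⊕ e ≈ f , e ⊕ a ⊕ b ⊕ c ⊕ d ≈ f ∷ [] })
            refl (p ∷ []))))) ∷
              ≡⇒≤ (χ-no-arc (λ u′→v → no-low {u} (v , v₁ ∷ v₂ ∷ M , u′ , e ▹ e₁ ▹ w , u′→v , (permute ([ u ] ∷ [ v ] ∷ [ v₁ ] ∷ [ v₂ ] ∷ M ∷ all ∷ [])
            (λ { (a ∷ b ∷ c ∷ d ∷ e ∷ f ∷ []) → a ⊕ b ⊕ c ⊕ d ⊕ e ≈ f , b ⊕ c ⊕ d ⊕ e ⊕ a ≈ f ∷ [] })
            refl (p ∷ []))))) ∷ ≡⇒≤ (size-rest q) ∷ []))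
        where
        q : v ∷ v₁ ∷ u ∷ v₂ ∷ M ↭ all
        q = (permute ([ v ] ∷ [ v₁ ] ∷ [ u ] ∷ [ v₂ ] ∷ M ∷ all ∷ [])
            (λ { (a ∷ b ∷ c ∷ d ∷ e ∷ f ∷ []) → a ⊕ b ⊕ c ⊕ d ⊕ e ≈ f , a ⊕ b ⊕ d ⊕ e ⊕ c ≈ f ∷ [] })
            refl (p ∷ []))

    module _ (no-C₃ : NoC₃) where

      on-cycle : ∀ {x L} → Walk x L x → L ↭ all → δ x < n
      on-cycle nil p with trans (Perm.↭-length p) size
      ... | ()
      on-cycle (e ▹ nil) p = ⊥-elim ((absurd (n ∷ [])
          (λ { (a ∷ []) → 𝟙 ⊕ 𝟙 ≼ a ∷ a ≼ ∅ ∷ [] })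
          refl (2≤n ∷ ≡⇒≥ (size-rest p) ∷ [])))
      on-cycle (e ▹ e₁ ▹ nil) p = ⊥-elim ((absurd (n ∷ [])
          (λ { (a ∷ []) → 𝟙 ⊕ 𝟙 ≼ a ∷ a ≼ 𝟙 ∷ [] })
          refl (2≤n ∷ ≡⇒≥ (size-rest p) ∷ [])))
      on-cycle {x} (_▹_ {y = v} e (_▹_ {y = u} e₁ (e₂ ▹ nil))) p = ⊥-elim (no-C₃ (permute ([ x ] ∷ [ v ] ∷ [ u ] ∷ all ∷ [])
          (λ { (a ∷ b ∷ c ∷ d ∷ []) → a ⊕ b ⊕ c ≈ d , b ⊕ c ⊕ a ≈ d ∷ [] })
          refl (p ∷ []))
        (e , no-bypass (e₁ ▹ e₂ ▹ nil) p) (e₁ , no-bypass (e₂ ▹ e ▹ nil) (permute ([ u ] ∷ [ x ] ∷ [ v ] ∷ all ∷ [])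
            (λ { (a ∷ b ∷ c ∷ d ∷ []) → a ⊕ b ⊕ c ≈ d , c ⊕ a ⊕ b ≈ d ∷ [] })
            refl (p ∷ [])))
        (e₂ , no-bypass (e ▹ e₁ ▹ nil) (permute ([ x ] ∷ [ v ] ∷ [ u ] ∷ all ∷ [])
            (λ { (a ∷ b ∷ c ∷ d ∷ []) → a ⊕ b ⊕ c ≈ d , b ⊕ c ⊕ a ≈ d ∷ [] })
            refl (p ∷ []))))
      on-cycle {x} (_▹_ {y = v₁} e (_▹_ {y = v₂} e₁ w@(_▹_ {y = v₃} {L = L₃} _ (_▹_ {L = L} _ _)))) p with walk-∷ʳ w
      ... | u , [] , nil , _ , ()
      ... | u , r ∷ M , w₁ , e″ , eq with walk-∷ʳ w₁
      ...   | u′ , M′ , w₂ , e′ , eq′ = small-degree e e₁ w₂ e′ e″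
              (permute ([ x ] ∷ [ v₁ ] ∷ [ v₂ ] ∷ M′ ∷ [ u ] ∷ all ∷
                    [ v₃ ] ∷ L₃ ∷ [ r ] ∷ M ∷ [])
                  (λ { (a ∷ b ∷ c ∷ d ∷ e ∷ f ∷ g ∷ h ∷ i ∷ j ∷ []) → a ⊕ b ⊕ c ⊕ d ⊕ e ≈ f , b ⊕ c ⊕ g ⊕ h ≈ f ∷
                        i ⊕ j ⊕ a ≈ g ⊕ h ∷ d ⊕ e ≈ i ⊕ j ∷ [] })
                  refl (p ∷ ↭-sym (↭-reflexive eq) ∷ ↭-sym (↭-reflexive eq′) ∷ []))

      no-hamiltonian-cycle : ∀ {c L} → Walk c L c → ¬ (L ↭ all)
      no-hamiltonian-cycle {L = L} w p = not-all-small λ v →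
        let (L′ , w′ , q) = rotate-closed w (Perm.∈-resp-↭ (↭-sym p) (covers v)) in on-cycle w′ (↭-trans q p)

      impossible : ⊥
      impossible = traceable λ (x , L , e , w , p) → from L w p
        where
        from : ∀ {x e} L → Walk x L e → x ∷ L ↭ all → ⊥
        from [] w p = (absurd (n ∷ [])
            (λ { (a ∷ []) → 𝟙 ⊕ 𝟙 ≼ a ∷ a ≼ ∅ ∷ [] })
            refl (2≤n ∷ ≡⇒≥ (size-rest p) ∷ []))
        from {x} {e} (v ∷ L) w p = open-walk w p λ e→x →
          no-hamiltonian-cycle (w ⧺ [ e→x ]ʷ) (permute ([ v ] ∷ L ∷ [ x ] ∷ all ∷ [])
              (λ { (a ∷ b ∷ c ∷ d ∷ []) → a ⊕ b ⊕ c ≈ d , c ⊕ a ⊕ b ≈ d ∷ [] })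
              refl (p ∷ []))

-- Decidability of the conclusion by finite search

Searchable : Set → Set₁
Searchable A = ∀ {P : A → Set} → (∀ a → Dec (P a)) → Dec (Σ A P)

search-Bool : Searchable Bool
search-Bool P? = map′ (λ { (inj₁ p) → true , p ; (inj₂ p) → false , p }) (λ { (true , p) → inj₁ p ; (false , p) → inj₂ p }) (P? true ⊎-dec P? false)

cons : ∀ {A : Set} {k} → A → (Fin k → A) → Fin (suc k) → A
cons a f zero = a
cons a f (suc i) = f i

-- The search meets only functions rebuilt by `cons`, which agree pointwise with the given one;
-- hence the demand that `Q` respects pointwise equality.
search-function : ∀ k {A} → Searchable A → {Q : (Fin k → A) → Set} →
                  (∀ {f g} → (∀ i → f i ≡ g i) → Q f → Q g) → (∀ f → Dec (Q f)) → Dec (Σ (Fin k → A) Q)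
search-function zero search ext Q? = map′ (λ q → _ , q) (λ (f , q) → ext (λ ()) q) (Q? λ ())
search-function (suc k) search {Q} ext Q? =
  map′ (λ (a , f , q) → cons a f , q) (λ (f , q) → f zero , f ∘ suc , ext (λ { zero → refl ; (suc i) → refl }) q)
       (search λ a → search-function k search (λ h → ext λ { zero → refl ; (suc i) → h i }) (λ f → Q? (cons a f)))

injective? : ∀ {p q} (f : Fin p → Fin q) → Dec (Injective _≡_ _≡_ f)
injective? f = map′ (λ h {x} {y} → h x y) (λ h x y → h) (Fin.all? λ x → Fin.all? λ y → (f x Fin.≟ f y) →-dec (x Fin.≟ y))

bypass? : ∀ {m} (G : Digraph (suc m)) → Dec (HamiltonianBypass G)
bypass? {m} G = search-function (suc m) Fin.any?
  (λ { {f} {g} h (inj , path , closing) →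
    (λ {x} {y} e → inj (trans (h x) (trans e (sym (h y))))) ,
    (λ i → trans (sym (cong₂ (arc G) (h (inject₁ i)) (h (suc i)))) (path i)) ,
    trans (sym (cong₂ (arc G) (h zero) (h (fromℕ m)))) closing })
  (λ v → injective? v ×-dec (Fin.all? λ i → arc G (v (inject₁ i)) (v (suc i)) Bool.≟ true) ×-dec (arc G (v zero) (v (fromℕ m)) Bool.≟ true))

iso? : ∀ {p q} (G : Digraph p) (H : Digraph q) → Dec (G ≅ H)
iso? {p} {q} G H = map′
  (λ (t , f , ft , tf , a) → record { to = t ; from = f ; from∘to = ft ; to∘from = tf ; arc-pres = a })
  (λ φ → let open _≅_ φ in to , from , from∘to , to∘from , arc-pres)
  (search-function p Fin.any?
    (λ { {t} {t′} h (f , ft , tf , a) → f , (λ x → trans (cong f (sym (h x))) (ft x)) , (λ y → trans (sym (h (f y))) (tf y)) ,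
      (λ x y → trans (sym (cong₂ (arc H) (h x) (h y))) (a x y)) })
    λ t → search-function q Fin.any?
      (λ { {f} {f′} h (ft , tf , a) → (λ x → trans (sym (h (t x))) (ft x)) , (λ y → trans (cong t (sym (h y))) (tf y)) , a })
      λ f → (Fin.all? λ x → f (t x) Fin.≟ x) ×-dec (Fin.all? λ y → t (f y) Fin.≟ y) ×-dec
            (Fin.all? λ x → Fin.all? λ y → arc H (t x) (t y) Bool.≟ arc G x y))

countB-ext : ∀ {p} {f g : Fin p → Bool} → (∀ i → f i ≡ g i) → countB f ≡ countB g
countB-ext {zero} h = refl
countB-ext {suc p} h = cong₂ _+_ (cong (λ b → if b then 1 else 0) (h zero)) (countB-ext (h ∘ suc))

D₀-on : ∀ {p} → Digraph p → ℕ → Set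
D₀-on {p} G k = p ≡ 2 * k + 1 × 1 ≤ k × Σ (Fin p → Bool) λ inA → countB inA ≡ k + 1
  × (∀ a a′ → inA a ≡ true → inA a′ ≡ true → arc G a a′ ≡ false)
  × (∀ a b → inA a ≡ true → inA b ≡ false → arc G a b ≡ true × arc G b a ≡ true)

D₀-on? : ∀ {p} (G : Digraph p) k → Dec (D₀-on G k)
D₀-on? {p} G k = (p Nat.≟ 2 * k + 1) ×-dec (1 Nat.≤? k) ×-dec search-function p search-Bool
  (λ { {f} {g} h (c , i , j) → trans (sym (countB-ext h)) c , (λ a a′ e e′ → i a a′ (trans (h a) e) (trans (h a′) e′)) ,
    (λ a b e e′ → j a b (trans (h a) e) (trans (h b) e′)) })
  (λ f → (countB f Nat.≟ k + 1) ×-dec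
    (Fin.all? λ a → Fin.all? λ a′ → (f a Bool.≟ true) →-dec ((f a′ Bool.≟ true) →-dec (arc G a a′ Bool.≟ false))) ×-dec
    (Fin.all? λ a → Fin.all? λ b → (f a Bool.≟ true) →-dec ((f b Bool.≟ false) →-dec ((arc G a b Bool.≟ true) ×-dec (arc G b a Bool.≟ true)))))

-- The parameters of both families are smaller than the order, so they can range over a finite type,
-- which makes the property decidable.
Exceptional : ∀ {m} → Digraph (suc m) → Set
Exceptional {m} G = (Σ (Fin (suc m)) λ i → D₀-on G (toℕ i))
                  ⊎ (Σ (Fin (suc m)) λ i → 1 ≤ toℕ i × toℕ i ≤ suc m ∸ 2 × G ≅ D (suc m) (toℕ i))
                  ⊎ G ≅ T5
                  ⊎ G ≅ C3

exceptional? : ∀ {m} (G : Digraph (suc m)) → Dec (Exceptional G)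
exceptional? {m} G = (Fin.any? λ i → D₀-on? G (toℕ i))
              ⊎-dec ((Fin.any? λ i → (1 Nat.≤? toℕ i) ×-dec (toℕ i Nat.≤? (suc m ∸ 2)) ×-dec iso? G (D (suc m) (toℕ i)))
              ⊎-dec (iso? G T5 ⊎-dec iso? G C3))

-- From lists of vertices to bypasses and isomorphisms

unique-↭ : ∀ {p} {L : List (Fin p)} → L ↭ allFin p → Unique L
unique-↭ {p} q = Permₛ.Unique-resp-↭ (setoid (Fin p)) (↭⇒↭ₛ (↭-sym q)) (allFin⁺ p)
  where
  import Data.List.Relation.Binary.Permutation.Setoid.Properties as Permₛ
  open import Data.List.Relation.Binary.Permutation.Propositional using (↭⇒↭ₛ)
  open import Relation.Binary.PropositionalEquality using (setoid)
  open import Data.List.Relation.Unary.Unique.Propositional.Properties using (allFin⁺)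

lookup-unique : ∀ {A : Set} {L : List A} → Unique L → ∀ i j → lookup L i ≡ lookup L j → i ≡ j
lookup-unique (_ ∷ u) zero zero e = refl
lookup-unique {L = x ∷ L} (h ∷ u) zero (suc j) e = ⊥-elim (All.lookup h (Mem.∈-lookup j) e)
lookup-unique {L = x ∷ L} (h ∷ u) (suc i) zero e = ⊥-elim (All.lookup h (Mem.∈-lookup i) (sym e))
lookup-unique (h ∷ u) (suc i) (suc j) e = cong suc (lookup-unique u i j e)

-- Vertices correspond to their positions in `L`. Keeping `H` on `Fin (length L)` lets the order of
-- a concrete list compute.
list-iso : ∀ {p} (G : Digraph p) (L : List (Fin p)) → L ↭ allFin p → (H : Digraph (length L)) →
           (∀ i j → arc H i j ≡ arc G (lookup L i) (lookup L j)) → G ≅ H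
list-iso {p} G L q H h = record
  { to = position
  ; from = lookup L
  ; from∘to = at
  ; to∘from = λ i → lookup-unique (unique-↭ q) _ _ (at (lookup L i))
  ; arc-pres = λ x y → trans (h (position x) (position y)) (cong₂ (arc G) (at x) (at y))
  }
  where
  position : Fin p → Fin (length L)
  position x = Data.List.Relation.Unary.Any.index (Perm.∈-resp-↭ (↭-sym q) (Mem.∈-allFin x))
  at : ∀ x → lookup L (position x) ≡ x
  at x = sym (lookup-index (Perm.∈-resp-↭ (↭-sym q) (Mem.∈-allFin x)))
    where open import Data.List.Relation.Unary.Any.Properties using (lookup-index)

module _ {m} (G : Digraph (suc m)) where
  open Walks (arc G)

  walk-bypass : ∀ {x L y} → Walk x L y → x ∷ L ↭ allFin (suc m) → E x y → HamiltonianBypass G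
  walk-bypass {x} {L} {y} w p e = from (ℕ.suc-injective (trans (Perm.↭-length p) (List.length-tabulate id)))
    where
    steps : ∀ {x L y} → Walk x L y → ∀ i → E (lookup (x ∷ L) (inject₁ i)) (lookup (x ∷ L) (suc i))
    steps (e ▹ w) zero = e
    steps (e ▹ w) (suc i) = steps w i
    last : ∀ {x L y} → Walk x L y → lookup (x ∷ L) (fromℕ (length L)) ≡ y
    last nil = refl
    last (e ▹ w) = last w
    Bypass : ℕ → Set
    Bypass k = Σ (Fin (suc k) → Fin (suc m)) λ v → Injective _≡_ _≡_ v × (∀ (i : Fin k) → E (v (inject₁ i)) (v (suc i))) × E (v zero) (v (fromℕ k))
    from : ∀ {k} → length L ≡ k → Bypass k
    from refl = lookup (x ∷ L) , (λ {i} {j} → lookup-unique (unique-↭ p) i j) , steps w , subst (E x) (sym (last w)) e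

  countB-∑ : ∀ {p} (f : Fin p → Bool) → countB f ≡ ∑ (λ v → if f v then 1 else 0) (allFin p)
  countB-∑ {p} f = go f id
    where
    go : ∀ {k} (f : Fin p → Bool) (g : Fin k → Fin p) → countB (f ∘ g) ≡ ∑ (λ v → if f v then 1 else 0) (tabulate g)
    go {zero} f g = refl
    go {suc k} f g = cong (_ +_) (go f (g ∘ suc))

region : ∀ {V : Set} (A : List V) κ B (i : Fin (length (A ++ κ ∷ B))) →
         (toℕ i < length A × lookup (A ++ κ ∷ B) i ∈ A)
         ⊎ (toℕ i ≡ length A × lookup (A ++ κ ∷ B) i ≡ κ)
         ⊎ (length A < toℕ i × lookup (A ++ κ ∷ B) i ∈ B)
region [] κ B zero = inj₂ (inj₁ (refl , refl))
region [] κ B (suc i) = inj₂ (inj₂ (s≤s z≤n , Mem.∈-lookup i))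
region (a ∷ A) κ B zero = inj₁ (s≤s z≤n , here refl)
region (a ∷ A) κ B (suc i) with region A κ B i
... | inj₁ (l , j) = inj₁ (s≤s l , there j)
... | inj₂ (inj₁ (e , e′)) = inj₂ (inj₁ (cong suc e , e′))
... | inj₂ (inj₂ (l , j)) = inj₂ (inj₂ (s≤s l , j))

module _ {p} (G : Digraph p) where
  open Walks (arc G)

  no-arc : ∀ {x y} → ¬ E x y → arc G x y ≡ false
  no-arc {x} {y} h with arc G x y
  ... | true = ⊥-elim (h refl)
  ... | false = refl

  -- Listing A, κ, B in this order puts κ at index `length A`, the index shared by the two cliques
  -- of `D`.
  glued-iso : ∀ A κ B → A ++ κ ∷ B ↭ allFin p →
    (∀ {x y} → x ∈ (κ ∷ A) → y ∈ (κ ∷ A) → x ≢ y → E x y) →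
    (∀ {x y} → x ∈ (κ ∷ B) → y ∈ (κ ∷ B) → x ≢ y → E x y) →
    (∀ {x y} → x ∈ A → y ∈ B → NonAdj x y) → G ≅ D (length (A ++ κ ∷ B)) (length B)
  glued-iso A κ B q in-A in-B apart = list-iso G L q (D (length L) (length B)) table
    where
    L = A ++ κ ∷ B
    size-A : length L ∸ length B ≡ suc (length A)
    size-A = trans (cong (_∸ length B) (trans (List.length-++ A) (ℕ.+-suc (length A) (length B)))) (ℕ.m+n∸n≡m (suc (length A)) (length B))
    low high : Fin (length L) → Bool
    low i = does (suc (toℕ i) Nat.≤? length L ∸ length B)
    high i = does (length L ∸ length B ∸ 1 Nat.≤? toℕ i)
    low-yes : ∀ i → toℕ i ≤ length A → low i ≡ true
    low-yes i h = dec-true (suc (toℕ i) Nat.≤? _) (subst (suc (toℕ i) ≤_) (sym size-A) (s≤s h))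
      where open import Relation.Nullary.Decidable using (dec-true)
    low-no : ∀ i → length A < toℕ i → low i ≡ false
    low-no i h = dec-false (suc (toℕ i) Nat.≤? _) λ l → ℕ.<⇒≱ h (ℕ.≤-pred (subst (suc (toℕ i) ≤_) size-A l))
      where open import Relation.Nullary.Decidable using (dec-false)
    high-yes : ∀ i → length A ≤ toℕ i → high i ≡ true
    high-yes i h = dec-true (_ Nat.≤? toℕ i) (subst (_≤ toℕ i) (sym (cong (_∸ 1) size-A)) h)
      where open import Relation.Nullary.Decidable using (dec-true)
    high-no : ∀ i → toℕ i < length A → high i ≡ false
    high-no i h = dec-false (_ Nat.≤? toℕ i) λ l → ℕ.<⇒≱ h (subst (_≤ toℕ i) (cong (_∸ 1) size-A) l)
      where open import Relation.Nullary.Decidable using (dec-false)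
    Place : Fin (length L) → Set
    Place i = (low i ≡ true × high i ≡ false × lookup L i ∈ A)
            ⊎ (low i ≡ true × high i ≡ true × lookup L i ≡ κ)
            ⊎ (low i ≡ false × high i ≡ true × lookup L i ∈ B)
    place : ∀ i → Place i
    place i with region A κ B i
    ... | inj₁ (l , j) = inj₁ (low-yes i (ℕ.<⇒≤ l) , high-no i l , j)
    ... | inj₂ (inj₁ (e , e′)) = inj₂ (inj₁ (low-yes i (ℕ.≤-reflexive e) , high-yes i (ℕ.≤-reflexive (sym e)) , e′))
    ... | inj₂ (inj₂ (l , j)) = inj₂ (inj₂ (low-no i l , high-yes i (ℕ.<⇒≤ l) , j))
    entries : ∀ {i j b b′ c c′} → low i ≡ b → low j ≡ b′ → high i ≡ c → high j ≡ c′ →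
              (low i ∧ low j) ∨ (high i ∧ high j) ≡ (b ∧ b′) ∨ (c ∧ c′)
    entries l l′ h h′ = cong₂ _∨_ (cong₂ _∧_ l l′) (cong₂ _∧_ h h′)
    off-diagonal : ∀ i j → lookup L i ≢ lookup L j → Place i → Place j →
                   (low i ∧ low j) ∨ (high i ∧ high j) ≡ arc G (lookup L i) (lookup L j)
    off-diagonal i j x≢y (inj₁ (l , h , k)) (inj₁ (l′ , h′ , k′)) = trans (entries l l′ h h′) (sym (in-A (there k) (there k′) x≢y))
    off-diagonal i j x≢y (inj₁ (l , h , k)) (inj₂ (inj₁ (l′ , h′ , k′))) = trans (entries l l′ h h′) (sym (in-A (there k) (here k′) x≢y))
    off-diagonal i j x≢y (inj₁ (l , h , k)) (inj₂ (inj₂ (l′ , h′ , k′))) = trans (entries l l′ h h′) (sym (no-arc (proj₁ (apart k k′))))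
    off-diagonal i j x≢y (inj₂ (inj₁ (l , h , k))) (inj₁ (l′ , h′ , k′)) = trans (entries l l′ h h′) (sym (in-A (here k) (there k′) x≢y))
    off-diagonal i j x≢y (inj₂ (inj₁ (l , h , k))) (inj₂ (inj₁ (l′ , h′ , k′))) = ⊥-elim (x≢y (trans k (sym k′)))
    off-diagonal i j x≢y (inj₂ (inj₁ (l , h , k))) (inj₂ (inj₂ (l′ , h′ , k′))) = trans (entries l l′ h h′) (sym (in-B (here k) (there k′) x≢y))
    off-diagonal i j x≢y (inj₂ (inj₂ (l , h , k))) (inj₁ (l′ , h′ , k′)) = trans (entries l l′ h h′) (sym (no-arc (proj₂ (apart k′ k))))
    off-diagonal i j x≢y (inj₂ (inj₂ (l , h , k))) (inj₂ (inj₁ (l′ , h′ , k′))) = trans (entries l l′ h h′) (sym (in-B (there k) (here k′) x≢y))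
    off-diagonal i j x≢y (inj₂ (inj₂ (l , h , k))) (inj₂ (inj₂ (l′ , h′ , k′))) = trans (entries l l′ h h′) (sym (in-B (there k) (there k′) x≢y))
    table : ∀ i j → arc (D (length L) (length B)) i j ≡ arc G (lookup L i) (lookup L j)
    table i j with i Fin.≟ j
    ... | yes refl = sym (loopless G (lookup L i))
    ... | no i≢j = off-diagonal i j (λ e → i≢j (lookup-unique (unique-↭ q) i j e)) (place i) (place j)

-- The counterexample attached to a digraph on `Fin`

module _ {m} (G : Digraph (suc m)) (2≤m : 2 ≤ m)
         (cond : ∀ x y → NonAdjacent G x y → 2 * suc m ∸ 2 ≤ deg G x + deg G y)
         (no-HB : ¬ HamiltonianBypass G) (no-exception : ¬ Exceptional G) where

  private
    V = Fin (suc m)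
    vertices : List V
    vertices = allFin (suc m)

    repetition-free : ∀ {x : V} {L} → ¬ (x ∷ x ∷ L ↭ vertices)
    repetition-free q with unique-↭ q
    ... | (x≢x ∷ _) ∷ _ = x≢x refl

    order : length vertices ≡ suc m
    order = List.length-tabulate id

  open Spanning vertices repetition-free m order (arc G) (loopless G)

  degree : ∀ x → deg G x ≡ δ x
  degree x = cong₂ _+_ (countB-∑ G (λ y → arc G x y)) (countB-∑ G (λ y → arc G y x))

  ore : ∀ {x y} → x ≢ y → NonAdj x y → m + m ≤ δ x + δ y
  ore {x} {y} x≢y (h , h′) = subst₂ _≤_ twice (cong₂ _+_ (degree x) (degree y)) (cond x y (x≢y , no-arc G h , no-arc G h′))
    where
    twice : 2 * suc m ∸ 2 ≡ m + m
    twice = trans (cong (λ k → m + suc k ∸ 1) (ℕ.+-identityʳ m)) (cong (_∸ 1) (ℕ.+-suc m m))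

  no-bypass : ∀ {x L y} → Walk x L y → x ∷ L ↭ vertices → ¬ E x y
  no-bypass w q e = no-HB (walk-bypass G w q e)

  open Extremal ore no-bypass using (tight-end; complete-arc)

  no-D₀ : ∀ A B → A ++ B ↭ vertices → length A ≡ suc (length B) →
          (∀ {a a′} → a ∈ A → a′ ∈ A → NonAdj a a′) → (∀ {a b} → a ∈ A → b ∈ B → E a b × E b a) → ⊥
  no-D₀ A B q eq indep compl = no-exception (inj₁ (Fin.fromℕ< b<p , subst (D₀-on G) (sym (Fin.toℕ-fromℕ< b<p))
      (order-G , 1≤b , inA , count-A , (λ a a′ e e′ → no-arc G (proj₁ (indep (true⇒∈ e) (true⇒∈ e′)))) , λ a b e e′ → compl (true⇒∈ e) (false⇒∈ e′))))
    where
    open import Data.List.Membership.DecPropositional {A = V} Fin._≟_ using (_∈?_)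
    inA : V → Bool
    inA v = does (v ∈? A)
    sizes : length A + length B ≡ suc m
    sizes = trans (sym (List.length-++ A)) (trans (Perm.↭-length q) order)
    b<p : length B < suc m
    b<p = ℕ.≰⇒> λ h → (absurd (m ∷ (length B) ∷ (length A) ∷ [])
        (λ { (a ∷ b ∷ c ∷ []) → 𝟙 ⊕ a ≼ b ∷ 𝟙 ⊕ a ≼ b ∷ 𝟙 ⊕ b ≼ c ∷ c ⊕ b ≼ 𝟙 ⊕ a ∷ [] })
        refl (h ∷ h ∷ ≡⇒≥ eq ∷ ≡⇒≤ sizes ∷ []))
    order-G : suc m ≡ 2 * length B + 1
    order-G = trans (sym sizes) (trans (cong (_+ length B) eq) (trans (ℕ.+-comm 1 _) (cong (λ k → length B + k + 1) (sym (ℕ.+-identityʳ _)))))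
    1≤b : 1 ≤ length B
    1≤b = ℕ.≮⇒≥ λ h → (absurd ((length B) ∷ (length A) ∷ m ∷ [])
        (λ { (a ∷ b ∷ c ∷ []) → 𝟙 ⊕ a ≼ 𝟙 ∷ 𝟙 ⊕ a ≼ 𝟙 ∷ b ≼ 𝟙 ⊕ a ∷ 𝟙 ⊕ c ≼ b ⊕ a ∷ 𝟙 ⊕ 𝟙 ≼ c ∷ [] })
        refl (h ∷ h ∷ ≡⇒≤ eq ∷ ≡⇒≥ sizes ∷ 2≤m ∷ []))
    true⇒∈ : ∀ {v} → inA v ≡ true → v ∈ A
    true⇒∈ {v} e with v ∈? A
    ... | yes i = i
    true⇒∈ () | no _
    false⇒∈ : ∀ {v} → inA v ≡ false → v ∈ B
    false⇒∈ {v} e with v ∈? A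
    false⇒∈ () | yes _
    ... | no v∉A with Mem.∈-++⁻ A (Perm.∈-resp-↭ (↭-sym q) (Mem.∈-allFin v))
    ...   | inj₁ i = ⊥-elim (v∉A i)
    ...   | inj₂ i = i
    disjoint : ∀ {v} → v ∈ A → ¬ v ∈ B
    disjoint {v} i j = let (A₁ , A₂ , e) = Mem.∈-∃++ i ; (B₁ , B₂ , e′) = Mem.∈-∃++ j in
      repetition-free (permute ([ v ] ∷ A₁ ∷ A₂ ∷ B₁ ∷ B₂ ∷ vertices ∷ A ∷ B ∷ [])
          (λ { (a ∷ b ∷ c ∷ d ∷ e ∷ f ∷ g ∷ h ∷ []) → a ⊕ a ⊕ b ⊕ c ⊕ d ⊕ e ≈ f , g ⊕ h ≈ f ∷ b ⊕ a ⊕ c ≈ g ∷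
                d ⊕ a ⊕ e ≈ h ∷ [] })
          refl (q ∷ ↭-sym (↭-reflexive e) ∷ ↭-sym (↭-reflexive e′) ∷ []))
    χ-in : V → ℕ
    χ-in v = if inA v then 1 else 0
    all-in : ∀ L → (∀ {v} → v ∈ L → v ∈ A) → ∑ χ-in L ≡ length L
    all-in [] h = refl
    all-in (v ∷ L) h with v ∈? A
    ... | yes _ = cong suc (all-in L (h ∘ there))
    ... | no v∉A = ⊥-elim (v∉A (h (here refl)))
    none-in : ∀ L → (∀ {v} → v ∈ L → ¬ v ∈ A) → ∑ χ-in L ≡ 0
    none-in [] h = refl
    none-in (v ∷ L) h with v ∈? A
    ... | yes i = ⊥-elim (h (here refl) i)
    ... | no _ = none-in L (h ∘ there)
    count-A : countB inA ≡ length B + 1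
    count-A = trans (countB-∑ G inA) (trans (∑-↭ χ-in (↭-sym q)) (trans (∑-++ χ-in A B)
      (trans (cong₂ _+_ (all-in A id) (none-in B λ j i → disjoint i j)) (trans (ℕ.+-identityʳ _) (trans eq (ℕ.+-comm 1 _))))))

  -- `tight-end` with the middle reduced to κ: the insertion conditions are void, and the equalities
  -- make each side a clique joined to κ by all arcs.
  no-cliques : ∀ {x M κ ν N} → (x ∷ M) ++ κ ∷ ν ∷ N ↭ vertices →
               (∀ {x′ y} → x′ ∈ (x ∷ M) → y ∈ (ν ∷ N) → NonAdj x′ y) → ⊥
  no-cliques {x} {M} {κ} {ν} {N} q apart-MN = no-exception (inj₂ (inj₁ (Fin.fromℕ< k<p ,
      subst (λ k → 1 ≤ k × k ≤ suc m ∸ 2 × G ≅ D (suc m) k) (sym (Fin.toℕ-fromℕ< k<p))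
        (s≤s z≤n , k≤ , subst (λ p → G ≅ D p (length (ν ∷ N))) sizes (glued-iso G (x ∷ M) κ (ν ∷ N) q within-M within-N apart-MN)))))
    where
    sizes : length ((x ∷ M) ++ κ ∷ ν ∷ N) ≡ suc m
    sizes = trans (Perm.↭-length q) order
    k≤ : length (ν ∷ N) ≤ suc m ∸ 2
    k≤ = ℕ.≤-trans (ℕ.m≤n+m (length (ν ∷ N)) (length M)) (ℕ.≤-reflexive (trans (cong (_∸ 2)
           (sym (cong suc (trans (List.length-++ M) (ℕ.+-suc (length M) _))))) (cong (_∸ 2) sizes)))
    k<p : length (ν ∷ N) < suc m
    k<p = s≤s (ℕ.≤-trans k≤ (ℕ.m∸n≤m m 1))
    q′ : (ν ∷ N) ++ (κ ∷ []) ++ (x ∷ M) ↭ vertices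
    q′ = (permute ([ ν ] ∷ N ∷ [ κ ] ∷ [ x ] ∷ M ∷ vertices ∷ [])
        (λ { (a ∷ b ∷ c ∷ d ∷ e ∷ f ∷ []) → (a ⊕ b) ⊕ c ⊕ d ⊕ e ≈ f , (d ⊕ e) ⊕ c ⊕ a ⊕ b ≈ f ∷ [] })
        refl (q ∷ []))
    within-M : ∀ {u v} → u ∈ (κ ∷ x ∷ M) → v ∈ (κ ∷ x ∷ M) → u ≢ v → E u v
    within-M (here refl) (here refl) h = ⊥-elim (h refl)
    within-M (here refl) (there j) h = proj₁ (proj₂ (proj₂ (tight-end nil q apart-MN j (here refl) [-] [-])))
    within-M (there i) (here refl) h = proj₁ (proj₂ (tight-end nil q apart-MN i (here refl) [-] [-]))
    within-M (there i) (there j) h = complete-arc i j h (proj₁ (tight-end nil q apart-MN i (here refl) [-] [-]))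
    apart-NM : ∀ {u v} → u ∈ (ν ∷ N) → v ∈ (x ∷ M) → NonAdj u v
    apart-NM i j = let (h , h′) = apart-MN j i in h′ , h
    within-N : ∀ {u v} → u ∈ (κ ∷ ν ∷ N) → v ∈ (κ ∷ ν ∷ N) → u ≢ v → E u v
    within-N (here refl) (here refl) h = ⊥-elim (h refl)
    within-N (here refl) (there j) h = proj₁ (proj₂ (proj₂ (tight-end nil q′ apart-NM j (here refl) [-] [-])))
    within-N (there i) (here refl) h = proj₁ (proj₂ (tight-end nil q′ apart-NM i (here refl) [-] [-]))
    within-N (there i) (there j) h = complete-arc i j h (proj₁ (tight-end nil q′ apart-NM i (here refl) [-] [-]))

  Dominates : V → V → Set
  Dominates u v = E u v × ¬ E v u

  no-T₅ : ∀ {z₁ z₂ z₃ z₄ w} → z₁ ∷ z₂ ∷ z₃ ∷ z₄ ∷ w ∷ [] ↭ vertices →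
          Dominates z₁ z₂ → Dominates z₂ z₃ → Dominates z₃ z₄ → Dominates z₄ z₁ →
          Dominates z₁ w → Dominates z₃ w → Dominates w z₂ → Dominates w z₄ →
          Dominates z₁ z₃ → Dominates z₂ z₄ → ⊥
  no-T₅ {z₁} {z₂} {z₃} {z₄} {w} q (e₁ , f₁) (e₂ , f₂) (e₃ , f₃) (e₄ , f₄) (e₅ , f₅) (e₆ , f₆) (e₇ , f₇) (e₈ , f₈) (e₉ , f₉) (e₀ , f₀) =
    no-exception (inj₂ (inj₂ (inj₁ (list-iso G (z₁ ∷ z₂ ∷ z₃ ∷ z₄ ∷ w ∷ []) q T5 table))))
    where
    L = z₁ ∷ z₂ ∷ z₃ ∷ z₄ ∷ w ∷ []
    table : ∀ i j → arc T5 i j ≡ arc G (lookup L i) (lookup L j)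
    table zero zero = sym (loopless G z₁)
    table zero (suc zero) = sym e₁
    table zero (suc (suc zero)) = sym e₉
    table zero (suc (suc (suc zero))) = sym (no-arc G f₄)
    table zero (suc (suc (suc (suc zero)))) = sym e₅
    table (suc zero) zero = sym (no-arc G f₁)
    table (suc zero) (suc zero) = sym (loopless G z₂)
    table (suc zero) (suc (suc zero)) = sym e₂
    table (suc zero) (suc (suc (suc zero))) = sym e₀
    table (suc zero) (suc (suc (suc (suc zero)))) = sym (no-arc G f₇)
    table (suc (suc zero)) zero = sym (no-arc G f₉)
    table (suc (suc zero)) (suc zero) = sym (no-arc G f₂)
    table (suc (suc zero)) (suc (suc zero)) = sym (loopless G z₃)
    table (suc (suc zero)) (suc (suc (suc zero))) = sym e₃
    table (suc (suc zero)) (suc (suc (suc (suc zero)))) = sym e₆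
    table (suc (suc (suc zero))) zero = sym e₄
    table (suc (suc (suc zero))) (suc zero) = sym (no-arc G f₀)
    table (suc (suc (suc zero))) (suc (suc zero)) = sym (no-arc G f₃)
    table (suc (suc (suc zero))) (suc (suc (suc zero))) = sym (loopless G z₄)
    table (suc (suc (suc zero))) (suc (suc (suc (suc zero)))) = sym (no-arc G f₈)
    table (suc (suc (suc (suc zero)))) zero = sym (no-arc G f₅)
    table (suc (suc (suc (suc zero)))) (suc zero) = sym e₇
    table (suc (suc (suc (suc zero)))) (suc (suc zero)) = sym (no-arc G f₆)
    table (suc (suc (suc (suc zero)))) (suc (suc (suc zero))) = sym e₈
    table (suc (suc (suc (suc zero)))) (suc (suc (suc (suc zero)))) = sym (loopless G w)

  no-C₃ : ∀ {x y z} → x ∷ y ∷ z ∷ [] ↭ vertices → Dominates x y → Dominates y z → Dominates z x → ⊥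
  no-C₃ {x} {y} {z} q (e₁ , f₁) (e₂ , f₂) (e₃ , f₃) = no-exception (inj₂ (inj₂ (inj₂ (list-iso G L q C3 table))))
    where
    L = x ∷ y ∷ z ∷ []
    table : ∀ i j → arc C3 i j ≡ arc G (lookup L i) (lookup L j)
    table zero zero = sym (loopless G x)
    table zero (suc zero) = sym e₁
    table zero (suc (suc zero)) = sym (no-arc G f₃)
    table (suc zero) zero = sym (no-arc G f₁)
    table (suc zero) (suc zero) = sym (loopless G y)
    table (suc zero) (suc (suc zero)) = sym e₂
    table (suc (suc zero)) zero = sym e₃
    table (suc (suc zero)) (suc zero) = sym (no-arc G f₂)
    table (suc (suc zero)) (suc (suc zero)) = sym (loopless G z)

  counterexample : Counterexample
  counterexample = record
    { V = V ; all = vertices ; covers = Mem.∈-allFin ; nodup = repetition-free ; n = m ; size = order ; arcs = arc G ; loopless′ = loopless G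
    ; ore = ore ; no-bypass = no-bypass ; no-D₀ = no-D₀ ; no-cliques = no-cliques }

  contradiction : ⊥
  contradiction = NoCounterexample.impossible counterexample 2≤m no-T₅ no-C₃

≅-refl : ∀ {p} (G : Digraph p) → G ≅ G
≅-refl G = record { to = id ; from = id ; from∘to = λ _ → refl ; to∘from = λ _ → refl ; arc-pres = λ _ _ → refl }

classify : ∀ {m} (G : Digraph (suc m)) → (¬ HamiltonianBypass G → ¬ Exceptional G → ⊥) →
    Dec (HamiltonianBypass G) → Dec (Exceptional G) →
    HamiltonianBypass G
    ⊎ (Σ (Digraph (suc m)) λ H → IsTypeD0 H × G ≅ H)
    ⊎ (Σ ℕ λ k → 1 ≤ k × k ≤ suc m ∸ 2 × G ≅ D (suc m) k)
    ⊎ G ≅ T5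
    ⊎ G ≅ C3
classify G h (yes b) _ = inj₁ b
classify G h (no ¬b) (yes (inj₁ (i , d))) = inj₂ (inj₁ (G , (toℕ i , d) , ≅-refl G))
classify G h (no ¬b) (yes (inj₂ (inj₁ (i , d)))) = inj₂ (inj₂ (inj₁ (toℕ i , d)))
classify G h (no ¬b) (yes (inj₂ (inj₂ e))) = inj₂ (inj₂ (inj₂ e))
classify G h (no ¬b) (no ¬e) = ⊥-elim (h ¬b ¬e)

theorem1p18 : ∀ {m} (G : Digraph (suc m)) →
    3 ≤ suc m →
    StronglyConnected G →
    (∀ x y → NonAdjacent G x y → 2 * suc m ∸ 2 ≤ deg G x + deg G y) →
    HamiltonianBypass G
    ⊎ (Σ (Digraph (suc m)) λ H → IsTypeD0 H × G ≅ H)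
    ⊎ (Σ ℕ λ k → 1 ≤ k × k ≤ suc m ∸ 2 × G ≅ D (suc m) k)
    ⊎ G ≅ T5
    ⊎ G ≅ C3
theorem1p18 G (s≤s 2≤m) _ cond = classify G (contradiction G 2≤m cond) (bypass? G) (exceptional? G)
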